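{- Let ZFP be the first-order theory described in the context, and let $(\cdot)^*$ be the translation of ZFP formulas into ZF formulas described in the context. For every axiom $\varphi$ of ZFP, the translated formula $\varphi^*$ is a theorem of ZF (Zermelo–Fraenkel set theory). (Consequently, ZFP is consistent if ZF is.)
   Context: Logic: first-order logic with equality whose only predicate symbols are the binary symbols $\in$, $\pi_1$, $\pi_2$, $=$. Terms are variables or definite descriptions $(\iota x:\varphi)$; $(\iota x:\varphi)$ denotes the unique $x$ satisfying $\varphi$ if there is exactly one, and otherwise denotes a value $\bot$ outside the domain such that any atomic formula (including equality) with $\bot$ as an argument is false. Usual abbreviations ($\wedge,\vee,\leftrightarrow,\exists,\exists!,\notin$, $\forall b\in X:\varphi$ for $\forall b:(b\in X\to\varphi)$, $\exists b\in X:\varphi$ for $\exists b:(b\in X\wedge\varphi)$) are used. ZFP abbreviations: $\mathsf{Pair}(Q):=\exists b:\, b\,\pi_1\, Q$; $\mathsf{Set}(X):=\neg\mathsf{Pair}(X)$; $\forall_{\mathsf{Set}}x:\varphi := \forall x:(\mathsf{Set}(x)\to\varphi)$, $\exists_{\mathsf{Set}}x:\varphi:=\exists x:(\mathsf{Set}(x)\wedge\varphi)$, $\forall_{\mathsf{Pair}}p:\varphi:=\forall p:(\mathsf{Pair}(p)\to\varphi)$, $\iota_{\mathsf{Set}}x:\varphi := \iota x:(\mathsf{Set}(x)\wedge\varphi)$; $X\subseteq Y := \mathsf{Set}(X)\wedge\mathsf{Set}(Y)\wedge\forall c\in X: c\in Y$; $\emptyset := (\iota_{\mathsf{Set}}x:\forall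 a: a\notin x)$. Axioms of ZFP: all instances, for every formula $\varphi$ with free variables among $a,b,c_1,c_2$, of: (S1) $\forall_{\mathsf{Set}}x,y:(\forall a: a\in x\leftrightarrow a\in y)\to x=y$; (S2) $\forall_{\mathsf{Set}}x:\exists y:\forall a:(a\in y\leftrightarrow \exists z\in x: a\in z)$; (S3) $\forall_{\mathsf{Set}}x:\exists y:\forall z:(z\in y\leftrightarrow z\subseteq x)$; (S4) $\exists y: (\exists_{\mathsf{Set}} z:(z\in y\wedge \forall b: b\notin z))\wedge(\forall x\in y:\exists s\in y:\forall c:(c\in s\leftrightarrow(c\in x\vee c=x)))$; (S5) $\forall c_1,c_2,x:(\forall a\in x:\exists! b:\varphi)\to(\exists_{\mathsf{Set}}y:\forall b:(b\in y\leftrightarrow\exists a\in x:\varphi))$; (S6) $\forall_{\mathsf{Set}}x: x=\emptyset\vee(\exists a\in x:\neg\exists b\in x:(b\,\pi_1\,a\vee b\,\pi_2\,a\vee b\in a))$; (P1) $\forall_{\mathsf{Pair}}p:\forall a: a\notin p$; (P2) $\forall a,b:\exists p:(a\,\pi_1\,p\wedge b\,\pi_2\,p)$; (P3) $\forall p:((\exists a: a\,\pi_1\,p)\leftrightarrow(\exists b: b\,\pi_2\,p))$; (P4) $\forall_{\mathsf{Pair}}p:(\exists! a: a\,\pi_1\,p)\wedge(\exists! b: b\,\pi_2\,p)$; (P5) $\forall_{\mathsf{Pair}}p,q:(\forall a:((a\,\pi_1\,p\leftrightarrow a\,\pi_1\,q)\wedge(a\,\pi_2\,p\leftrightarrow a\,\pi_2\,q)))\to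 p=q$. (Abbreviations are expanded before translating.) Model in ZF: $\langle a,b\rangle:=\{\{a\},\{a,b\}\}$ (Kuratowski pair), $A\times B$ the set of Kuratowski pairs $\langle c,d\rangle$ with $c\in A,d\in B$, $0=\emptyset$, $1=\{0\}$. For ordinals define by transfinite recursion $W_0=\emptyset$, $W_{\beta+1}=(\{0\}\times\mathcal P(W_\beta))\cup(\{1\}\times(W_\beta\times W_\beta))$, $W_\lambda=\bigcup_{\beta<\lambda}W_\beta$ for limit $\lambda$. $\mathcal H(X)$ is the ZF formula "$X\in W_\alpha$ for some ordinal $\alpha$". Define $a\,\widehat\in\, x := \exists y:(x=\langle 0,y\rangle\wedge a\in y)$; $a\,\widehat\pi_1\,p:=\exists u,v:(p=\langle 1,\langle u,v\rangle\rangle\wedge a=u)$; $a\,\widehat\pi_2\,p:=\exists u,v:(p=\langle 1,\langle u,v\rangle\rangle\wedge a=v)$. Translation: $(X\in Y)^*:=X^*\,\widehat\in\,Y^*$; $(X\,\pi_1\,Y)^*:=X^*\,\widehat\pi_1\,Y^*$; $(X\,\pi_2\,Y)^*:=X^*\,\widehat\pi_2\,Y^*$; $(X=Y)^*:=X^*=Y^*$; $x^*:=x$ for variables; $(\varphi\to\psi)^*:=\varphi^*\to\psi^*$; $(\neg\varphi)^*:=\neg\varphi^*$; $(\forall x:\varphi)^*:=\forall x:(\mathcal H(x)\to\varphi^*)$; $(\iota x:\varphi)^*:=\iota x:(\mathcal H(x)\wedge\varphi^*)$. -}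

module Defs where

open import Data.Nat using (ℕ; zero; suc)
open import Data.Fin using (Fin; zero; suc)

-- 1. First-order syntax with definite descriptions (scoped de Bruijn).
--    Primitives exactly as in the paper: binary atomic predicates
--    (parameter R), equality, negation, implication, ∀, and ι-terms.
--    Term R n / Formula R n have free variables among Fin n
--    (var zero = innermost bound variable).

infix  7 _≐_
infixr 5 _⇒_
infixr 6 _∧̇_ _∨̇_
infix  5 _⇔_

mutual
  data Term (R : Set) (n : ℕ) : Set where
    var  : Fin n → Term R n
    desc : Formula R (suc n) → Term R n

  data Formula (R : Set) (n : ℕ) : Set where
    rel  : R → Term R n → Term R n → Formula R n
    _≐_  : Term R n → Term R n → Formula R n
    ¬̇_   : Formula R n → Formula R n
    _⇒_  : Formula R n → Formula R n → Formula R n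
    ∀̇    : Formula R (suc n) → Formula R n

liftR : ∀ {n m} → (Fin n → Fin m) → Fin (suc n) → Fin (suc m)
liftR ρ zero    = zero
liftR ρ (suc i) = suc (ρ i)

mutual
  renT : ∀ {R n m} → (Fin n → Fin m) → Term R n → Term R m
  renT ρ (var i)  = var (ρ i)
  renT ρ (desc φ) = desc (renF (liftR ρ) φ)

  renF : ∀ {R n m} → (Fin n → Fin m) → Formula R n → Formula R m
  renF ρ (rel r t u) = rel r (renT ρ t) (renT ρ u)
  renF ρ (t ≐ u)     = renT ρ t ≐ renT ρ u
  renF ρ (¬̇ φ)       = ¬̇ renF ρ φ
  renF ρ (φ ⇒ ψ)     = renF ρ φ ⇒ renF ρ ψ
  renF ρ (∀̇ φ)       = ∀̇ (renF (liftR ρ) φ)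

↑ : ∀ {R n} → Term R n → Term R (suc n)
↑ = renT suc

↑F : ∀ {R n} → Formula R n → Formula R (suc n)
↑F = renF suc

liftS : ∀ {R n m} → (Fin n → Term R m) → Fin (suc n) → Term R (suc m)
liftS σ zero    = var zero
liftS σ (suc i) = ↑ (σ i)

mutual
  subT : ∀ {R n m} → (Fin n → Term R m) → Term R n → Term R m
  subT σ (var i)  = σ i
  subT σ (desc φ) = desc (subF (liftS σ) φ)

  subF : ∀ {R n m} → (Fin n → Term R m) → Formula R n → Formula R m
  subF σ (rel r t u) = rel r (subT σ t) (subT σ u)
  subF σ (t ≐ u)     = subT σ t ≐ subT σ u
  subF σ (¬̇ φ)       = ¬̇ subF σ φ
  subF σ (φ ⇒ ψ)     = subF σ φ ⇒ subF σ ψ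
  subF σ (∀̇ φ)       = ∀̇ (subF (liftS σ) φ)

sub0 : ∀ {R n} → Formula R (suc n) → Term R n → Formula R n
sub0 {R} {n} φ t = subF σ φ
  where
  σ : Fin (suc n) → Term R n
  σ zero    = t
  σ (suc i) = var i

skip1 : ∀ {n} → Fin (suc n) → Fin (suc (suc n))
skip1 zero    = zero
skip1 (suc i) = suc (suc i)

skip2 : ∀ {n} → Fin (suc (suc n)) → Fin (suc (suc (suc n)))
skip2 zero          = zero
skip2 (suc zero)    = suc zero
skip2 (suc (suc i)) = suc (suc (suc i))

v0 : ∀ {R n} → Term R (suc n)
v0 = var zero
v1 : ∀ {R n} → Term R (suc (suc n))
v1 = var (suc zero)
v2 : ∀ {R n} → Term R (suc (suc (suc n)))
v2 = var (suc (suc zero))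
v3 : ∀ {R n} → Term R (suc (suc (suc (suc n))))
v3 = var (suc (suc (suc zero)))
v4 : ∀ {R n} → Term R (suc (suc (suc (suc (suc n)))))
v4 = var (suc (suc (suc (suc zero))))
v5 : ∀ {R n} → Term R (suc (suc (suc (suc (suc (suc n))))))
v5 = var (suc (suc (suc (suc (suc zero)))))

_∨̇_ : ∀ {R n} → Formula R n → Formula R n → Formula R n
φ ∨̇ ψ = (¬̇ φ) ⇒ ψ

_∧̇_ : ∀ {R n} → Formula R n → Formula R n → Formula R n
φ ∧̇ ψ = ¬̇ (φ ⇒ ¬̇ ψ)

_⇔_ : ∀ {R n} → Formula R n → Formula R n → Formula R n
φ ⇔ ψ = (φ ⇒ ψ) ∧̇ (ψ ⇒ φ)

∃̇ : ∀ {R n} → Formula R (suc n) → Formula R n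
∃̇ φ = ¬̇ ∀̇ (¬̇ φ)

∃!̇ : ∀ {R n} → Formula R (suc n) → Formula R n
∃!̇ φ = ∃̇ (φ ∧̇ ∀̇ (renF skip1 φ ⇒ (v0 ≐ v1)))

∀∈[_] : ∀ {R n} → R → Term R n → Formula R (suc n) → Formula R n
∀∈[ m ] t φ = ∀̇ (rel m v0 (↑ t) ⇒ φ)

∃∈[_] : ∀ {R n} → R → Term R n → Formula R (suc n) → Formula R n
∃∈[ m ] t φ = ∃̇ (rel m v0 (↑ t) ∧̇ φ)

closeAll : ∀ {R} (k : ℕ) → Formula R k → Formula R zero
closeAll zero    φ = φ
closeAll (suc k) φ = closeAll k (∀̇ φ)

-- 2. Deductive system: classical first-order logic with (negative)
--    free description semantics — ι-terms may fail to denote, and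
--    atomic formulas/equations with a non-denoting argument are false.
--    Hilbert calculus; T ⊢ φ for a theory T (a predicate on sentences).

E! : ∀ {R n} → Term R n → Formula R n
E! t = ∃̇ (v0 ≐ ↑ t)

infix 3 _⊢_

data _⊢_ {R : Set} (T : Formula R zero → Set) : ∀ {n} → Formula R n → Set where
  ax    : ∀ {n} {φ : Formula R zero} → T φ → T ⊢ renF {n = zero} {m = n} (λ ()) φ
  mp    : ∀ {n} {φ ψ : Formula R n} → T ⊢ (φ ⇒ ψ) → T ⊢ φ → T ⊢ ψ
  gen   : ∀ {n} {φ : Formula R (suc n)} → T ⊢ φ → T ⊢ ∀̇ φ
  ax-K  : ∀ {n} {φ ψ : Formula R n} → T ⊢ (φ ⇒ (ψ ⇒ φ))
  ax-S  : ∀ {n} {φ ψ χ : Formula R n} →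
          T ⊢ ((φ ⇒ (ψ ⇒ χ)) ⇒ ((φ ⇒ ψ) ⇒ (φ ⇒ χ)))
  ax-N  : ∀ {n} {φ ψ : Formula R n} → T ⊢ ((¬̇ φ ⇒ ¬̇ ψ) ⇒ (ψ ⇒ φ))
  ax-∀v : ∀ {n} {φ : Formula R (suc n)} (i : Fin n) → T ⊢ (∀̇ φ ⇒ sub0 φ (var i))
  ax-∀t : ∀ {n} {φ : Formula R (suc n)} (t : Term R n) →
          T ⊢ (E! t ⇒ (∀̇ φ ⇒ sub0 φ t))
  ax-∀⇒ : ∀ {n} {φ : Formula R n} {ψ : Formula R (suc n)} →
          T ⊢ (∀̇ (↑F φ ⇒ ψ) ⇒ (φ ⇒ ∀̇ ψ))
  ax-refl : ∀ {n} (i : Fin n) → T ⊢ (var i ≐ var i)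
  ax-leib : ∀ {n} {φ : Formula R (suc n)} (i j : Fin n) →
            T ⊢ ((var i ≐ var j) ⇒ (sub0 φ (var i) ⇒ sub0 φ (var j)))
  ax-strict-rel₁ : ∀ {n} (r : R) (t u : Term R n) → T ⊢ (rel r t u ⇒ E! t)
  ax-strict-rel₂ : ∀ {n} (r : R) (t u : Term R n) → T ⊢ (rel r t u ⇒ E! u)
  ax-strict-eq₁  : ∀ {n} (t u : Term R n) → T ⊢ ((t ≐ u) ⇒ E! t)
  ax-strict-eq₂  : ∀ {n} (t u : Term R n) → T ⊢ ((t ≐ u) ⇒ E! u)
  -- Lambert's description axiom:  ∀y (y = ιx φ ↔ ∀x (φ ↔ x = y))
  ax-ι  : ∀ {n} (φ : Formula R (suc n)) →
          T ⊢ ∀̇ ((v0 ≐ ↑ (desc φ)) ⇔ ∀̇ (renF skip1 φ ⇔ (v0 ≐ v1)))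

data ZFRel : Set where
  mem : ZFRel

ZTerm : ℕ → Set
ZTerm = Term ZFRel
ZForm : ℕ → Set
ZForm = Formula ZFRel

infix 8 _∈z_
_∈z_ : ∀ {n} → ZTerm n → ZTerm n → ZForm n
t ∈z u = rel mem t u

∀∈z : ∀ {n} → ZTerm n → ZForm (suc n) → ZForm n
∀∈z = ∀∈[ mem ]
∃∈z : ∀ {n} → ZTerm n → ZForm (suc n) → ZForm n
∃∈z = ∃∈[ mem ]

_⊆z_ : ∀ {n} → ZTerm n → ZTerm n → ZForm n
a ⊆z b = ∀̇ ((v0 ∈z ↑ a) ⇒ (v0 ∈z ↑ b))

data ZFAxiom : ZForm zero → Set where
  extensionality : ZFAxiom (∀̇ (∀̇ (∀̇ ((v0 ∈z v2) ⇔ (v0 ∈z v1)) ⇒ (v1 ≐ v0))))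
  pairing : ZFAxiom (∀̇ (∀̇ (∃̇ ((v2 ∈z v0) ∧̇ (v1 ∈z v0)))))
  union : ZFAxiom (∀̇ (∃̇ (∀̇ (∀̇ (((v0 ∈z v1) ∧̇ (v1 ∈z v3)) ⇒ (v0 ∈z v2))))))
  powerset : ZFAxiom (∀̇ (∃̇ (∀̇ ((v0 ⊆z v2) ⇒ (v0 ∈z v1)))))
  infinity : ZFAxiom (∃̇ (∃̇ ((v0 ∈z v1) ∧̇ ∀̇ (¬̇ (v0 ∈z v1)))
                          ∧̇ ∀∈z v0 (∃∈z v1 (∀̇ ((v0 ∈z v1) ⇔ ((v0 ∈z v2) ∨̇ (v0 ≐ v2)))))))
  foundation : ZFAxiom (∀̇ (∃̇ (v0 ∈z v1) ⇒ ∃∈z v0 (¬̇ ∃̇ ((v0 ∈z v2) ∧̇ (v0 ∈z v1)))))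
  -- Separation: for φ with free variables x (= var 0), z (= var 1),
  -- w₁..w_k (the rest):  ∀w̄ ∀z ∃y ∀x (x∈y ↔ (x∈z ∧ φ))
  separation : (k : ℕ) (φ : ZForm (suc (suc k))) →
    ZFAxiom (closeAll k (∀̇ (∃̇ (∀̇ ((v0 ∈z v1) ⇔ ((v0 ∈z v2) ∧̇ renF skip1 φ))))))
  -- Replacement: for φ with free variables y (= var 0), x (= var 1),
  -- A (= var 2), w₁..w_k (the rest):
  -- ∀w̄ ∀A (∀x∈A ∃!y φ → ∃Y ∀x∈A ∃y∈Y φ)
  replacement : (k : ℕ) (φ : ZForm (suc (suc (suc k)))) →
    ZFAxiom (closeAll k (∀̇ (∀∈z v0 (∃!̇ φ)
                           ⇒ ∃̇ (∀∈z v1 (∃∈z v1 (renF skip2 φ))))))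

setOf : ∀ {n} → ZForm (suc n) → ZTerm n
setOf P = desc (∀̇ ((v0 ∈z v1) ⇔ renF skip1 P))

emptyZ : ∀ {n} → ZTerm n
emptyZ = desc (∀̇ (¬̇ (v0 ∈z v1)))

singZ : ∀ {n} → ZTerm n → ZTerm n
singZ a = setOf (v0 ≐ ↑ a)

upairZ : ∀ {n} → ZTerm n → ZTerm n → ZTerm n
upairZ a b = setOf ((v0 ≐ ↑ a) ∨̇ (v0 ≐ ↑ b))

kpair : ∀ {n} → ZTerm n → ZTerm n → ZTerm n
kpair a b = upairZ (singZ a) (upairZ a b)

zeroZ : ∀ {n} → ZTerm n
zeroZ = emptyZ

oneZ : ∀ {n} → ZTerm n
oneZ = singZ zeroZ

succZ : ∀ {n} → ZTerm n → ZTerm n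
succZ a = setOf ((v0 ∈z ↑ a) ∨̇ (v0 ≐ ↑ a))

cupZ : ∀ {n} → ZTerm n → ZTerm n → ZTerm n
cupZ a b = setOf ((v0 ∈z ↑ a) ∨̇ (v0 ∈z ↑ b))

powZ : ∀ {n} → ZTerm n → ZTerm n
powZ a = setOf (v0 ⊆z ↑ a)

prodZ : ∀ {n} → ZTerm n → ZTerm n → ZTerm n
prodZ a b = setOf (∃∈z (↑ a) (∃∈z (↑ (↑ b)) (v2 ≐ kpair v1 v0)))

appZ : ∀ {n} → ZTerm n → ZTerm n → ZTerm n
appZ f b = desc (kpair (↑ b) v0 ∈z ↑ f)

bigUZ : ∀ {n} → ZTerm n → ZTerm n → ZTerm n
bigUZ f β = setOf (∃∈z (↑ β) (v1 ∈z appZ (↑ (↑ f)) v0))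

stepZ : ∀ {n} → ZTerm n → ZTerm n
stepZ Y = cupZ (prodZ (singZ zeroZ) (powZ Y)) (prodZ (singZ oneZ) (prodZ Y Y))

transZ : ∀ {n} → ZTerm n → ZForm n
transZ a = ∀∈z a (v0 ⊆z ↑ a)

-- ordinal: transitive set of transitive sets (ZF has foundation)
ordZ : ∀ {n} → ZTerm n → ZForm n
ordZ a = transZ a ∧̇ ∀∈z a (transZ v0)

funZ : ∀ {n} → ZTerm n → ZForm n
funZ f = ∀∈z f (∃̇ (∃̇ (v2 ≐ kpair v1 v0)))
       ∧̇ ∀̇ (∀̇ (∀̇ (((kpair v2 v1 ∈z ↑ (↑ (↑ f))) ∧̇ (kpair v2 v0 ∈z ↑ (↑ (↑ f))))
                     ⇒ (v1 ≐ v0))))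

domZ : ∀ {n} → ZTerm n → ZTerm n → ZForm n
domZ f D = ∀̇ ((v0 ∈z ↑ D) ⇔ ∃̇ (kpair v1 v0 ∈z ↑ (↑ f)))

limitZ : ∀ {n} → ZTerm n → ZForm n
limitZ β = ¬̇ (β ≐ zeroZ) ∧̇ ¬̇ ∃∈z β (↑ β ≐ succZ v0)

-- recursion clauses of W at β, for the function f:
-- W_0 = ∅,  W_{γ+1} = F(W_γ),  W_λ = ⋃_{γ<λ} W_γ
wClauseZ : ∀ {n} → ZTerm n → ZTerm n → ZForm n
wClauseZ f β =
      ((β ≐ zeroZ) ⇒ (appZ f β ≐ zeroZ))
  ∧̇ (∀∈z β ((↑ β ≐ succZ v0) ⇒ (appZ (↑ f) (↑ β) ≐ stepZ (appZ (↑ f) v0))))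
  ∧̇ (limitZ β ⇒ (appZ f β ≐ bigUZ f β))

-- 𝓗(X): X ∈ W_α for some ordinal α, i.e.
-- ∃α (Ord α ∧ ∃f (f function ∧ dom f = α+1 ∧
--        ∀β ∈ α+1 (clauses of W at β for f) ∧ X ∈ f(α)))
HZ : ∀ {n} → ZTerm n → ZForm n
HZ X = ∃̇ (ordZ v0 ∧̇
          ∃̇ (funZ v0 ∧̇ domZ v0 (succZ v1)
               ∧̇ ∀∈z (succZ v1) (wClauseZ v1 v0)
               ∧̇ (↑ (↑ X) ∈z appZ v0 v1)))

data ZFPRel : Set where
  pmem pi1 pi2 : ZFPRel

PTerm : ℕ → Set
PTerm = Term ZFPRel
PForm : ℕ → Set
PForm = Formula ZFPRel

_∈p_ : ∀ {n} → PTerm n → PTerm n → PForm n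
t ∈p u = rel pmem t u

_π₁_ : ∀ {n} → PTerm n → PTerm n → PForm n
t π₁ u = rel pi1 t u

_π₂_ : ∀ {n} → PTerm n → PTerm n → PForm n
t π₂ u = rel pi2 t u

∀∈p : ∀ {n} → PTerm n → PForm (suc n) → PForm n
∀∈p = ∀∈[ pmem ]
∃∈p : ∀ {n} → PTerm n → PForm (suc n) → PForm n
∃∈p = ∃∈[ pmem ]

PairP : ∀ {n} → PTerm n → PForm n
PairP Q = ∃̇ (v0 π₁ ↑ Q)

SetP : ∀ {n} → PTerm n → PForm n
SetP X = ¬̇ PairP X

∀Set : ∀ {n} → PForm (suc n) → PForm n
∀Set φ = ∀̇ (SetP v0 ⇒ φ)

∃Set : ∀ {n} → PForm (suc n) → PForm n
∃Set φ = ∃̇ (SetP v0 ∧̇ φ)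

∀Pair : ∀ {n} → PForm (suc n) → PForm n
∀Pair φ = ∀̇ (PairP v0 ⇒ φ)

_⊆p_ : ∀ {n} → PTerm n → PTerm n → PForm n
X ⊆p Y = SetP X ∧̇ SetP Y ∧̇ ∀∈p X (v0 ∈p ↑ Y)

emptyP : ∀ {n} → PTerm n
emptyP = desc (SetP v0 ∧̇ ∀̇ (¬̇ (v0 ∈p v1)))

-- Instances of (S5) are indexed by φ : PForm 4 whose free variables
-- var 0, var 1, var 2, var 3 stand for a, b, c₁, c₂ respectively.
-- S5-premise context (inner→outer): b, a, x, c₂, c₁
s5σ₁ : Fin 4 → Fin 5
s5σ₁ zero                   = suc zero
s5σ₁ (suc zero)             = zero
s5σ₁ (suc (suc zero))       = suc (suc (suc (suc zero)))
s5σ₁ (suc (suc (suc zero))) = suc (suc (suc zero))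
-- S5-conclusion context (inner→outer): a, b, y, x, c₂, c₁
s5σ₂ : Fin 4 → Fin 6
s5σ₂ zero                   = zero
s5σ₂ (suc zero)             = suc zero
s5σ₂ (suc (suc zero))       = suc (suc (suc (suc (suc zero))))
s5σ₂ (suc (suc (suc zero))) = suc (suc (suc (suc zero)))

data ZFPAxiom : PForm zero → Set where
  S1 : ZFPAxiom (∀Set (∀Set (∀̇ ((v0 ∈p v2) ⇔ (v0 ∈p v1)) ⇒ (v1 ≐ v0))))
  S2 : ZFPAxiom (∀Set (∃̇ (∀̇ ((v0 ∈p v1) ⇔ ∃∈p v2 (v1 ∈p v0)))))
  S3 : ZFPAxiom (∀Set (∃̇ (∀̇ ((v0 ∈p v1) ⇔ (v0 ⊆p v2)))))
  S4 : ZFPAxiom (∃̇ (∃Set ((v0 ∈p v1) ∧̇ ∀̇ (¬̇ (v0 ∈p v1)))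
                    ∧̇ ∀∈p v0 (∃∈p v1 (∀̇ ((v0 ∈p v1) ⇔ ((v0 ∈p v2) ∨̇ (v0 ≐ v2)))))))
  S5 : (φ : PForm 4) →
    ZFPAxiom (∀̇ (∀̇ (∀̇ (∀∈p v0 (∃!̇ (renF s5σ₁ φ))
                         ⇒ ∃Set (∀̇ ((v0 ∈p v1) ⇔ ∃∈p v2 (renF s5σ₂ φ)))))))
  S6 : ZFPAxiom (∀Set ((v0 ≐ emptyP)
                 ∨̇ ∃∈p v0 (¬̇ ∃∈p v1 ((v0 π₁ v1) ∨̇ (v0 π₂ v1) ∨̇ (v0 ∈p v1)))))
  P1 : ZFPAxiom (∀Pair (∀̇ (¬̇ (v0 ∈p v1))))
  P2 : ZFPAxiom (∀̇ (∀̇ (∃̇ ((v2 π₁ v0) ∧̇ (v1 π₂ v0)))))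
  P3 : ZFPAxiom (∀̇ (∃̇ (v0 π₁ v1) ⇔ ∃̇ (v0 π₂ v1)))
  P4 : ZFPAxiom (∀Pair (∃!̇ (v0 π₁ v1) ∧̇ ∃!̇ (v0 π₂ v1)))
  P5 : ZFPAxiom (∀Pair (∀Pair (∀̇ (((v0 π₁ v2) ⇔ (v0 π₁ v1)) ∧̇ ((v0 π₂ v2) ⇔ (v0 π₂ v1)))
                                ⇒ (v1 ≐ v0))))

memHat : ∀ {n} → ZTerm n → ZTerm n → ZForm n
memHat a x = ∃̇ ((↑ x ≐ kpair zeroZ v0) ∧̇ (↑ a ∈z v0))

pi1Hat : ∀ {n} → ZTerm n → ZTerm n → ZForm n
pi1Hat a p = ∃̇ (∃̇ ((↑ (↑ p) ≐ kpair oneZ (kpair v1 v0)) ∧̇ (↑ (↑ a) ≐ v1)))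

pi2Hat : ∀ {n} → ZTerm n → ZTerm n → ZForm n
pi2Hat a p = ∃̇ (∃̇ ((↑ (↑ p) ≐ kpair oneZ (kpair v1 v0)) ∧̇ (↑ (↑ a) ≐ v0)))

relHat : ∀ {n} → ZFPRel → ZTerm n → ZTerm n → ZForm n
relHat pmem = memHat
relHat pi1  = pi1Hat
relHat pi2  = pi2Hat

mutual
  trT : ∀ {n} → PTerm n → ZTerm n
  trT (var i)  = var i
  trT (desc φ) = desc (HZ v0 ∧̇ trF φ)

  trF : ∀ {n} → PForm n → ZForm n
  trF (rel r t u) = relHat r (trT t) (trT u)
  trF (t ≐ u)     = trT t ≐ trT u
  trF (¬̇ φ)       = ¬̇ trF φ
  trF (φ ⇒ ψ)     = trF φ ⇒ trF ψ
  trF (∀̇ φ)       = ∀̇ (HZ v0 ⇒ trF φ)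

{-# OPTIONS --safe #-}

-- The proof is semantic.  By a constructive completeness theorem in the style of Krivine it suffices
-- that φ* holds in every model of ZF, where a model may interpret absurdity by any proposition.  The
-- term model used for completeness comes from a Henkin–Lindenbaum extension; in it every truth value
-- is ¬¬-stable and every true existential statement has a witness, so that set theory can be done
-- inside it by ordinary classical arguments about Agda propositions.
--
-- In a model of ZF put F(Y) = ({0} × 𝒫(Y)) ∪ ({1} × (Y × Y)).  The three recursion clauses for W amount to
-- W_β = ⋃_{γ < β} F(W_γ).  As a set of elements of H lies in a single W_σ, H contains ⟨0,y⟩ for every set
-- y ⊆ H and ⟨1,⟨u,v⟩⟩ for all u, v ∈ H, and by construction it has no other elements.  All axioms but
-- two are then read off.  For infinity take ⟨0,W_λ⟩ with λ a nonzero ordinal without maximum; for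
-- foundation take an element of x that enters the hierarchy W first.
module Submission where

open import Defs
open import Data.Empty using (⊥; ⊥-elim)
open import Data.Fin using (Fin; zero; suc; toℕ)
open import Data.List using (List; []; _∷_; _++_; map; concatMap; cartesianProduct; cartesianProductWith; upTo; allFin)
open import Data.List.Membership.Propositional using (lose) renaming (_∈_ to _∈ˡ_)
open import Data.List.Membership.Propositional.Properties using (∈-map⁺; ∈-++⁺ˡ; ∈-++⁺ʳ; ∈-cartesianProduct⁺; ∈-cartesianProductWith⁺; ∈-concatMap⁺; ∈-upTo⁺; ∈-allFin)
open import Data.List.Relation.Unary.Any using (here; there)
open import Data.Nat using (ℕ; zero; suc; _+_; _≤_; _<_; _⊔_; z≤n; s≤s; _≟_)
open import Data.Nat.Properties using (≤-refl; ≤-trans; m≤m⊔n; m≤n⊔m; m⊔n≤o⇒m≤o; m⊔n≤o⇒n≤o; n≤1+n; <-irrefl; +-comm; +-suc; +-identityʳ; suc-injective; ⊔-lub)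
open import Data.Product using (Σ; ∃; _×_; _,_; proj₁; proj₂)
open import Data.Sum using (_⊎_; inj₁; inj₂)
open import Data.Vec using (Vec; []; _∷_; lookup; tail)
open import Function using (_∘_; id)
open import Relation.Binary.PropositionalEquality using (_≡_; refl; sym; trans; cong; cong₂; subst; subst₂)
open import Relation.Nullary using (yes; no)

-- Three obstacles shape the proof. Developing set theory inside a Hilbert calculus is hopeless,
-- hence the detour through models; but the ambient logic is constructive, so completeness can
-- neither decide which sentences hold nor assume that ZF is consistent. Letting absurdity be a
-- proposition of the model answers both: an inconsistent theory has a model in which everything is
-- true, and truth need only be stable relative to that absurdity. Next, separation, replacement,
-- ordinal induction and least ordinals exist only for definable predicates, so each predicate is
-- built together with a formula defining it; the same formula yields stability and invariance under
-- the equality of the model. Last, `HZ` mentions the value of f at β as a description that may fail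
-- to denote. The recursion for W is therefore carried out with the relation ⟨β,y⟩ ∈ f, and
-- application terms are read only when `HZ` is compared with the result.

private variable
  R : Set
  n m l : ℕ

-- Renaming and substitution

liftR-∘ : {f : Fin n → Fin m} {g : Fin m → Fin l} {h : Fin n → Fin l} →
          (∀ i → g (f i) ≡ h i) → ∀ i → liftR g (liftR f i) ≡ liftR h i
liftR-∘ eq zero    = refl
liftR-∘ eq (suc i) = cong suc (eq i)

mutual
  renT-∘ : {f : Fin n → Fin m} {g : Fin m → Fin l} {h : Fin n → Fin l} →
           (∀ i → g (f i) ≡ h i) → (t : Term R n) → renT g (renT f t) ≡ renT h t
  renT-∘ eq (var i)  = cong var (eq i)
  renT-∘ eq (desc φ) = cong desc (renF-∘ (liftR-∘ eq) φ)

  renF-∘ : {f : Fin n → Fin m} {g : Fin m → Fin l} {h : Fin n → Fin l} →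
           (∀ i → g (f i) ≡ h i) → (φ : Formula R n) → renF g (renF f φ) ≡ renF h φ
  renF-∘ eq (rel r t u) = cong₂ (rel r) (renT-∘ eq t) (renT-∘ eq u)
  renF-∘ eq (t ≐ u)     = cong₂ _≐_ (renT-∘ eq t) (renT-∘ eq u)
  renF-∘ eq (¬̇ φ)       = cong ¬̇_ (renF-∘ eq φ)
  renF-∘ eq (φ ⇒ ψ)     = cong₂ _⇒_ (renF-∘ eq φ) (renF-∘ eq ψ)
  renF-∘ eq (∀̇ φ)       = cong ∀̇ (renF-∘ (liftR-∘ eq) φ)

liftR-id : {f : Fin n → Fin n} → (∀ i → f i ≡ i) → ∀ i → liftR f i ≡ i
liftR-id eq zero    = refl
liftR-id eq (suc i) = cong suc (eq i)

mutual
  renT-id : {f : Fin n → Fin n} → (∀ i → f i ≡ i) → (t : Term R n) → renT f t ≡ t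
  renT-id eq (var i)  = cong var (eq i)
  renT-id eq (desc φ) = cong desc (renF-id (liftR-id eq) φ)

  renF-id : {f : Fin n → Fin n} → (∀ i → f i ≡ i) → (φ : Formula R n) → renF f φ ≡ φ
  renF-id eq (rel r t u) = cong₂ (rel r) (renT-id eq t) (renT-id eq u)
  renF-id eq (t ≐ u)     = cong₂ _≐_ (renT-id eq t) (renT-id eq u)
  renF-id eq (¬̇ φ)       = cong ¬̇_ (renF-id eq φ)
  renF-id eq (φ ⇒ ψ)     = cong₂ _⇒_ (renF-id eq φ) (renF-id eq ψ)
  renF-id eq (∀̇ φ)       = cong ∀̇ (renF-id (liftR-id eq) φ)

renT-square : {f : Fin n → Fin m} {g : Fin m → Fin l} {k : ℕ} {f′ : Fin n → Fin k} {g′ : Fin k → Fin l} →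
              (∀ i → g (f i) ≡ g′ (f′ i)) → (t : Term R n) → renT g (renT f t) ≡ renT g′ (renT f′ t)
renT-square eq t = trans (renT-∘ eq t) (sym (renT-∘ (λ _ → refl) t))

renF-square : {f : Fin n → Fin m} {g : Fin m → Fin l} {k : ℕ} {f′ : Fin n → Fin k} {g′ : Fin k → Fin l} →
              (∀ i → g (f i) ≡ g′ (f′ i)) → (φ : Formula R n) → renF g (renF f φ) ≡ renF g′ (renF f′ φ)
renF-square eq φ = trans (renF-∘ eq φ) (sym (renF-∘ (λ _ → refl) φ))

renT-↑ : (f : Fin n → Fin m) (t : Term R n) → renT (liftR f) (↑ t) ≡ ↑ (renT f t)
renT-↑ f = renT-square (λ _ → refl)

liftS-ren : {f : Fin n → Fin m} {σ : Fin m → Term R l} {τ : Fin n → Term R l} →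
            (∀ i → σ (f i) ≡ τ i) → ∀ i → liftS σ (liftR f i) ≡ liftS τ i
liftS-ren eq zero    = refl
liftS-ren eq (suc i) = cong ↑ (eq i)

mutual
  subT-ren : {f : Fin n → Fin m} {σ : Fin m → Term R l} {τ : Fin n → Term R l} →
             (∀ i → σ (f i) ≡ τ i) → (t : Term R n) → subT σ (renT f t) ≡ subT τ t
  subT-ren eq (var i)  = eq i
  subT-ren eq (desc φ) = cong desc (subF-ren (liftS-ren eq) φ)

  subF-ren : {f : Fin n → Fin m} {σ : Fin m → Term R l} {τ : Fin n → Term R l} →
             (∀ i → σ (f i) ≡ τ i) → (φ : Formula R n) → subF σ (renF f φ) ≡ subF τ φ
  subF-ren eq (rel r t u) = cong₂ (rel r) (subT-ren eq t) (subT-ren eq u)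
  subF-ren eq (t ≐ u)     = cong₂ _≐_ (subT-ren eq t) (subT-ren eq u)
  subF-ren eq (¬̇ φ)       = cong ¬̇_ (subF-ren eq φ)
  subF-ren eq (φ ⇒ ψ)     = cong₂ _⇒_ (subF-ren eq φ) (subF-ren eq ψ)
  subF-ren eq (∀̇ φ)       = cong ∀̇ (subF-ren (liftS-ren eq) φ)

ren-liftS : {f : Fin m → Fin l} {σ : Fin n → Term R m} {τ : Fin n → Term R l} →
            (∀ i → renT f (σ i) ≡ τ i) → ∀ i → renT (liftR f) (liftS σ i) ≡ liftS τ i
ren-liftS         eq zero    = refl
ren-liftS {f = f} {σ} eq (suc i) = trans (renT-↑ f (σ i)) (cong ↑ (eq i))

mutual
  renT-sub : {f : Fin m → Fin l} {σ : Fin n → Term R m} {τ : Fin n → Term R l} →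
             (∀ i → renT f (σ i) ≡ τ i) → (t : Term R n) → renT f (subT σ t) ≡ subT τ t
  renT-sub eq (var i)  = eq i
  renT-sub eq (desc φ) = cong desc (renF-sub (ren-liftS eq) φ)

  renF-sub : {f : Fin m → Fin l} {σ : Fin n → Term R m} {τ : Fin n → Term R l} →
             (∀ i → renT f (σ i) ≡ τ i) → (φ : Formula R n) → renF f (subF σ φ) ≡ subF τ φ
  renF-sub eq (rel r t u) = cong₂ (rel r) (renT-sub eq t) (renT-sub eq u)
  renF-sub eq (t ≐ u)     = cong₂ _≐_ (renT-sub eq t) (renT-sub eq u)
  renF-sub eq (¬̇ φ)       = cong ¬̇_ (renF-sub eq φ)
  renF-sub eq (φ ⇒ ψ)     = cong₂ _⇒_ (renF-sub eq φ) (renF-sub eq ψ)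
  renF-sub eq (∀̇ φ)       = cong ∀̇ (renF-sub (ren-liftS eq) φ)

liftS-var : {σ : Fin n → Term R m} {f : Fin n → Fin m} →
            (∀ i → σ i ≡ var (f i)) → ∀ i → liftS σ i ≡ var (liftR f i)
liftS-var eq zero    = refl
liftS-var eq (suc i) = cong ↑ (eq i)

mutual
  subT-var : {σ : Fin n → Term R m} {f : Fin n → Fin m} →
             (∀ i → σ i ≡ var (f i)) → (t : Term R n) → subT σ t ≡ renT f t
  subT-var eq (var i)  = eq i
  subT-var eq (desc φ) = cong desc (subF-var (liftS-var eq) φ)

  subF-var : {σ : Fin n → Term R m} {f : Fin n → Fin m} →
             (∀ i → σ i ≡ var (f i)) → (φ : Formula R n) → subF σ φ ≡ renF f φ
  subF-var eq (rel r t u) = cong₂ (rel r) (subT-var eq t) (subT-var eq u)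
  subF-var eq (t ≐ u)     = cong₂ _≐_ (subT-var eq t) (subT-var eq u)
  subF-var eq (¬̇ φ)       = cong ¬̇_ (subF-var eq φ)
  subF-var eq (φ ⇒ ψ)     = cong₂ _⇒_ (subF-var eq φ) (subF-var eq ψ)
  subF-var eq (∀̇ φ)       = cong ∀̇ (subF-var (liftS-var eq) φ)

subT-↑ : {σ : Fin (suc n) → Term R n} → (∀ i → σ (suc i) ≡ var i) → (t : Term R n) → subT σ (↑ t) ≡ t
subT-↑ eq t = trans (subT-ren {τ = var} eq t)
             (trans (subT-var {f = id} (λ _ → refl) t) (renT-id (λ _ → refl) t))

instVar : Fin n → Fin (suc n) → Fin n
instVar i zero    = i
instVar i (suc j) = j

sub0-var : (φ : Formula R (suc n)) (i : Fin n) → sub0 φ (var i) ≡ renF (instVar i) φ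
sub0-var φ i = subF-var (λ { zero → refl ; (suc _) → refl }) φ

renF-sub0 : (f : Fin n → Fin m) (φ : Formula R (suc n)) (t : Term R n) →
            renF f (sub0 φ t) ≡ sub0 (renF (liftR f) φ) (renT f t)
renF-sub0 f φ t = trans (renF-sub {τ = τ} (λ { zero → refl ; (suc _) → refl }) φ)
                        (sym (subF-ren (λ { zero → refl ; (suc _) → refl }) φ))
  where
  τ : Fin _ → Term _ _
  τ zero    = renT f t
  τ (suc i) = var (f i)

skip1-liftR : (f : Fin n → Fin m) (i : Fin (suc n)) →
              liftR (liftR f) (skip1 i) ≡ skip1 (liftR f i)
skip1-liftR f zero    = refl
skip1-liftR f (suc i) = refl

-- Derivations

module Derivations {R : Set} (T : Formula R zero → Set) where

  -- Free variables of a theorem are schematic, so any renaming is allowed, even one that identifies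
  -- variables; this lets variables play the part of constants. Each axiom schema is closed under
  -- renaming once the renaming is moved past `sub0`, `↑` and `skip1`.
  ⊢-ren : {φ : Formula R n} (f : Fin n → Fin m) → T ⊢ φ → T ⊢ renF f φ
  ⊢-ren {m = m} f (ax {φ = φ} a) = subst (T ⊢_) (sym (renF-∘ (λ ()) φ)) (ax {n = m} a)
  ⊢-ren f (mp d e) = mp (⊢-ren f d) (⊢-ren f e)
  ⊢-ren f (gen d)  = gen (⊢-ren (liftR f) d)
  ⊢-ren f ax-K = ax-K
  ⊢-ren f ax-S = ax-S
  ⊢-ren f ax-N = ax-N
  ⊢-ren f (ax-∀v {φ = φ} i) =
    subst (λ χ → T ⊢ (∀̇ (renF (liftR f) φ) ⇒ χ)) (sym (renF-sub0 f φ (var i))) (ax-∀v (f i))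
  ⊢-ren f (ax-∀t {φ = φ} t)
    rewrite renF-sub0 f φ t | renT-↑ f t = ax-∀t (renT f t)
  ⊢-ren f (ax-∀⇒ {φ = φ}) rewrite renF-square {g = liftR f} {f′ = f} {g′ = suc} (λ _ → refl) φ = ax-∀⇒
  ⊢-ren f (ax-refl i) = ax-refl (f i)
  ⊢-ren f (ax-leib {φ = φ} i j)
    rewrite renF-sub0 f φ (var i) | renF-sub0 f φ (var j) = ax-leib (f i) (f j)
  ⊢-ren f (ax-strict-rel₁ r t u) rewrite renT-↑ f t = ax-strict-rel₁ r (renT f t) (renT f u)
  ⊢-ren f (ax-strict-rel₂ r t u) rewrite renT-↑ f u = ax-strict-rel₂ r (renT f t) (renT f u)
  ⊢-ren f (ax-strict-eq₁ t u)    rewrite renT-↑ f t = ax-strict-eq₁ (renT f t) (renT f u)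
  ⊢-ren f (ax-strict-eq₂ t u)    rewrite renT-↑ f u = ax-strict-eq₂ (renT f t) (renT f u)
  ⊢-ren f (ax-ι φ)
    rewrite renF-square {f = skip1} {g = liftR (liftR f)} {f′ = liftR f} {g′ = skip1} (skip1-liftR f) φ
          | renF-square {f = liftR suc} {g = liftR (liftR f)} {f′ = liftR f} {g′ = liftR suc}
                        (λ { zero → refl ; (suc _) → refl }) φ
    = ax-ι (renF (liftR f) φ)

  private variable
    φ ψ χ : Formula R n

  ⇒-refl : T ⊢ (φ ⇒ φ)
  ⇒-refl {φ = φ} = mp (mp ax-S ax-K) (ax-K {ψ = φ})

  ⇒-const : T ⊢ φ → T ⊢ (ψ ⇒ φ)
  ⇒-const = mp ax-K

  ⇒-ap : T ⊢ (χ ⇒ (φ ⇒ ψ)) → T ⊢ (χ ⇒ φ) → T ⊢ (χ ⇒ ψ)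
  ⇒-ap d e = mp (mp ax-S d) e

  ⇒-trans : T ⊢ (φ ⇒ ψ) → T ⊢ (ψ ⇒ χ) → T ⊢ (φ ⇒ χ)
  ⇒-trans d e = ⇒-ap (⇒-const e) d

  ¬-elim : T ⊢ (¬̇ φ ⇒ (φ ⇒ ψ))
  ¬-elim = ⇒-trans ax-K ax-N

  ¬¬-elim : T ⊢ (¬̇ ¬̇ φ ⇒ φ)
  -- With the consequent `¬̇ ¬̇ ¬̇ φ`, `ax-N` turns `¬-elim` into a proof that `¬̇ ¬̇ φ` implies
  -- `¬̇ ¬̇ φ ⇒ φ`; the repeated antecedent is then contracted.
  ¬¬-elim {φ = φ} = ⇒-ap (⇒-trans (¬-elim {ψ = ¬̇ ¬̇ ¬̇ φ}) ax-N) ⇒-refl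

  ¬¬-intro : T ⊢ (φ ⇒ ¬̇ ¬̇ φ)
  ¬¬-intro = mp ax-N ¬¬-elim

  contraposition : T ⊢ ((φ ⇒ ψ) ⇒ (¬̇ ψ ⇒ ¬̇ φ))
  contraposition =
    ⇒-trans (⇒-ap (⇒-trans ax-K ax-S) (⇒-const ¬¬-elim))
            (⇒-trans (mp ax-S (⇒-const ¬¬-intro)) ax-N)

  ∀-inst : T ⊢ (↑F (∀̇ φ) ⇒ φ)
  ∀-inst {φ = φ} = subst (λ χ → T ⊢ (↑F (∀̇ φ) ⇒ χ))
    (trans (sub0-var _ zero) (trans (renF-∘ (λ { zero → refl ; (suc _) → refl }) φ) (renF-id (λ _ → refl) φ)))
    (ax-∀v zero)

  -- `ax-∀⇒` shifts a quantifier only past an antecedent free of the bound variable. Under `gen`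
  -- both quantified antecedents are instantiated at that variable, and two shifts follow.
  ∀-dist : T ⊢ (∀̇ (φ ⇒ ψ) ⇒ (∀̇ φ ⇒ ∀̇ ψ))
  ∀-dist = ⇒-trans (mp ax-∀⇒ (gen (⇒-trans ∀-inst (⇒-ap (⇒-trans ax-K ax-S) (⇒-const ∀-inst))))) ax-∀⇒

  ∀-vacuous : T ⊢ (φ ⇒ ∀̇ (↑F φ))
  ∀-vacuous = mp ax-∀⇒ (gen ⇒-refl)

-- Enumeration of formulas with parameters

diagonal-next : ℕ × ℕ → ℕ × ℕ
diagonal-next (zero  , j) = suc j , zero
diagonal-next (suc i , j) = i , suc j

diagonal : ℕ → ℕ × ℕ
diagonal zero    = zero , zero
diagonal (suc k) = diagonal-next (diagonal k)

-- `s` numbers the antidiagonal. The recursion walks back along it by lowering `j`, and from `j` = 0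
-- steps to the last point of the previous one.
diagonal-surjective : ∀ s i j → i + j ≡ s → ∃ λ k → diagonal k ≡ (i , j)
diagonal-surjective s i (suc j) eq with diagonal-surjective s (suc i) j (trans (sym (+-suc i j)) eq)
... | k , p = suc k , cong diagonal-next p
diagonal-surjective zero    zero    zero eq = zero , refl
diagonal-surjective (suc s) (suc i) zero eq
  with diagonal-surjective s zero i (trans (sym (+-identityʳ i)) (suc-injective eq))
... | k , p = suc k , cong diagonal-next p

nth : {A : Set} → A → List A → ℕ → A
nth d []       _       = d
nth d (x ∷ xs) zero    = x
nth d (x ∷ xs) (suc i) = nth d xs i

∈⇒nth : {A : Set} (d : A) {x : A} {xs : List A} → x ∈ˡ xs → ∃ λ i → nth d xs i ≡ x
∈⇒nth d (here refl) = zero , refl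
∈⇒nth d (there x∈) with ∈⇒nth d x∈
... | i , p = suc i , p

vecBound : Vec ℕ n → ℕ
vecBound []      = zero
vecBound (x ∷ ρ) = suc x ⊔ vecBound ρ

lookup<vecBound : (ρ : Vec ℕ n) (i : Fin n) → lookup ρ i < vecBound ρ
lookup<vecBound (x ∷ ρ) zero    = m≤m⊔n (suc x) (vecBound ρ)
lookup<vecBound (x ∷ ρ) (suc i) = ≤-trans (lookup<vecBound ρ i) (m≤n⊔m (suc x) (vecBound ρ))

Sentence : Set → Set
Sentence R = Σ ℕ λ n → Formula R n × Vec ℕ n

module Enumeration {R : Set} (rels : List R) (rels-complete : ∀ r → r ∈ˡ rels) where

  mutual
    termHeight : Term R n → ℕ
    termHeight (var i)  = 1
    termHeight (desc φ) = suc (height φ)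

    height : Formula R n → ℕ
    height (rel r t u) = suc (termHeight t ⊔ termHeight u)
    height (t ≐ u)     = suc (termHeight t ⊔ termHeight u)
    height (¬̇ φ)       = suc (height φ)
    height (φ ⇒ ψ)     = suc (height φ ⊔ height ψ)
    height (∀̇ φ)       = suc (height φ)

  mutual
    -- Height cuts syntax into finite lists because `rels` and `Fin n` are finite. Variables have
    -- height 1, so the lists at bound 0 may be empty.
    terms : ℕ → (n : ℕ) → List (Term R n)
    terms zero    n = []
    terms (suc k) n = map var (allFin n) ++ map desc (formulas k (suc n))

    formulas : ℕ → (n : ℕ) → List (Formula R n)
    formulas zero    n = []
    formulas (suc k) n =
      cartesianProductWith (λ r (t , u) → rel r t u) rels (cartesianProduct (terms k n) (terms k n))
      ++ cartesianProductWith _≐_ (terms k n) (terms k n)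
      ++ map ¬̇_ (formulas k n)
      ++ cartesianProductWith _⇒_ (formulas k n) (formulas k n)
      ++ map ∀̇ (formulas k (suc n))

  mutual
    ∈-terms : ∀ k (t : Term R n) → termHeight t ≤ k → t ∈ˡ terms k n
    ∈-terms (suc k) (var i)  h       = ∈-++⁺ˡ (∈-map⁺ var (∈-allFin i))
    ∈-terms (suc k) (desc φ) (s≤s h) = ∈-++⁺ʳ _ (∈-map⁺ desc (∈-formulas k φ h))

    ∈-formulas : ∀ k (φ : Formula R n) → height φ ≤ k → φ ∈ˡ formulas k n
    ∈-formulas (suc k) (rel r t u) (s≤s h) = ∈-++⁺ˡ
      (∈-cartesianProductWith⁺ _ (rels-complete r)
        (∈-cartesianProduct⁺ (∈-terms k t (m⊔n≤o⇒m≤o _ _ h)) (∈-terms k u (m⊔n≤o⇒n≤o _ _ h))))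
    ∈-formulas (suc k) (t ≐ u) (s≤s h) = ∈-++⁺ʳ (cartesianProductWith _ rels _) (∈-++⁺ˡ
      (∈-cartesianProductWith⁺ _≐_ (∈-terms k t (m⊔n≤o⇒m≤o _ _ h)) (∈-terms k u (m⊔n≤o⇒n≤o _ _ h))))
    ∈-formulas {n} (suc k) (¬̇ φ) (s≤s h) = ∈-++⁺ʳ (cartesianProductWith _ rels _)
      (∈-++⁺ʳ (cartesianProductWith _≐_ (terms k n) _) (∈-++⁺ˡ (∈-map⁺ ¬̇_ (∈-formulas k φ h))))
    ∈-formulas {n} (suc k) (φ ⇒ ψ) (s≤s h) = ∈-++⁺ʳ (cartesianProductWith _ rels _)
      (∈-++⁺ʳ (cartesianProductWith _≐_ (terms k n) _) (∈-++⁺ʳ (map ¬̇_ (formulas k n)) (∈-++⁺ˡ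
        (∈-cartesianProductWith⁺ _⇒_ (∈-formulas k φ (m⊔n≤o⇒m≤o _ _ h)) (∈-formulas k ψ (m⊔n≤o⇒n≤o _ _ h))))))
    ∈-formulas {n} (suc k) (∀̇ φ) (s≤s h) = ∈-++⁺ʳ (cartesianProductWith _ rels _)
      (∈-++⁺ʳ (cartesianProductWith _≐_ (terms k n) _) (∈-++⁺ʳ (map ¬̇_ (formulas k n))
        (∈-++⁺ʳ (cartesianProductWith _⇒_ (formulas k n) _) (∈-map⁺ ∀̇ (∈-formulas k φ h)))))

  vecs : ℕ → (n : ℕ) → List (Vec ℕ n)
  vecs k zero    = [] ∷ []
  vecs k (suc n) = cartesianProductWith _∷_ (upTo k) (vecs k n)

  ∈-vecs : ∀ k (ρ : Vec ℕ n) → vecBound ρ ≤ k → ρ ∈ˡ vecs k n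
  ∈-vecs k []      h = here refl
  ∈-vecs k (x ∷ ρ) h =
    ∈-cartesianProductWith⁺ _∷_ (∈-upTo⁺ (m⊔n≤o⇒m≤o (suc x) (vecBound ρ) h)) (∈-vecs k ρ (m⊔n≤o⇒n≤o (suc x) (vecBound ρ) h))

  -- One number `k` bounds the count of free variables, the height and the parameters at once.
  sentences : ℕ → List (Sentence R)
  sentences k = concatMap (λ n → map (n ,_) (cartesianProduct (formulas k n) (vecs k n))) (upTo k)

  ∈-sentences : (φ : Formula R n) (ρ : Vec ℕ n) → ∃ λ k → (n , φ , ρ) ∈ˡ sentences k
  ∈-sentences {n} φ ρ = k , ∈-concatMap⁺ _
    (lose (∈-upTo⁺ (m≤m⊔n (suc n) (height φ ⊔ vecBound ρ)))
      (∈-map⁺ (n ,_) (∈-cartesianProduct⁺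
        (∈-formulas k φ (≤-trans (m≤m⊔n (height φ) _) (m≤n⊔m (suc n) _)))
        (∈-vecs k ρ (≤-trans (m≤n⊔m (height φ) _) (m≤n⊔m (suc n) _))))))
    where k = suc n ⊔ (height φ ⊔ vecBound ρ)

  -- The two diagonal coordinates choose a list and a position in it. A position past the end yields
  -- an arbitrary closed formula; only surjectivity matters, so repetitions are harmless.
  sentence : ℕ → Sentence R
  sentence k = nth (zero , ∀̇ (v0 ≐ v0) , []) (sentences (proj₁ (diagonal k))) (proj₂ (diagonal k))

  sentence-surjective : (s : Sentence R) → ∃ λ k → sentence k ≡ s
  sentence-surjective (n , φ , ρ) with ∈-sentences φ ρ
  ... | a , s∈ with ∈⇒nth _ s∈
  ... | b , nth≡ with diagonal-surjective (a + b) a b refl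
  ... | k , diag = k , trans (cong (λ (x , y) → nth (zero , ∀̇ (v0 ≐ v0) , []) (sentences x) y) diag) nth≡

-- Sentences over infinitely many parameters

-- The calculus has no constants, so a formula with parameters in ℕ is the family of its readings with
-- free variables in Fin (suc N), parameters ≥ N being identified with N; only large N matter.
Family : Set → Set
Family R = (N : ℕ) → Formula R (suc N)

clip : (N : ℕ) → ℕ → Fin (suc N)
clip zero    _       = zero
clip (suc N) zero    = zero
clip (suc N) (suc i) = suc (clip N i)

toℕ-clip-< : ∀ {N c} → c < N → toℕ (clip N c) ≡ c
toℕ-clip-< {suc N} {zero}  c<N       = refl
toℕ-clip-< {suc N} {suc c} (s≤s c<N) = cong suc (toℕ-clip-< c<N)

clip-injective-< : ∀ {N c} i → c < N → toℕ (clip N i) ≡ c → i ≡ c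
clip-injective-< {suc N} zero    c<N       eq = eq
clip-injective-< {suc N} {suc c} (suc i) (s≤s c<N) eq = cong suc (clip-injective-< i c<N (suc-injective eq))

⟪_⟫ : {R : Set} → Formula R n → Vec ℕ n → Family R
⟪ φ ⟫ ρ N = renF (clip N ∘ lookup ρ) φ

sentenceFamily : {R : Set} → Sentence R → Family R
sentenceFamily (_ , φ , ρ) = ⟪ φ ⟫ ρ

-- The renaming that binds parameter `c`: it becomes the new variable, and every other index is
-- shifted as by `suc`.
abstracting : ℕ → (N : ℕ) → Fin (suc N) → Fin (suc (suc N))
abstracting c N i with toℕ i ≟ c
... | yes _ = zero
... | no  _ = suc i

abstracting-fresh : ∀ {c N} i → c < N → i < c → abstracting c N (clip N i) ≡ suc (clip N i)
abstracting-fresh {c} {N} i c<N i<c with toℕ (clip N i) ≟ c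
... | yes eq = ⊥-elim (<-irrefl (clip-injective-< i c<N eq) i<c)
... | no  _  = refl

abstracting-self : ∀ {c N} → c < N → abstracting c N (clip N c) ≡ zero
abstracting-self {c} {N} c<N with toℕ (clip N c) ≟ c
... | yes _   = refl
... | no  neq = ⊥-elim (neq (toℕ-clip-< c<N))

-- Derivability between families of formulas

module Families {R : Set} (T : Formula R zero → Set) where

  open Derivations T

  infixr 5 _⇛_
  infix  7 ∼_
  infix  3 _⊩_
  infixl 4 _▹_

  _⇛_ : Family R → Family R → Family R
  (s ⇛ u) N = s N ⇒ u N

  ∼_ : Family R → Family R
  (∼ s) N = ¬̇ s N

  -- The language has no constant for falsity. The negation of this closed sentence serves, since
  -- the sentence is provable whether or not the domain is empty.
  falsum : Family R
  falsum = ⟪ ¬̇ ∀̇ (v0 ≐ v0) ⟫ []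

  -- There is no generalisation rule, so the deduction theorem holds without side conditions.
  -- Theorems are required only for large `N`, where `clip` keeps the relevant parameters apart.
  data _⊩_ (F : Family R → Set) : Family R → Set where
    hyp : ∀ {s} → F s → F ⊩ s
    thm : ∀ {s} N₀ → (∀ N → N₀ ≤ N → T ⊢ s N) → F ⊩ s
    app : ∀ {s u} → F ⊩ (s ⇛ u) → F ⊩ s → F ⊩ u

  private variable
    F G   : Family R → Set
    s u w : Family R

  pure : (∀ N → T ⊢ s N) → F ⊩ s
  pure d = thm 0 (λ N _ → d N)

  ⊩-mono : (∀ {s} → F s → G s) → F ⊩ u → G ⊩ u
  ⊩-mono i (hyp h)    = hyp (i h)
  ⊩-mono i (thm N₀ d) = thm N₀ d
  ⊩-mono i (app d e)  = app (⊩-mono i d) (⊩-mono i e)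

  ⊩-resp : (∀ N → s N ≡ u N) → F ⊩ s → F ⊩ u
  ⊩-resp eq = app (pure (λ N → subst (λ χ → T ⊢ (_ ⇒ χ)) (eq N) ⇒-refl))

  ⊢⇒⊩ : {φ : Formula R n} (ρ : Vec ℕ n) → T ⊢ φ → F ⊩ ⟪ φ ⟫ ρ
  ⊢⇒⊩ ρ d = pure (λ N → ⊢-ren _ d)

  _▹_ : (Family R → Set) → Family R → Family R → Set
  (F ▹ s) u = F u ⊎ s ≡ u

  deduction : F ▹ s ⊩ u → F ⊩ s ⇛ u
  deduction (hyp (inj₁ h))    = app (pure λ _ → ax-K) (hyp h)
  deduction (hyp (inj₂ refl)) = pure λ _ → ⇒-refl
  deduction (thm N₀ d)        = thm N₀ λ N h → ⇒-const (d N h)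
  deduction (app d e)         = app (app (pure λ _ → ax-S) (deduction d)) (deduction e)

  ∼-elim : F ⊩ ∼ s → F ⊩ s → F ⊩ u
  ∼-elim d e = app (app (pure λ _ → ¬-elim) d) e

  truth : F ⊩ ∼ falsum
  truth = pure λ _ → mp ¬¬-intro (gen (ax-refl zero))

  ex-falso : F ⊩ falsum → F ⊩ s
  ex-falso = ∼-elim truth

  ∼-intro : F ⊩ s ⇛ falsum → F ⊩ ∼ s
  ∼-intro d = app (app (pure λ _ → contraposition) d) truth

  by-contradiction : F ⊩ ∼ s ⇛ falsum → F ⊩ s
  by-contradiction d = app (pure λ _ → ¬¬-elim) (∼-intro d)

  ⇛-trans : F ⊩ s ⇛ u → F ⊩ u ⇛ w → F ⊩ s ⇛ w
  ⇛-trans d e = app (app (pure λ _ → ax-S) (app (pure λ _ → ax-K) e)) d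

  -- A family has no syntax in which to look for `c`; instead, abstracting `c` must eventually have
  -- the same effect as plain weakening.
  Fresh : ℕ → Family R → Set
  Fresh c s = ∃ λ N₀ → ∀ N → N₀ ≤ N → renF (abstracting c N) (s N) ≡ ↑F (s N)

  Below : ℕ → Family R → Set
  Below b s = ∀ c → b ≤ c → Fresh c s

  Below-⟪⟫ : ∀ {b} (φ : Formula R n) (ρ : Vec ℕ n) → vecBound ρ ≤ b → Below b (⟪ φ ⟫ ρ)
  Below-⟪⟫ φ ρ ρ≤b c b≤c = suc c , λ N c<N →
    renF-square (λ i → abstracting-fresh (lookup ρ i) c<N
                         (≤-trans (lookup<vecBound ρ i) (≤-trans ρ≤b b≤c))) φ

  Below-⇛ : ∀ {b} → Below b s → Below b u → Below b (s ⇛ u)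
  Below-⇛ p q c h with p c h | q c h
  ... | N₁ , e₁ | N₂ , e₂ = N₁ ⊔ N₂ , λ N h → cong₂ _⇒_ (e₁ N (≤-trans (m≤m⊔n N₁ N₂) h))
                                                        (e₂ N (≤-trans (m≤n⊔m N₁ N₂) h))

  Below-mono : ∀ {b c} → b ≤ c → Below b s → Below c s
  Below-mono b≤c p d h = p d (≤-trans b≤c h)

  ∀-abstract : ℕ → Family R → Family R
  ∀-abstract c s N = ∀̇ (renF (abstracting c N) (s N))

  -- The missing generalisation rule, by induction on the derivation: hypotheses bind `c` vacuously,
  -- theorems are renamed and closed with `gen`, and modus ponens goes through `∀-dist`.
  generalize : ∀ {c} → (∀ {s} → F s → Fresh c s) → F ⊩ u → F ⊩ ∀-abstract c u
  generalize fresh (hyp {s} h) with fresh h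
  ... | N₀ , eq = app (thm N₀ λ N h → subst (λ χ → T ⊢ (s N ⇒ ∀̇ χ)) (sym (eq N h)) ∀-vacuous) (hyp h)
  generalize fresh (thm N₀ d) = thm N₀ λ N h → gen (⊢-ren _ (d N h))
  generalize fresh (app d e)  =
    app (app (pure λ _ → ∀-dist) (generalize fresh d)) (generalize fresh e)

  ∀-generalize : ∀ {c} (φ : Formula R (suc n)) (ρ : Vec ℕ n) → vecBound ρ ≤ c →
                 (∀ {s} → F s → Fresh c s) → F ⊩ ⟪ φ ⟫ (c ∷ ρ) → F ⊩ ⟪ ∀̇ φ ⟫ ρ
  ∀-generalize {c = c} φ ρ ρ≤c fresh d =
    app (thm (suc c) λ N c<N → subst (λ χ → T ⊢ (∀̇ (renF (abstracting c N) (⟪ φ ⟫ (c ∷ ρ) N)) ⇒ ∀̇ χ))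
                                     (renF-∘ (eq c<N) φ) ⇒-refl)
        (generalize fresh d)
    where
    eq : ∀ {N} → c < N → ∀ i → abstracting c N (clip N (lookup (c ∷ ρ) i)) ≡ liftR (clip N ∘ lookup ρ) i
    eq c<N zero    = abstracting-self c<N
    eq c<N (suc i) = abstracting-fresh (lookup ρ i) c<N (≤-trans (lookup<vecBound ρ i) ρ≤c)

  -- The constant `c` is a counterexample to `∀̇ φ` if there is one. For other shapes a tautology is
  -- used, so that every stage adds exactly one such formula.
  henkin : Sentence R → ℕ → Family R
  henkin (_ , ∀̇ φ , ρ) c = ⟪ φ ⟫ (c ∷ ρ) ⇛ ⟪ ∀̇ φ ⟫ ρ
  henkin (_ , φ , ρ)   c = ⟪ φ ⟫ ρ ⇛ ⟪ φ ⟫ ρ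

  parameterBound : Sentence R → ℕ
  parameterBound (_ , _ , ρ) = vecBound ρ

  Below-henkin : ∀ (S : Sentence R) {c} → parameterBound S ≤ c → Below (suc c) (henkin S c)
  Below-henkin (_ , rel r t u , ρ) h = Below-mono (n≤1+n _) (Below-⇛ (Below-⟪⟫ _ ρ h) (Below-⟪⟫ _ ρ h))
  Below-henkin (_ , t ≐ u , ρ)     h = Below-mono (n≤1+n _) (Below-⇛ (Below-⟪⟫ _ ρ h) (Below-⟪⟫ _ ρ h))
  Below-henkin (_ , ¬̇ φ , ρ)       h = Below-mono (n≤1+n _) (Below-⇛ (Below-⟪⟫ _ ρ h) (Below-⟪⟫ _ ρ h))
  Below-henkin (_ , φ ⇒ ψ , ρ)     h = Below-mono (n≤1+n _) (Below-⇛ (Below-⟪⟫ _ ρ h) (Below-⟪⟫ _ ρ h))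
  Below-henkin (_ , ∀̇ φ , ρ) {c}   h =
    Below-⇛ (Below-⟪⟫ φ (c ∷ ρ) (⊔-lub ≤-refl (≤-trans h (n≤1+n c))))
            (Below-mono (n≤1+n c) (Below-⟪⟫ (∀̇ φ) ρ h))

  -- If the Henkin formula is refutable, then so is the negation of its antecedent, because that
  -- negation would prove the formula. Hence the antecedent holds at the fresh `c`, generalises to
  -- `∀̇ φ`, and proves the formula after all.
  henkin-conservative : ∀ (S : Sentence R) {c} → parameterBound S ≤ c → (∀ {s} → F s → Fresh c s) →
                        F ▹ henkin S c ⊩ falsum → F ⊩ falsum
  henkin-conservative (_ , rel r t u , ρ) h fresh d = app (deduction d) (pure λ _ → ⇒-refl)
  henkin-conservative (_ , t ≐ u , ρ)     h fresh d = app (deduction d) (pure λ _ → ⇒-refl)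
  henkin-conservative (_ , ¬̇ φ , ρ)       h fresh d = app (deduction d) (pure λ _ → ⇒-refl)
  henkin-conservative (_ , φ ⇒ ψ , ρ)     h fresh d = app (deduction d) (pure λ _ → ⇒-refl)
  henkin-conservative (_ , ∀̇ φ , ρ)       h fresh d = app (deduction d) (app (pure λ _ → ax-K)
    (∀-generalize φ ρ h fresh
      (by-contradiction (⇛-trans (pure λ _ → ¬-elim) (deduction d)))))

  ⟪⟫-ren : (f : Fin n → Fin m) {ρ : Vec ℕ m} {ρ′ : Vec ℕ n} → (∀ i → lookup ρ (f i) ≡ lookup ρ′ i) →
           (φ : Formula R n) → ∀ N → ⟪ renF f φ ⟫ ρ N ≡ ⟪ φ ⟫ ρ′ N
  ⟪⟫-ren f eq φ N = renF-∘ (λ i → cong (clip N) (eq i)) φ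

  ⟪⟫-sub0 : (φ : Formula R (suc n)) (ρ : Vec ℕ n) (i : Fin n) →
            ∀ N → ⟪ sub0 φ (var i) ⟫ ρ N ≡ ⟪ φ ⟫ (lookup ρ i ∷ ρ) N
  ⟪⟫-sub0 φ ρ i N rewrite sub0-var φ i =
    ⟪⟫-ren (instVar i) {ρ} {lookup ρ i ∷ ρ} (λ { zero → refl ; (suc _) → refl }) φ N

  ⊩-∀-elim : {φ : Formula R (suc n)} (ρ : Vec ℕ n) (x : ℕ) → F ⊩ ⟪ ∀̇ φ ⟫ ρ → F ⊩ ⟪ φ ⟫ (x ∷ ρ)
  ⊩-∀-elim {φ = φ} ρ x d =
    ⊩-resp (λ N → trans (sub0-var _ (clip N x))
                        (renF-∘ (λ { zero → refl ; (suc _) → refl }) φ))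
           (app (pure λ N → ax-∀v {φ = renF (liftR (clip N ∘ lookup ρ)) φ} (clip N x)) d)

-- Lindenbaum–Henkin extension

-- Krivine's form of Lindenbaum's lemma: whether a sentence is added is not decided, it is added under
-- the (Set-valued) condition that adding it reflects inconsistency.
module Extension {R : Set} (T : Formula R zero → Set)
                 (A : ℕ → Sentence R) (A-surjective : (S : Sentence R) → ∃ λ k → A k ≡ S)
                 (φ₀ : Formula R zero) where

  open Derivations T
  open Families T

  -- Strictly above all earlier constants and no smaller than any bound seen so far, hence fresh for
  -- stage `k` and for the sentence `A k`.
  constant : ℕ → ℕ
  constant zero    = parameterBound (A zero)
  constant (suc k) = suc (constant k) ⊔ parameterBound (A (suc k))

  bound≤constant : ∀ k → parameterBound (A k) ≤ constant k
  bound≤constant zero    = ≤-refl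
  bound≤constant (suc k) = m≤n⊔m (suc (constant k)) _

  stage  : ℕ → Family R → Set
  stageʰ : ℕ → Family R → Set

  Admissible : ℕ → Set

  stage zero    u = ⟪ φ₀ ⟫ [] ≡ u
  stage (suc k) u = stageʰ k u ⊎ Admissible k × sentenceFamily (A k) ≡ u

  stageʰ k = stage k ▹ henkin (A k) (constant k)

  Admissible k = stageʰ k ▹ sentenceFamily (A k) ⊩ falsum → stageʰ k ⊩ falsum

  stage-below : ∀ k {s} → stage k s → Below (constant k) s
  stage-below zero refl = Below-⟪⟫ φ₀ [] z≤n
  stage-below (suc k) (inj₁ (inj₁ h)) =
    Below-mono (≤-trans (n≤1+n _) (m≤m⊔n _ (parameterBound (A (suc k))))) (stage-below k h)
  stage-below (suc k) (inj₁ (inj₂ refl)) =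
    Below-mono (m≤m⊔n _ (parameterBound (A (suc k)))) (Below-henkin (A k) (bound≤constant k))
  stage-below (suc k) (inj₂ (_ , refl)) =
    Below-mono (≤-trans (bound≤constant k) (≤-trans (n≤1+n _) (m≤m⊔n _ (parameterBound (A (suc k))))))
               (Below-⟪⟫ _ (proj₂ (proj₂ (A k))) ≤-refl)

  -- This replaces a decision whether `A k` was added: a derivation that uses it carries the proof
  -- of admissibility in its hypothesis, and one that does not is a derivation from `stageʰ k`. The
  -- split is on the derivation.
  conditional : ∀ k {u} → stage (suc k) ⊩ u →
                stageʰ k ⊩ u ⊎ Admissible k × (stageʰ k ▹ sentenceFamily (A k) ⊩ u)
  conditional k (hyp (inj₁ h))       = inj₁ (hyp h)
  conditional k (hyp (inj₂ (a , eq))) = inj₂ (a , hyp (inj₂ eq))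
  conditional k (thm N₀ d)           = inj₁ (thm N₀ d)
  conditional k (app d e) with conditional k d | conditional k e
  ... | inj₁ d′       | inj₁ e′       = inj₁ (app d′ e′)
  ... | inj₁ d′       | inj₂ (a , e′) = inj₂ (a , app (⊩-mono inj₁ d′) e′)
  ... | inj₂ (a , d′) | inj₁ e′       = inj₂ (a , app d′ (⊩-mono inj₁ e′))
  ... | inj₂ (a , d′) | inj₂ (_ , e′) = inj₂ (a , app d′ e′)

  -- Admissibility, when it was used, brings an inconsistency down to `stageʰ k`; conservativity of
  -- the Henkin formula brings it down to `stage k`.
  stage-reflects : ∀ k → stage k ⊩ falsum → stage zero ⊩ falsum
  stage-reflects zero    d = d
  stage-reflects (suc k) d with conditional k d
  ... | inj₁ d′       = stage-reflects k
    (henkin-conservative (A k) (bound≤constant k) (λ h → stage-below k h _ ≤-refl) d′)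
  ... | inj₂ (a , d′) = stage-reflects k
    (henkin-conservative (A k) (bound≤constant k) (λ h → stage-below k h _ ≤-refl) (a d′))

  stage-mono : ∀ j {k s} → stage k s → stage (j + k) s
  stage-mono zero    h = h
  stage-mono (suc j) h = inj₁ (inj₁ (stage-mono j h))

  limit : Family R → Set
  limit s = ∃ λ k → stage k s

  compactness : ∀ {s} → limit ⊩ s → ∃ λ k → stage k ⊩ s
  compactness (hyp (k , h)) = k , hyp h
  compactness (thm N₀ d)    = zero , thm N₀ d
  compactness (app d e) with compactness d | compactness e
  ... | j , d′ | k , e′ = j + k , app (⊩-mono (λ {s} h → subst (λ i → stage i s) (+-comm k j) (stage-mono k h)) d′)
                                      (⊩-mono (stage-mono j) e′)

  limit-reflects : limit ⊩ falsum → stage zero ⊩ falsum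
  limit-reflects d = stage-reflects _ (proj₂ (compactness d))

  stageʰ-falsum : ∀ k → limit ⊩ falsum → stageʰ k ⊩ falsum
  stageʰ-falsum k d =
    ⊩-mono (λ h → inj₁ (subst (λ i → stage i _) (+-identityʳ k) (stage-mono k h))) (limit-reflects d)

  ⊩-limit : ∀ {k s} → stageʰ k ⊩ s → limit ⊩ s
  ⊩-limit {k} = ⊩-mono (λ h → suc k , inj₁ h)

  -- The premise is asked at every `k` because the position of the sentence in the enumeration comes
  -- from surjectivity; at that position it becomes admissibility by the deduction theorem.
  maximal : (φ : Formula R n) (ρ : Vec ℕ n) →
            (∀ k → stageʰ k ⊩ ⟪ φ ⟫ ρ ⇛ falsum → stageʰ k ⊩ falsum) → limit ⊩ ⟪ φ ⟫ ρ
  maximal φ ρ admissible with A-surjective (_ , φ , ρ)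
  ... | k , eq = hyp (suc k , inj₂ ((λ d → admissible k (deduction
                   (subst (λ S → stageʰ k ▹ sentenceFamily S ⊩ falsum) eq d))) , cong sentenceFamily eq))

  -- A record, so that `φ` and `ρ` can be inferred although `⟪ φ ⟫ ρ` computes.
  record True (φ : Formula R n) (ρ : Vec ℕ n) : Set where
    constructor true
    field derivation : limit ⊩ ⟪ φ ⟫ ρ
  open True public

  Absurd : Set
  Absurd = limit ⊩ falsum

  private variable
    φ ψ : Formula R n
    ρ   : Vec ℕ n

  -- A stage refuting `φ ⇒ ψ` proves `φ` and refutes `ψ`. The given function then makes the limit
  -- inconsistent, hence stage zero, hence the stage in question. Thus implication between truths
  -- already makes the implication true.
  True-⇒-intro : (True φ ρ → True ψ ρ) → True (φ ⇒ ψ) ρ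
  True-⇒-intro {φ = φ} {ρ} {ψ} f = true (maximal (φ ⇒ ψ) ρ λ k d →
    let antecedent = by-contradiction (⇛-trans (pure λ _ → ¬-elim) d)
        refutation = ∼-intro (⇛-trans (pure λ _ → ax-K) d)
    in stageʰ-falsum k (∼-elim (⊩-limit refutation) (derivation (f (true (⊩-limit antecedent))))))

  True-⇒-elim : True (φ ⇒ ψ) ρ → True φ ρ → True ψ ρ
  True-⇒-elim (true d) (true e) = true (app d e)

  True-¬-intro : (True φ ρ → Absurd) → True (¬̇ φ) ρ
  True-¬-intro {φ = φ} {ρ} f = true (maximal (¬̇ φ) ρ λ k d →
    stageʰ-falsum k (f (true (⊩-limit (by-contradiction d)))))

  True-¬-elim : True (¬̇ φ) ρ → True φ ρ → Absurd
  True-¬-elim (true d) (true e) = ∼-elim d e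

  True-∀-intro : (∀ x → True φ (x ∷ ρ)) → True (∀̇ φ) ρ
  True-∀-intro {φ = φ} {ρ} f with A-surjective (_ , ∀̇ φ , ρ)
  ... | k , eq = true (app (hyp (suc k , inj₁ (inj₂ (cong (λ S → henkin S (constant k)) eq))))
                           (derivation (f (constant k))))

  True-∀-elim : True (∀̇ φ) ρ → ∀ x → True φ (x ∷ ρ)
  True-∀-elim {φ = φ} {ρ} (true d) x = true (⊩-∀-elim {φ = φ} ρ x d)

  True-stable : ((True φ ρ → Absurd) → Absurd) → True φ ρ
  True-stable f = true (app (pure λ _ → ¬¬-elim)
    (derivation (True-¬-intro λ d → f λ e → True-¬-elim d e)))

  True-∃-elim : True (∃̇ φ) ρ → ∃ λ x → True φ (x ∷ ρ)
  True-∃-elim {φ = φ} {ρ} (true d) with A-surjective (_ , ∀̇ (¬̇ φ) , ρ)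
  -- The witness is the Henkin constant of `∀̇ (¬̇ φ)`: contraposing its Henkin formula gives the
  -- double negation of `φ` there.
  ... | k , eq = constant k , true (app (pure λ _ → ¬¬-elim) (app (app (pure λ _ → contraposition)
                   (hyp (suc k , inj₁ (inj₂ (cong (λ S → henkin S (constant k)) eq))))) d))

  True-∧-intro : True φ ρ → True ψ ρ → True (φ ∧̇ ψ) ρ
  True-∧-intro d e = True-¬-intro λ f → True-¬-elim (True-⇒-elim f d) e

  True-∧-elim : True (φ ∧̇ ψ) ρ → True φ ρ × True ψ ρ
  True-∧-elim d =
      True-stable (λ f → True-¬-elim d (True-⇒-intro λ e → true (ex-falso (f e))))
    , True-stable (λ f → True-¬-elim d (True-⇒-intro λ _ → True-¬-intro f))

  True-ren : (f : Fin n → Fin m) {ρ : Vec ℕ m} {ρ′ : Vec ℕ n} → (∀ i → lookup ρ (f i) ≡ lookup ρ′ i) →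
             (φ : Formula R n) → (True (renF f φ) ρ → True φ ρ′) × (True φ ρ′ → True (renF f φ) ρ)
  True-ren f {ρ} {ρ′} eq φ = (λ (true d) → true (⊩-resp (⟪⟫-ren f {ρ} {ρ′} eq φ) d))
                           , (λ (true d) → true (⊩-resp (λ N → sym (⟪⟫-ren f {ρ} {ρ′} eq φ N)) d))

  True-sub0 : (φ : Formula R (suc n)) (ρ : Vec ℕ n) (i : Fin n) →
              (True (sub0 φ (var i)) ρ → True φ (lookup ρ i ∷ ρ)) ×
              (True φ (lookup ρ i ∷ ρ) → True (sub0 φ (var i)) ρ)
  True-sub0 φ ρ i = (λ (true d) → true (⊩-resp (⟪⟫-sub0 φ ρ i) d))
                  , (λ (true d) → true (⊩-resp (λ N → sym (⟪⟫-sub0 φ ρ i N)) d))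

  ⊢⇒True : T ⊢ φ → True φ ρ
  ⊢⇒True {φ = φ} {ρ} d = true (⊢⇒⊩ {φ = φ} ρ d)

-- Semantics

infix 1 _⟷_
_⟷_ : Set → Set → Set
A ⟷ B = (A → B) × (B → A)

⟷-refl : {A : Set} → A ⟷ A
⟷-refl = id , id

⟷-sym : {A B : Set} → A ⟷ B → B ⟷ A
⟷-sym (f , g) = g , f

⟷-trans : {A B C : Set} → A ⟷ B → B ⟷ C → A ⟷ C
⟷-trans (f , g) (h , k) = h ∘ f , g ∘ k

⟷-→ : {A B C D : Set} → A ⟷ B → C ⟷ D → (A → C) ⟷ (B → D)
⟷-→ (f , g) (h , k) = (λ c → h ∘ c ∘ g) , (λ c → k ∘ c ∘ f)

-- Absurdity is a parameter: a structure may be inconsistent, in which case everything holds in it.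
record Structure (R : Set) : Set₁ where
  infix 4 _≈_
  field
    Carrier  : Set
    relation : R → Carrier → Carrier → Set
    _≈_      : Carrier → Carrier → Set
    Absurdity : Set

module Semantics {R : Set} (𝓢 : Structure R) where

  open Structure 𝓢

  Env : ℕ → Set
  Env = Vec Carrier

  mutual
    ⟦_⟧ : Formula R n → Env n → Set
    ⟦ rel r t u ⟧ ρ = ⟦ t ⟧≔ ρ λ a → ⟦ u ⟧≔ ρ λ b → relation r a b
    ⟦ t ≐ u ⟧     ρ = ⟦ t ⟧≔ ρ λ a → ⟦ u ⟧≔ ρ λ b → a ≈ b
    ⟦ ¬̇ φ ⟧       ρ = ⟦ φ ⟧ ρ → Absurdity
    ⟦ φ ⇒ ψ ⟧     ρ = ⟦ φ ⟧ ρ → ⟦ ψ ⟧ ρ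
    ⟦ ∀̇ φ ⟧       ρ = ∀ x → ⟦ φ ⟧ (x ∷ ρ)

    -- t denotes, and K holds of its value.
    ⟦_⟧≔ : Term R n → Env n → (Carrier → Set) → Set
    ⟦ var i ⟧≔  ρ K = K (lookup ρ i)
    ⟦ desc φ ⟧≔ ρ K = ∃ λ a → (∀ x → ⟦ φ ⟧ (x ∷ ρ) ⟷ x ≈ a) × K a

  lookup-liftR : (f : Fin n → Fin m) {ρ : Env m} {ρ′ : Env n} → (∀ i → lookup ρ (f i) ≡ lookup ρ′ i) →
                 ∀ x i → lookup (x ∷ ρ) (liftR f i) ≡ lookup (x ∷ ρ′) i
  lookup-liftR f eq x zero    = refl
  lookup-liftR f eq x (suc i) = eq i

  mutual
    ⟦⟧-ren : (f : Fin n → Fin m) {ρ : Env m} {ρ′ : Env n} → (∀ i → lookup ρ (f i) ≡ lookup ρ′ i) →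
             (φ : Formula R n) → ⟦ renF f φ ⟧ ρ ⟷ ⟦ φ ⟧ ρ′
    ⟦⟧-ren f eq (rel r t u) = ⟦⟧≔-ren f eq t λ a → ⟦⟧≔-ren f eq u λ b → ⟷-refl
    ⟦⟧-ren f eq (t ≐ u)     = ⟦⟧≔-ren f eq t λ a → ⟦⟧≔-ren f eq u λ b → ⟷-refl
    ⟦⟧-ren f eq (¬̇ φ)       = ⟷-→ (⟦⟧-ren f eq φ) ⟷-refl
    ⟦⟧-ren f eq (φ ⇒ ψ)     = ⟷-→ (⟦⟧-ren f eq φ) (⟦⟧-ren f eq ψ)
    ⟦⟧-ren f eq (∀̇ φ)       = (λ h x → proj₁ (⟦⟧-ren (liftR f) (lookup-liftR f eq x) φ) (h x))
                            , (λ h x → proj₂ (⟦⟧-ren (liftR f) (lookup-liftR f eq x) φ) (h x))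

    ⟦⟧≔-ren : (f : Fin n → Fin m) {ρ : Env m} {ρ′ : Env n} → (∀ i → lookup ρ (f i) ≡ lookup ρ′ i) →
              (t : Term R n) {K L : Carrier → Set} → (∀ a → K a ⟷ L a) → ⟦ renT f t ⟧≔ ρ K ⟷ ⟦ t ⟧≔ ρ′ L
    ⟦⟧≔-ren f eq (var i) {K} {L} h = subst (λ a → K _ ⟷ L a) (eq i) (h _)
    ⟦⟧≔-ren f eq (desc φ)  h =
        (λ (a , d , k) → a , (λ x → ⟷-trans (⟷-sym (⟦⟧-ren (liftR f) (lookup-liftR f eq x) φ)) (d x)) , proj₁ (h a) k)
      , (λ (a , d , k) → a , (λ x → ⟷-trans (⟦⟧-ren (liftR f) (lookup-liftR f eq x) φ) (d x)) , proj₂ (h a) k)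

record Model {R : Set} (T : Formula R zero → Set) : Set₁ where
  field
    structure : Structure R
  open Structure structure public
  open Semantics structure public
  field
    ≈-refl  : ∀ {a} → a ≈ a
    leibniz : ∀ {n} (φ : Formula R (suc n)) {ρ a b} → a ≈ b → ⟦ φ ⟧ (a ∷ ρ) → ⟦ φ ⟧ (b ∷ ρ)
    stable  : ∀ {n} (φ : Formula R n) {ρ} → ((⟦ φ ⟧ ρ → Absurdity) → Absurdity) → ⟦ φ ⟧ ρ
    witness : ∀ {n} (φ : Formula R (suc n)) {ρ} → ⟦ ∃̇ φ ⟧ ρ → ∃ λ a → ⟦ φ ⟧ (a ∷ ρ)
    sound   : ∀ {φ} → T φ → ⟦ φ ⟧ []

-- Completeness

module TermModel {R : Set} (T : Formula R zero → Set)
                 (A : ℕ → Sentence R) (A-surjective : (S : Sentence R) → ∃ λ k → A k ≡ S)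
                 (φ₀ : Formula R zero) where

  open Derivations T
  open Families T
  open Extension T A A-surjective φ₀

  private variable
    ρ : Vec ℕ n

  termStructure : Structure R
  termStructure = record
    { Carrier   = ℕ
    ; relation  = λ r a b → True (rel r v0 v1) (a ∷ b ∷ [])
    ; _≈_       = λ a b → True (v0 ≐ v1) (a ∷ b ∷ [])
    ; Absurdity = Absurd
    }

  open Structure termStructure
  open Semantics termStructure

  -- `ax-leib` speaks of variables only, so `a` and `b` are both put in front of the environment and
  -- `φ` is weakened past them.
  True-leibniz : (φ : Formula R (suc n)) {ρ : Vec ℕ n} {a b : ℕ} → a ≈ b → True φ (a ∷ ρ) → True φ (b ∷ ρ)
  True-leibniz {n = n} φ {ρ} {a} {b} a≈b d =
    proj₁ (True-ren instB inst-eq φ) (proj₁ (True-sub0 φ′ ρ′ (suc zero))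
      (True-⇒-elim (True-⇒-elim (⊢⇒True (ax-leib zero (suc zero))) (proj₂ (True-ren f f-eq (v0 ≐ v1)) a≈b))
        (proj₂ (True-sub0 φ′ ρ′ zero) (proj₂ (True-ren instB inst-eqA φ) d))))
    where
    ρ′ : Vec ℕ (suc (suc n))
    ρ′ = a ∷ b ∷ ρ
    instB : Fin (suc n) → Fin (suc (suc (suc n)))
    instB zero    = zero
    instB (suc i) = suc (suc (suc i))
    φ′ : Formula R (suc (suc (suc n)))
    φ′ = renF instB φ
    inst-eq : ∀ i → lookup (b ∷ ρ′) (instB i) ≡ lookup (b ∷ ρ) i
    inst-eq zero    = refl
    inst-eq (suc i) = refl
    inst-eqA : ∀ i → lookup (a ∷ ρ′) (instB i) ≡ lookup (a ∷ ρ) i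
    inst-eqA zero    = refl
    inst-eqA (suc i) = refl
    f : Fin 2 → Fin (suc (suc n))
    f zero       = zero
    f (suc zero) = suc zero
    f-eq : ∀ i → lookup ρ′ (f i) ≡ lookup (a ∷ b ∷ []) i
    f-eq zero       = refl
    f-eq (suc zero) = refl

  Denotes : Term R n → Vec ℕ n → ℕ → Set
  Denotes t ρ a = True (v0 ≐ ↑ t) (a ∷ ρ)

  True-E! : (t : Term R n) → True (E! t) ρ → ∃ λ a → Denotes t ρ a
  True-E! t = True-∃-elim

  -- Leibniz's law is stated for variables. It is generalised over its right-hand variable and
  -- instantiated at `t` by `ax-∀t`; the existence of `t` comes from strictness of the equation that
  -- is assumed.
  ⊢-replace : (θ : Formula R (suc n)) (t : Term R n) →
              T ⊢ ((v0 ≐ ↑ t) ⇒ (θ ⇒ ↑F (sub0 θ t)))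
  ⊢-replace {n} θ t = ⇒-ap (⇒-trans (ax-strict-eq₂ v0 (↑ t)) instance-at-t) ⇒-refl
    where
    inst3 : Fin (suc n) → Fin (suc (suc (suc n)))
    inst3 zero    = zero
    inst3 (suc i) = suc (suc (suc i))
    τ : Fin (suc n) → Term R (suc n)
    τ zero    = ↑ t
    τ (suc i) = var (suc i)
    leib : T ⊢ ((v1 ≐ v0) ⇒ (↑F θ ⇒ renF skip1 θ))
    leib = subst₂ (λ φ ψ → T ⊢ ((v1 ≐ v0) ⇒ (φ ⇒ ψ)))
      (trans (sub0-var _ _) (renF-∘ (λ { zero → refl ; (suc _) → refl }) θ))
      (trans (sub0-var _ _) (renF-∘ (λ { zero → refl ; (suc _) → refl }) θ))
      (ax-leib {φ = renF inst3 θ} (suc zero) zero)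
    instance-at-t : T ⊢ (E! (↑ t) ⇒ ((v0 ≐ ↑ t) ⇒ (θ ⇒ ↑F (sub0 θ t))))
    instance-at-t = subst₂ (λ φ ψ → T ⊢ (E! (↑ t) ⇒ ((v0 ≐ ↑ t) ⇒ (φ ⇒ ψ))))
      (trans (subF-ren {τ = var} (λ { zero → refl ; (suc _) → refl }) θ)
             (trans (subF-var {f = id} (λ _ → refl) θ) (renF-id (λ _ → refl) θ)))
      (trans (subF-ren {τ = τ} (λ { zero → refl ; (suc _) → refl }) θ)
             (sym (renF-sub (λ { zero → refl ; (suc _) → refl }) θ)))
      (⇒-ap (ax-∀t (↑ t)) (⇒-const (gen leib)))

  ⊢-replace⁻ : (θ : Formula R (suc n)) (t : Term R n) →
               T ⊢ ((v0 ≐ ↑ t) ⇒ (↑F (sub0 θ t) ⇒ θ))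
  ⊢-replace⁻ θ t = ⇒-trans (⊢-replace (¬̇ θ) t) ax-N

  True-replace : (θ : Formula R (suc n)) (t : Term R n) {a : ℕ} → Denotes t ρ a →
                 True (sub0 θ t) ρ ⟷ True θ (a ∷ ρ)
  True-replace θ t den =
      (λ d → True-⇒-elim (True-⇒-elim (⊢⇒True (⊢-replace⁻ θ t)) den) (proj₂ (True-ren suc (λ _ → refl) (sub0 θ t)) d))
    , (λ d → proj₁ (True-ren suc (λ _ → refl) (sub0 θ t)) (True-⇒-elim (True-⇒-elim (⊢⇒True (⊢-replace θ t)) den) d))

  ren₂ : Fin n → Fin n → Fin 2 → Fin n
  ren₂ i j zero       = i
  ren₂ i j (suc zero) = j

  True-≈ : ∀ (ρ : Vec ℕ n) i j → True (var i ≐ var j) ρ ⟷ lookup ρ i ≈ lookup ρ j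
  True-≈ ρ i j = True-ren (ren₂ i j) (λ { zero → refl ; (suc zero) → refl }) (v0 ≐ v1)

  ≈-refl′ : ∀ {a} → a ≈ a
  ≈-refl′ {a} = proj₁ (True-≈ (a ∷ []) zero zero) (⊢⇒True (ax-refl zero))

  ≈-sym′ : ∀ {a b} → a ≈ b → b ≈ a
  ≈-sym′ {a} {b} p = proj₁ (True-≈ (b ∷ a ∷ []) zero (suc zero))
    (True-leibniz (v0 ≐ v1) p (proj₂ (True-≈ (a ∷ a ∷ []) zero (suc zero)) ≈-refl′))

  Denotes-desc : (φ : Formula R (suc n)) {ρ : Vec ℕ n} {a : ℕ} →
                 Denotes (desc φ) ρ a ⟷ (∀ x → True φ (x ∷ ρ) ⟷ x ≈ a)
  Denotes-desc φ {ρ} {a} =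
      (λ d x → let p , q = True-∧-elim (True-∀-elim (True-⇒-elim (proj₁ lambert) d) x) in
          (λ e → proj₁ (True-≈ (x ∷ a ∷ ρ) zero (suc zero)) (True-⇒-elim p (proj₂ (ren-φ x) e)))
        , (λ e → proj₁ (ren-φ x) (True-⇒-elim q (proj₂ (True-≈ (x ∷ a ∷ ρ) zero (suc zero)) e))))
    , (λ h → True-⇒-elim (proj₂ lambert) (True-∀-intro λ x → True-∧-intro
        (True-⇒-intro λ e → proj₂ (True-≈ (x ∷ a ∷ ρ) zero (suc zero)) (proj₁ (h x) (proj₁ (ren-φ x) e)))
        (True-⇒-intro λ e → proj₂ (ren-φ x) (proj₂ (h x) (proj₁ (True-≈ (x ∷ a ∷ ρ) zero (suc zero)) e)))))
    where
    lambert = True-∧-elim (True-∀-elim (⊢⇒True (ax-ι φ)) a)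
    ren-φ : ∀ x → (True (renF skip1 φ) (x ∷ a ∷ ρ) → True φ (x ∷ ρ)) × (True φ (x ∷ ρ) → True (renF skip1 φ) (x ∷ a ∷ ρ))
    ren-φ x = True-ren skip1 {x ∷ a ∷ ρ} {x ∷ ρ} (λ { zero → refl ; (suc _) → refl }) φ

  True-strict : (θ : Formula R (suc n)) (t : Term R n) {φ : Formula R n} → sub0 θ t ≡ φ → T ⊢ (φ ⇒ E! t) →
                True φ ρ ⟷ ∃ λ a → Denotes t ρ a × True θ (a ∷ ρ)
  True-strict θ t refl strict =
      (λ d → let a , den = True-E! t (True-⇒-elim (⊢⇒True strict) d) in a , den , proj₁ (True-replace θ t den) d)
    , (λ (a , den , d) → proj₂ (True-replace θ t den) d)

  Denotes-↑ : (t : Term R n) {ρ : Vec ℕ n} (a b : ℕ) → Denotes (↑ t) (a ∷ ρ) b ⟷ Denotes t ρ b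
  Denotes-↑ t {ρ} a b = subst (λ u → True (v0 ≐ u) (b ∷ a ∷ ρ) ⟷ True (v0 ≐ ↑ t) (b ∷ ρ))
    (renT-square {f = suc} {g = liftR suc} {f′ = suc} {g′ = suc} (λ _ → refl) t)
    (True-ren (liftR suc) (λ { zero → refl ; (suc _) → refl }) (v0 ≐ ↑ t))

  -- `P` stands for `rel r` and for `_≐_`. Strictness supplies a value for one argument at a time,
  -- the second in an environment that already holds the value of the first.
  True-binary : (P : ∀ {k} → Term R k → Term R k → Formula R k) (t u : Term R n) {ρ : Vec ℕ n} →
                sub0 (P v0 (↑ u)) t ≡ P t u → sub0 (P v1 v0) (↑ u) ≡ P v0 (↑ u) →
                renF (ren₂ (suc zero) zero) (P v0 v1) ≡ P v1 v0 →
                T ⊢ (P t u ⇒ E! t) → T ⊢ (P v0 (↑ u) ⇒ E! (↑ u)) →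
                True (P t u) ρ ⟷ ∃ λ a → Denotes t ρ a × ∃ λ b → Denotes u ρ b × True (P v0 v1) (a ∷ b ∷ [])
  True-binary P t u {ρ} eq₁ eq₂ eq₃ strict₁ strict₂ = ⟷-trans (True-strict (P v0 (↑ u)) t eq₁ strict₁)
    ( (λ (a , den , d) → let b , den′ , d′ = proj₁ (True-strict (P v1 v0) (↑ u) eq₂ strict₂) d
                         in a , den , b , proj₁ (Denotes-↑ u a b) den′ , proj₁ (swap a b) d′)
    , (λ (a , den , b , den′ , d) → a , den , proj₂ (True-strict (P v1 v0) (↑ u) eq₂ strict₂)
                                                    (b , proj₂ (Denotes-↑ u a b) den′ , proj₂ (swap a b) d)))
    where
    swap : ∀ a b → True (P v1 v0) (b ∷ a ∷ ρ) ⟷ True (P v0 v1) (a ∷ b ∷ [])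
    swap a b = subst (λ φ → True φ (b ∷ a ∷ ρ) ⟷ True (P v0 v1) (a ∷ b ∷ [])) eq₃
      (True-ren (ren₂ (suc zero) zero) (λ { zero → refl ; (suc zero) → refl }) (P v0 v1))

  relation-resp : ∀ r {a a′ b} → a ≈ a′ → relation r a b → relation r a′ b
  relation-resp r = True-leibniz (rel r v0 v1)

  ≈-respˡ : ∀ {a a′ b} → a ≈ a′ → a ≈ b → a′ ≈ b
  ≈-respˡ = True-leibniz (v0 ≐ v1)

  ⟦⟧≔-map : (t : Term R n) {K L : ℕ → Set} → (∀ a → K a → L a) → ⟦ t ⟧≔ ρ K → ⟦ t ⟧≔ ρ L
  ⟦⟧≔-map (var i)  f k           = f _ k
  ⟦⟧≔-map (desc φ) f (a , d , k) = a , d , f a k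

  relation-respʳ : ∀ r {a b b′} → b ≈ b′ → relation r a b → relation r a b′
  relation-respʳ r {a} {b} {b′} p d =
    proj₁ (True-ren (ren₂ (suc zero) zero) {b′ ∷ a ∷ []} (λ { zero → refl ; (suc zero) → refl }) (rel r v0 v1))
      (True-leibniz (rel r v1 v0) p
        (proj₂ (True-ren (ren₂ (suc zero) zero) {b ∷ a ∷ []} (λ { zero → refl ; (suc zero) → refl }) (rel r v0 v1)) d))

  ≈-respʳ : ∀ {a b b′} → b ≈ b′ → a ≈ b → a ≈ b′
  ≈-respʳ p d = ≈-sym′ (≈-respˡ p (≈-sym′ d))

  mutual
    ⟦⟧⟷True : (φ : Formula R n) {ρ : Vec ℕ n} → ⟦ φ ⟧ ρ ⟷ True φ ρ
    ⟦⟧⟷True (rel r t u) = ⟷-trans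
      (⟦⟧≔⟷Denotes t (λ p → ⟦⟧≔-map u λ _ → relation-resp r p)
                     λ _ → ⟦⟧≔⟷Denotes u (relation-respʳ r) λ _ → ⟷-refl)
      (⟷-sym (True-binary (rel r) t u (cong (rel r t) (subT-↑ (λ _ → refl) u)) refl refl
                           (ax-strict-rel₁ r t u) (ax-strict-rel₂ r v0 (↑ u))))
    ⟦⟧⟷True (t ≐ u) = ⟷-trans
      (⟦⟧≔⟷Denotes t (λ p → ⟦⟧≔-map u λ _ → ≈-respˡ p)
                     λ _ → ⟦⟧≔⟷Denotes u ≈-respʳ λ _ → ⟷-refl)
      (⟷-sym (True-binary _≐_ t u (cong (t ≐_) (subT-↑ (λ _ → refl) u)) refl refl
                           (ax-strict-eq₁ t u) (ax-strict-eq₂ v0 (↑ u))))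
    ⟦⟧⟷True (¬̇ φ)   = (λ h → True-¬-intro (h ∘ proj₂ (⟦⟧⟷True φ))) , (λ d → True-¬-elim d ∘ proj₁ (⟦⟧⟷True φ))
    ⟦⟧⟷True (φ ⇒ ψ) = (λ h → True-⇒-intro (proj₁ (⟦⟧⟷True ψ) ∘ h ∘ proj₂ (⟦⟧⟷True φ)))
                    , (λ d → proj₂ (⟦⟧⟷True ψ) ∘ True-⇒-elim d ∘ proj₁ (⟦⟧⟷True φ))
    ⟦⟧⟷True (∀̇ φ)   = (λ h → True-∀-intro λ x → proj₁ (⟦⟧⟷True φ) (h x))
                    , (λ d x → proj₂ (⟦⟧⟷True φ) (True-∀-elim d x))

    -- A term has its value only up to `≈`, hence the requirement that `K` respect it. For a
    -- description, `ax-ι` turns denotation into the condition used by the semantics.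
    ⟦⟧≔⟷Denotes : (t : Term R n) {ρ : Vec ℕ n} {K L : ℕ → Set} →
                   (∀ {a b} → a ≈ b → K a → K b) → (∀ a → K a ⟷ L a) →
                   ⟦ t ⟧≔ ρ K ⟷ ∃ λ a → Denotes t ρ a × L a
    ⟦⟧≔⟷Denotes (var i) {ρ} resp K⟷L =
        (λ k → lookup ρ i , proj₂ (True-≈ (lookup ρ i ∷ ρ) zero (suc i)) ≈-refl′ , proj₁ (K⟷L _) k)
      , (λ (a , den , k) → resp (proj₁ (True-≈ (a ∷ ρ) zero (suc i)) den) (proj₂ (K⟷L a) k))
    ⟦⟧≔⟷Denotes (desc φ) resp K⟷L =
        (λ (a , h , k) → a , proj₂ (Denotes-desc φ) (λ x → ⟷-trans (⟷-sym (⟦⟧⟷True φ)) (h x)) , proj₁ (K⟷L a) k)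
      , (λ (a , den , k) → a , (λ x → ⟷-trans (⟦⟧⟷True φ) (proj₁ (Denotes-desc φ) den x)) , proj₂ (K⟷L a) k)

  termModel : Model T
  termModel = record
    { structure = termStructure
    ; ≈-refl    = ≈-refl′
    ; leibniz   = λ φ p d → proj₂ (⟦⟧⟷True φ) (True-leibniz φ p (proj₁ (⟦⟧⟷True φ) d))
    ; stable    = λ φ f → proj₂ (⟦⟧⟷True φ) (True-stable λ g → f λ d → g (proj₁ (⟦⟧⟷True φ) d))
    ; witness   = λ φ d → let a , e = True-∃-elim (proj₁ (⟦⟧⟷True (∃̇ φ)) d) in a , proj₂ (⟦⟧⟷True φ) e
    ; sound     = λ {φ} a → proj₂ (⟦⟧⟷True φ)
        (proj₁ (True-ren (λ ()) (λ ()) φ) (⊢⇒True {ρ = []} (ax a)))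
    }

module Completeness {R : Set} (rels : List R) (rels-complete : ∀ r → r ∈ˡ rels)
                    (T : Formula R zero → Set) {θ : Formula R 1} (nonempty : T ⊢ ∃̇ θ) where

  open Derivations T
  open Families T
  open Enumeration rels rels-complete

  -- The calculus allows an empty domain, so discarding a free variable needs T ⊢ ∃̇ θ.
  strengthen : {φ : Formula R zero} → T ⊢ ↑F φ → T ⊢ φ
  strengthen d = mp ¬¬-elim (mp (mp contraposition
    (mp ax-∀⇒ (gen (⇒-ap ¬-elim (⇒-const d))))) nonempty)

  ⊩⇒⊢ : {s : Family R} → (λ _ → ⊥) ⊩ s → ∃ λ N₀ → ∀ N → N₀ ≤ N → T ⊢ s N
  ⊩⇒⊢ (thm N₀ d) = N₀ , d
  ⊩⇒⊢ (app d e) with ⊩⇒⊢ d | ⊩⇒⊢ e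
  ... | N₁ , d′ | N₂ , e′ = N₁ ⊔ N₂ , λ N h → mp (d′ N (≤-trans (m≤m⊔n N₁ N₂) h)) (e′ N (≤-trans (m≤n⊔m N₁ N₂) h))

  -- The extension starts from `¬̇ φ`. Its term model makes both this and the valid `φ` true, so the
  -- limit proves `falsum`; the inconsistency descends to the starting hypothesis, whose discharge
  -- proves `φ`.
  completeness : {φ : Formula R zero} → ((𝓜 : Model T) → Model.⟦_⟧ 𝓜 φ []) → T ⊢ φ
  -- The derivation obtained lives over `suc N` free variables. They are all identified, leaving one
  -- variable for `strengthen` to discard.
  completeness {φ} valid = strengthen (subst (T ⊢_)
      (renF-∘ {g = λ _ → zero} (λ ()) φ)
      (⊢-ren (λ _ → zero) (proj₂ (⊩⇒⊢ φ-derivable) _ ≤-refl)))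
    where
    open Extension T sentence sentence-surjective (¬̇ φ)
    open TermModel T sentence sentence-surjective (¬̇ φ)
    stage-zero-absurd : stage zero ⊩ falsum
    stage-zero-absurd = limit-reflects
      (True-¬-elim (true (hyp (zero , refl))) (proj₁ (⟦⟧⟷True φ) (valid termModel)))
    φ-derivable : (λ _ → ⊥) ⊩ ⟪ φ ⟫ []
    φ-derivable = by-contradiction (deduction (⊩-mono inj₂ stage-zero-absurd))

-- Set theory inside a model of ZF

module SetTheory (𝓜 : Model ZFAxiom) where

  open Model 𝓜

  M : Set
  M = Carrier

  infix 4 _∈_ _⊆_
  infix 3 ¬_
  infixr 2 _∨_

  _∈_ : M → M → Set
  a ∈ b = relation mem a b

  _⊆_ : M → M → Set
  a ⊆ b = ∀ x → x ∈ a → x ∈ b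

  ¬_ : Set → Set
  ¬ A = A → Absurdity

  -- A true disjunction of the model need not decide between its sides, so it is read as a doubly
  -- negated sum and eliminated only into stable goals.
  _∨_ : Set → Set → Set
  A ∨ B = ¬ ¬ (A ⊎ B)

  Stable : Set → Set
  Stable A = ¬ ¬ A → A

  left : {A B : Set} → A → A ∨ B
  left a k = k (inj₁ a)

  right : {A B : Set} → B → A ∨ B
  right b k = k (inj₂ b)

  cases : {A B C : Set} → Stable C → A ∨ B → (A → C) → (B → C) → C
  cases st a∨b f g = st λ k → a∨b λ { (inj₁ a) → k (f a) ; (inj₂ b) → k (g b) }

  absurd : {A : Set} → Stable A → Absurdity → A
  absurd st z = st λ _ → z

  stable-¬ : {A : Set} → Stable (¬ A)
  stable-¬ k a = k λ f → f a

  stable-× : {A B : Set} → Stable A → Stable B → Stable (A × B)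
  stable-× s t k = s (λ h → k (h ∘ proj₁)) , t (λ h → k (h ∘ proj₂))

  by-cases : {A C : Set} → Stable C → (A → C) → (¬ A → C) → C
  by-cases st f g = st λ k → k (g λ a → k (f a))

  stable-∈ : ∀ {a b} → Stable (a ∈ b)
  stable-∈ {a} {b} = stable (v0 ∈z v1) {a ∷ b ∷ []}

  stable-≈ : ∀ {a b} → Stable (a ≈ b)
  stable-≈ {a} {b} = stable (v0 ≐ v1) {a ∷ b ∷ []}

  ≈-sym : ∀ {a b} → a ≈ b → b ≈ a
  ≈-sym {a} p = leibniz (v0 ≐ v1) {a ∷ []} p ≈-refl

  ≈-trans : ∀ {a b c} → a ≈ b → b ≈ c → a ≈ c
  ≈-trans {c = c} p q = leibniz (v0 ≐ v1) {c ∷ []} (≈-sym p) q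

  ∈-respˡ : ∀ {a b c} → a ≈ b → a ∈ c → b ∈ c
  ∈-respˡ {c = c} = leibniz (v0 ∈z v1) {c ∷ []}

  ∈-respʳ : ∀ {a b c} → a ≈ b → c ∈ a → c ∈ b
  ∈-respʳ {c = c} = leibniz (v1 ∈z v0) {c ∷ []}

  -- Formulas and terms with a readable interpretation

  Value : ZTerm n → Env n → M → Set
  Value (var i)  ρ a = lookup ρ i ≈ a
  Value (desc φ) ρ a = ∀ x → ⟦ φ ⟧ (x ∷ ρ) ⟷ x ≈ a

  -- `Value` computes on the term; the record keeps the term inferable.
  record Den (t : ZTerm n) (ρ : Env n) (a : M) : Set where
    constructor denotes
    field value : Value t ρ a

  private variable
    φ ψ : ZForm n
    t u : ZTerm n
    ρ   : Env n
    a b : M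

  var-den : {i : Fin n} → Den (var i) ρ (lookup ρ i)
  var-den = denotes ≈-refl

  Den-≔ : Den t ρ a → {K : M → Set} → (∀ {b c} → b ≈ c → K b → K c) → ⟦ t ⟧≔ ρ K ⟷ K a
  Den-≔ {t = var i}          (denotes d) resp = resp d , resp (≈-sym d)
  Den-≔ {t = desc φ} {a = a} (denotes d) resp =
    (λ (b , d′ , k) → resp (proj₁ (d b) (proj₂ (d′ b) ≈-refl)) k) , (λ k → a , d , k)

  Den-∈ : Den t ρ a → Den u ρ b → ⟦ t ∈z u ⟧ ρ ⟷ a ∈ b
  Den-∈ {ρ = ρ} {u = u} d e = ⟷-trans (Den-≔ d respˡ) (Den-≔ e ∈-respʳ)
    where
    respˡ : ∀ {b c} → b ≈ c → ⟦ u ⟧≔ ρ (λ x → b ∈ x) → ⟦ u ⟧≔ ρ (λ x → c ∈ x)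
    respˡ p h = proj₂ (Den-≔ e ∈-respʳ) (∈-respˡ p (proj₁ (Den-≔ e ∈-respʳ) h))

  Den-≐ : Den t ρ a → Den u ρ b → ⟦ t ≐ u ⟧ ρ ⟷ a ≈ b
  Den-≐ {ρ = ρ} {u = u} d e = ⟷-trans (Den-≔ d respˡ) (Den-≔ e respʳ)
    where
    respʳ : ∀ {x b c} → b ≈ c → x ≈ b → x ≈ c
    respʳ p q = ≈-trans q p
    respˡ : ∀ {b c} → b ≈ c → ⟦ u ⟧≔ ρ (λ x → b ≈ x) → ⟦ u ⟧≔ ρ (λ x → c ≈ x)
    respˡ p h = proj₂ (Den-≔ e respʳ) (≈-trans (≈-sym p) (proj₁ (Den-≔ e respʳ) h))

  Den-ren : (f : Fin n → Fin m) {ρ : Env m} {ρ′ : Env n} → (∀ i → lookup ρ (f i) ≡ lookup ρ′ i) →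
            Den t ρ′ a → Den (renT f t) ρ a
  Den-ren {t = var i} {a = a}  f eq (denotes d) = denotes (subst (λ b → b ≈ a) (sym (eq i)) d)
  Den-ren {t = desc φ} f eq (denotes d) =
    denotes λ x → ⟷-trans (⟦⟧-ren (liftR f) (lookup-liftR f eq x) φ) (d x)

  Den-↑ : {x : M} → Den t ρ a → Den (↑ t) (x ∷ ρ) a
  Den-↑ = Den-ren suc (λ _ → refl)

  record Means (φ : ZForm n) (ρ : Env n) (A : Set) : Set where
    constructor means
    field iff : ⟦ φ ⟧ ρ ⟷ A
  open Means public

  private variable
    A B : Set

  means-stable : Means φ ρ A → Stable A
  means-stable {φ = φ} (means (f , g)) k = f (stable φ λ h → k (h ∘ g))

  ¬-means : Means φ ρ A → Means (¬̇ φ) ρ (¬ A)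
  ¬-means (means c) = means (⟷-→ c ⟷-refl)

  ⇒-means : Means φ ρ A → Means ψ ρ B → Means (φ ⇒ ψ) ρ (A → B)
  ⇒-means (means c) (means d) = means (⟷-→ c d)

  ∧-means : Means φ ρ A → Means ψ ρ B → Means (φ ∧̇ ψ) ρ (A × B)
  ∧-means p@(means (f , g)) q@(means (f′ , g′)) = means
    ( (λ k → stable-× (means-stable p) (means-stable q) λ h → k λ a b → h (f a , f′ b))
    , (λ (a , b) k → k (g a) (g′ b)))

  ∨-means : Means φ ρ A → Means ψ ρ B → Means (φ ∨̇ ψ) ρ (A ∨ B)
  ∨-means {ψ = ψ} (means (f , g)) (means (f′ , g′)) = means
    ( (λ h k → k (inj₂ (f′ (h λ a → k (inj₁ (f a))))))
    , (λ a∨b na → cases (stable ψ) a∨b (λ a → absurd (stable ψ) (na (g a))) g′))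

  ⇔-means : Means φ ρ A → Means ψ ρ B → Means (φ ⇔ ψ) ρ (A ⟷ B)
  ⇔-means c d = ∧-means (⇒-means c d) (⇒-means d c)

  ∀-means : {A : M → Set} → (∀ x → Means φ (x ∷ ρ) (A x)) → Means (∀̇ φ) ρ (∀ x → A x)
  ∀-means c = means ((λ h x → proj₁ (iff (c x)) (h x)) , (λ h x → proj₂ (iff (c x)) (h x)))

  ∃-means : {A : M → Set} → (∀ x → Means φ (x ∷ ρ) (A x)) → Means (∃̇ φ) ρ (∃ A)
  ∃-means {φ = φ} c = means
    ( (λ h → let a , p = witness φ h in a , proj₁ (iff (c a)) p)
    , (λ (a , p) k → k a (proj₂ (iff (c a)) p)))

  ∈-means : Den t ρ a → Den u ρ b → Means (t ∈z u) ρ (a ∈ b)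
  ∈-means d e = means (Den-∈ d e)

  ≐-means : Den t ρ a → Den u ρ b → Means (t ≐ u) ρ (a ≈ b)
  ≐-means d e = means (Den-≐ d e)

  ren-means : {f : Fin n → Fin m} {ρ : Env m} {ρ′ : Env n} → (∀ i → lookup ρ (f i) ≡ lookup ρ′ i) →
              Means φ ρ′ A → Means (renF f φ) ρ A
  ren-means {φ = φ} {f = f} eq (means c) = means (⟷-trans (⟦⟧-ren f eq φ) c)

  means-⟷ : Means φ ρ A → A ⟷ B → Means φ ρ B
  means-⟷ (means c) e = means (⟷-trans c e)

  -- The body is interpreted under the assumption `x ∈ a`, since it may contain an application that
  -- denotes only for arguments in the domain of a function.
  ∀∈-means : {A : M → Set} → Den t ρ a → (∀ x → x ∈ a → Means φ (x ∷ ρ) (A x)) →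
             Means (∀∈z t φ) ρ (∀ x → x ∈ a → A x)
  ∀∈-means {t = t} {ρ = ρ} {a = a} d c = means
    ( (λ h x x∈a → proj₁ (iff (c x x∈a)) (h x (proj₂ (bound x) x∈a)))
    , (λ h x x∈t → let x∈a = proj₁ (bound x) x∈t in proj₂ (iff (c x x∈a)) (h x x∈a)))
    where
    bound : ∀ x → ⟦ v0 ∈z ↑ t ⟧ (x ∷ ρ) ⟷ x ∈ a
    bound x = Den-∈ (var-den {i = zero}) (Den-↑ d)

  ∃∈-means : {A : M → Set} → Den t ρ a → (∀ x → Means φ (x ∷ ρ) (A x)) →
             Means (∃∈z t φ) ρ (∃ λ x → x ∈ a × A x)
  ∃∈-means d c = ∃-means λ x → ∧-means (∈-means var-den (Den-↑ d)) (c x)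

  -- A formula together with the Agda proposition that it expresses. Axiom schemas are instantiated
  -- through `form`, arguments run on `sem`, and every such `sem` is stable and invariant under `≈`.
  record Fm (n : ℕ) : Set₁ where
    field
      form : ZForm n
      sem  : Env n → Set
      corr : ∀ ρ → Means form ρ (sem ρ)
  open Fm public

  record Tm (n : ℕ) : Set where
    field
      term : ZTerm n
      val  : Env n → M
      den  : ∀ ρ → Den term ρ (val ρ)
  open Tm public

  stableᶠ : (P : Fm n) {ρ : Env n} → Stable (sem P ρ)
  stableᶠ P {ρ} = means-stable (corr P ρ)

  interpret : (P : Fm n) {ρ : Env n} → ⟦ form P ⟧ ρ → sem P ρ
  interpret P {ρ} = proj₁ (iff (corr P ρ))

  realise : (P : Fm n) {ρ : Env n} → sem P ρ → ⟦ form P ⟧ ρ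
  realise P {ρ} = proj₂ (iff (corr P ρ))

  leibnizᶠ : (P : Fm (suc n)) {ρ : Env n} {a b : M} → a ≈ b → sem P (a ∷ ρ) → sem P (b ∷ ρ)
  leibnizᶠ P p s = interpret P (leibniz (form P) p (realise P s))

  varᵗ : Fin n → Tm n
  varᵗ i = record { term = var i ; val = λ ρ → lookup ρ i ; den = λ ρ → var-den }

  x0 : Tm (1 + n)
  x0 = varᵗ zero
  x1 : Tm (2 + n)
  x1 = varᵗ (suc zero)
  x2 : Tm (3 + n)
  x2 = varᵗ (suc (suc zero))
  x3 : Tm (4 + n)
  x3 = varᵗ (suc (suc (suc zero)))
  x4 : Tm (5 + n)
  x4 = varᵗ (suc (suc (suc (suc zero))))

  ↑ᵗ : Tm n → Tm (suc n)
  ↑ᵗ t = record { term = ↑ (term t) ; val = λ ρ → val t (tail ρ)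
                ; den = λ { (x ∷ ρ) → Den-↑ (den t ρ) } }

  infix  7 _∈ᶠ_ _≐ᶠ_ _⊆ᶠ_
  infixr 6 _∧ᶠ_ _∨ᶠ_
  infixr 5 _⇒ᶠ_ _⇔ᶠ_

  _∈ᶠ_ : Tm n → Tm n → Fm n
  t ∈ᶠ u = record { form = term t ∈z term u ; sem = λ ρ → val t ρ ∈ val u ρ
                  ; corr = λ ρ → ∈-means (den t ρ) (den u ρ) }

  _≐ᶠ_ : Tm n → Tm n → Fm n
  t ≐ᶠ u = record { form = term t ≐ term u ; sem = λ ρ → val t ρ ≈ val u ρ
                  ; corr = λ ρ → ≐-means (den t ρ) (den u ρ) }

  ¬ᶠ_ : Fm n → Fm n
  ¬ᶠ P = record { form = ¬̇ form P ; sem = λ ρ → ¬ sem P ρ ; corr = λ ρ → ¬-means (corr P ρ) }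

  _⇒ᶠ_ : Fm n → Fm n → Fm n
  P ⇒ᶠ Q = record { form = form P ⇒ form Q ; sem = λ ρ → sem P ρ → sem Q ρ
                  ; corr = λ ρ → ⇒-means (corr P ρ) (corr Q ρ) }

  _∧ᶠ_ : Fm n → Fm n → Fm n
  P ∧ᶠ Q = record { form = form P ∧̇ form Q ; sem = λ ρ → sem P ρ × sem Q ρ
                  ; corr = λ ρ → ∧-means (corr P ρ) (corr Q ρ) }

  _∨ᶠ_ : Fm n → Fm n → Fm n
  P ∨ᶠ Q = record { form = form P ∨̇ form Q ; sem = λ ρ → sem P ρ ∨ sem Q ρ
                  ; corr = λ ρ → ∨-means (corr P ρ) (corr Q ρ) }

  _⇔ᶠ_ : Fm n → Fm n → Fm n
  φ ⇔ᶠ ψ = (φ ⇒ᶠ ψ) ∧ᶠ (ψ ⇒ᶠ φ)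

  ∀ᶠ : Fm (suc n) → Fm n
  ∀ᶠ P = record { form = ∀̇ (form P) ; sem = λ ρ → ∀ x → sem P (x ∷ ρ)
                ; corr = λ ρ → ∀-means λ x → corr P (x ∷ ρ) }

  ∃ᶠ : Fm (suc n) → Fm n
  ∃ᶠ P = record { form = ∃̇ (form P) ; sem = λ ρ → ∃ λ x → sem P (x ∷ ρ)
                ; corr = λ ρ → ∃-means λ x → corr P (x ∷ ρ) }

  ∀∈ᶠ ∃∈ᶠ : Tm n → Fm (suc n) → Fm n
  ∀∈ᶠ t φ = ∀ᶠ ((x0 ∈ᶠ ↑ᵗ t) ⇒ᶠ φ)
  ∃∈ᶠ t φ = ∃ᶠ ((x0 ∈ᶠ ↑ᵗ t) ∧ᶠ φ)

  _⊆ᶠ_ : Tm n → Tm n → Fm n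
  t ⊆ᶠ u = ∀∈ᶠ t (x0 ∈ᶠ ↑ᵗ u)

  renᶠ : (f : Fin n → Fin m) (g : Env m → Env n) → (∀ ρ i → lookup ρ (f i) ≡ lookup (g ρ) i) → Fm n → Fm m
  renᶠ f g eq P = record { form = renF f (form P) ; sem = λ ρ → sem P (g ρ)
                         ; corr = λ ρ → ren-means (eq ρ) (corr P (g ρ)) }

  drop₁ : Env (2 + n) → Env (1 + n)
  drop₁ (x ∷ _ ∷ ρ) = x ∷ ρ

  drop₂ : Env (3 + n) → Env (2 + n)
  drop₂ (x ∷ y ∷ _ ∷ ρ) = x ∷ y ∷ ρ

  lookup-drop₁ : (ρ : Env (2 + n)) (i : Fin (1 + n)) → lookup ρ (skip1 i) ≡ lookup (drop₁ ρ) i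
  lookup-drop₁ (x ∷ _ ∷ ρ) zero    = refl
  lookup-drop₁ (x ∷ _ ∷ ρ) (suc i) = refl

  lookup-drop₂ : (ρ : Env (3 + n)) (i : Fin (2 + n)) → lookup ρ (skip2 i) ≡ lookup (drop₂ ρ) i
  lookup-drop₂ (x ∷ y ∷ _ ∷ ρ) zero          = refl
  lookup-drop₂ (x ∷ y ∷ _ ∷ ρ) (suc zero)    = refl
  lookup-drop₂ (x ∷ y ∷ _ ∷ ρ) (suc (suc i)) = refl

  skip1ᶠ : Fm (1 + n) → Fm (2 + n)
  skip1ᶠ = renᶠ skip1 drop₁ lookup-drop₁

  skip2ᶠ : Fm (2 + n) → Fm (3 + n)
  skip2ᶠ = renᶠ skip2 drop₂ lookup-drop₂

  skip1ᵗ : Tm (1 + n) → Tm (2 + n)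
  skip1ᵗ t = record { term = renT skip1 (term t) ; val = λ ρ → val t (drop₁ ρ)
                    ; den = λ ρ → Den-ren skip1 (lookup-drop₁ ρ) (den t (drop₁ ρ)) }

  val-cong : (t : Tm (suc n)) {ρ : Env n} {a b : M} → a ≈ b → val t (a ∷ ρ) ≈ val t (b ∷ ρ)
  val-cong t p = leibnizᶠ (x1 ≐ᶠ skip1ᵗ t) p ≈-refl

  ∃!ᶠ : Fm (suc n) → Fm n
  ∃!ᶠ φ = ∃ᶠ (φ ∧ᶠ ∀ᶠ (skip1ᶠ φ ⇒ᶠ (x0 ≐ᶠ x1)))

  -- The axioms of ZF

  sound-closeAll : ∀ k (φ : ZForm k) → ⟦ closeAll k φ ⟧ [] → ∀ ρ → ⟦ φ ⟧ ρ
  sound-closeAll zero    φ h []      = h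
  sound-closeAll (suc k) φ h (x ∷ ρ) = sound-closeAll k (∀̇ φ) h ρ x

  ext : ∀ {a b} → (∀ x → x ∈ a ⟷ x ∈ b) → a ≈ b
  ext {a} {b} = interpret (∀ᶠ (∀ᶠ (∀ᶠ ((x0 ∈ᶠ x2) ⇔ᶠ (x0 ∈ᶠ x1)) ⇒ᶠ (x1 ≐ᶠ x0)))) {[]} (sound extensionality) a b

  ∈-cong : ∀ {a b} → a ≈ b → ∀ x → x ∈ a ⟷ x ∈ b
  ∈-cong p x = ∈-respʳ p , ∈-respʳ (≈-sym p)

  abstract
    separate : (P : Fm (suc n)) (ρ : Env n) (z : M) → ∃ λ y → ∀ x → x ∈ y ⟷ (x ∈ z × sem P (x ∷ ρ))
    separate {n} P ρ z = interpret instanceᶠ (sound-closeAll n (form instanceᶠ) axiom ρ) z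
      where
      instanceᶠ : Fm n
      instanceᶠ = ∀ᶠ (∃ᶠ (∀ᶠ ((x0 ∈ᶠ x1) ⇔ᶠ ((x0 ∈ᶠ x2) ∧ᶠ skip1ᶠ (skip1ᶠ P)))))
      axiom : ⟦ closeAll n (form instanceᶠ) ⟧ []
      axiom = sound (separation n (renF skip1 (form P)))

    collect : (P : Fm (2 + n)) (ρ : Env n) (A : M) →
              (∀ x → x ∈ A → ∃ λ y → sem P (y ∷ x ∷ ρ) × (∀ y′ → sem P (y′ ∷ x ∷ ρ) → y′ ≈ y)) →
              ∃ λ Y → ∀ x → x ∈ A → ∃ λ y → y ∈ Y × sem P (y ∷ x ∷ ρ)
    collect {n} P ρ A = interpret instanceᶠ (sound-closeAll n (form instanceᶠ) axiom ρ) A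
      where
      instanceᶠ : Fm n
      instanceᶠ = ∀ᶠ (∀∈ᶠ x0 (∃!ᶠ (skip2ᶠ P)) ⇒ᶠ ∃ᶠ (∀∈ᶠ x1 (∃∈ᶠ x1 (skip2ᶠ (skip2ᶠ P)))))
      axiom : ⟦ closeAll n (form instanceᶠ) ⟧ []
      axiom = sound (replacement n (renF skip2 (form P)))

    -- The axiom provides only a set `Y` meeting all the values; separation trims it to the image.
    -- Uniqueness of values puts every value, not merely some value for each `x`, into `Y`.
    replace : (P : Fm (2 + n)) (ρ : Env n) (A : M) →
              (∀ x → x ∈ A → ∃ λ y → sem P (y ∷ x ∷ ρ) × (∀ y′ → sem P (y′ ∷ x ∷ ρ) → y′ ≈ y)) →
              ∃ λ Y → ∀ y → y ∈ Y ⟷ ∃ λ x → x ∈ A × sem P (y ∷ x ∷ ρ)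
    replace {n} P ρ A functional =
      proj₁ Z , λ y → (λ y∈Z → proj₂ (proj₁ (proj₂ Z y) y∈Z))
                    , λ (x , x∈A , p) → proj₂ (proj₂ Z y) (in-Y x x∈A p , x , x∈A , p)
      where
      swap₀₁ : Fin (2 + n) → Fin (3 + n)
      swap₀₁ zero          = suc zero
      swap₀₁ (suc zero)    = zero
      swap₀₁ (suc (suc i)) = suc (suc (suc i))
      swapEnv : Env (3 + n) → Env (2 + n)
      swapEnv (x ∷ y ∷ _ ∷ ρ) = y ∷ x ∷ ρ
      lookup-swap : (ρ : Env (3 + n)) (i : Fin (2 + n)) → lookup ρ (swap₀₁ i) ≡ lookup (swapEnv ρ) i
      lookup-swap (x ∷ y ∷ _ ∷ ρ) zero          = refl
      lookup-swap (x ∷ y ∷ _ ∷ ρ) (suc zero)    = refl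
      lookup-swap (x ∷ y ∷ _ ∷ ρ) (suc (suc i)) = refl
      Y : ∃ λ Y → ∀ x → x ∈ A → ∃ λ y → y ∈ Y × sem P (y ∷ x ∷ ρ)
      Y = collect P ρ A functional
      Z : ∃ λ Z → ∀ y → y ∈ Z ⟷ (y ∈ proj₁ Y × ∃ λ x → x ∈ A × sem P (y ∷ x ∷ ρ))
      Z = separate (∃∈ᶠ x1 (renᶠ swap₀₁ swapEnv lookup-swap P)) (A ∷ ρ) (proj₁ Y)
      in-Y : ∀ {y} x → x ∈ A → sem P (y ∷ x ∷ ρ) → y ∈ proj₁ Y
      in-Y x x∈A p = let y₀ , _ , uniq = functional x x∈A
                         y₁ , y₁∈Y , p₁ = proj₂ Y x x∈A
                     in ∈-respˡ (≈-trans (uniq y₁ p₁) (≈-sym (uniq _ p))) y₁∈Y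

    minimal : ∀ {a z} → z ∈ a → ∃ λ y → y ∈ a × (∀ w → w ∈ a → ¬ (w ∈ y))
    minimal {a} {z} z∈a =
      let y , y∈a , h = interpret (∀ᶠ (∃ᶠ (x0 ∈ᶠ x1) ⇒ᶠ ∃∈ᶠ x0 (¬ᶠ ∃ᶠ ((x0 ∈ᶠ x2) ∧ᶠ (x0 ∈ᶠ x1))))) {[]}
                          (sound foundation) a (z , z∈a)
      in y , y∈a , λ w w∈a w∈y → h (w , w∈a , w∈y)

-- Pairs, products, successors and the operation F

module SetConstructions (𝓜 : Model ZFAxiom) where

  open Model 𝓜
  open SetTheory 𝓜

  private variable
    ρ   : Env n
    t u : ZTerm n
    a b c d x y z : M

  lookup-skip1 : (ρ : Env n) (i : Fin (suc n)) → lookup (x ∷ y ∷ ρ) (skip1 i) ≡ lookup (x ∷ ρ) i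
  lookup-skip1 ρ zero    = refl
  lookup-skip1 ρ (suc i) = refl

  -- A set with the right elements is the only one by extensionality, so it is the value of the
  -- description. All set-builder terms are read through this.
  Den-setOf : {φ : ZForm (suc n)} {P : M → Set} →
              (∀ x → Means φ (x ∷ ρ) (P x)) → (∀ x → x ∈ a ⟷ P x) → Den (setOf φ) ρ a
  Den-setOf {ρ = ρ} {φ = φ} {P} c spec = denotes λ y → ⟷-trans (iff (members y))
    ( (λ h → ext λ x → ⟷-trans (h x) (⟷-sym (spec x)))
    , (λ p x → ⟷-trans (∈-cong p x) (spec x)))
    where
    members : ∀ y → Means (∀̇ ((v0 ∈z v1) ⇔ renF skip1 φ)) (y ∷ ρ) (∀ x → x ∈ y ⟷ P x)
    members y = ∀-means λ x → ⇔-means (∈-means var-den var-den) (ren-means (lookup-skip1 ρ) (c x))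

  exactly : (P : Fm (suc n)) (ρ : Env n) (z : M) → (∀ x → sem P (x ∷ ρ) → x ∈ z) →
            ∃ λ y → ∀ x → x ∈ y ⟷ sem P (x ∷ ρ)
  exactly P ρ z bound = let y , h = separate P ρ z in
    y , λ x → (λ x∈y → proj₂ (proj₁ (h x) x∈y)) , (λ p → proj₂ (h x) (bound x p , p))

  abstract
    infinity-set : ∃ λ y → (∃ λ e → e ∈ y × ∀ x → ¬ (x ∈ e)) ×
                           (∀ x → x ∈ y → ∃ λ s → s ∈ y × ∀ z → z ∈ s ⟷ (z ∈ x ∨ z ≈ x))
    infinity-set = interpret
      (∃ᶠ (∃ᶠ ((x0 ∈ᶠ x1) ∧ᶠ ∀ᶠ (¬ᶠ (x0 ∈ᶠ x1)))
           ∧ᶠ ∀∈ᶠ x0 (∃∈ᶠ x1 (∀ᶠ ((x0 ∈ᶠ x1) ⇔ᶠ ((x0 ∈ᶠ x2) ∨ᶠ (x0 ≐ᶠ x2))))))) {[]} (sound infinity)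

    ∅ : M
    ∅ = proj₁ (proj₁ (proj₂ infinity-set))

    ∅-spec : ∀ x → ¬ (x ∈ ∅)
    ∅-spec = proj₂ (proj₂ (proj₁ (proj₂ infinity-set)))

    upair-exists : ∀ a b → ∃ λ y → ∀ x → x ∈ y ⟷ (x ≈ a ∨ x ≈ b)
    upair-exists a b =
      let y , a∈y , b∈y = interpret (∀ᶠ (∀ᶠ (∃ᶠ ((x2 ∈ᶠ x0) ∧ᶠ (x1 ∈ᶠ x0))))) {[]} (sound pairing) a b
      in exactly ((x0 ≐ᶠ x1) ∨ᶠ (x0 ≐ᶠ x2)) (a ∷ b ∷ []) y λ x p →
           cases stable-∈ p (λ x≈a → ∈-respˡ (≈-sym x≈a) a∈y) (λ x≈b → ∈-respˡ (≈-sym x≈b) b∈y)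

    upair : M → M → M
    upair a b = proj₁ (upair-exists a b)

    upair-spec : ∀ x → x ∈ upair a b ⟷ (x ≈ a ∨ x ≈ b)
    upair-spec {a} {b} = proj₂ (upair-exists a b)

    ⋃-exists : ∀ a → ∃ λ u → ∀ x → x ∈ u ⟷ (∃ λ y → y ∈ a × x ∈ y)
    ⋃-exists a =
      let u , h = interpret (∀ᶠ (∃ᶠ (∀ᶠ (∀ᶠ ((x0 ∈ᶠ x1) ∧ᶠ (x1 ∈ᶠ x3) ⇒ᶠ (x0 ∈ᶠ x2)))))) {[]} (sound union) a
      in exactly (∃∈ᶠ x1 (x1 ∈ᶠ x0)) (a ∷ []) u λ x (y , y∈a , x∈y) → h y x (x∈y , y∈a)

    ⋃ : M → M
    ⋃ a = proj₁ (⋃-exists a)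

    ⋃-spec : ∀ x → x ∈ ⋃ a ⟷ (∃ λ y → y ∈ a × x ∈ y)
    ⋃-spec {a} = proj₂ (⋃-exists a)

    pow-exists : ∀ a → ∃ λ p → ∀ x → x ∈ p ⟷ x ⊆ a
    pow-exists a =
      let p , h = interpret (∀ᶠ (∃ᶠ (∀ᶠ ((x0 ⊆ᶠ x2) ⇒ᶠ (x0 ∈ᶠ x1))))) {[]} (sound powerset) a
      in exactly (x0 ⊆ᶠ x1) (a ∷ []) p h

    pow : M → M
    pow a = proj₁ (pow-exists a)

    pow-spec : ∀ x → x ∈ pow a ⟷ x ⊆ a
    pow-spec {a} = proj₂ (pow-exists a)

    sing : M → M
    sing a = upair a a

    sing-spec : ∀ x → x ∈ sing a ⟷ x ≈ a
    sing-spec x = (λ h → cases stable-≈ (proj₁ (upair-spec x) h) id id) , (λ p → proj₂ (upair-spec x) (left p))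

    cup : M → M → M
    cup a b = ⋃ (upair a b)

    cup-spec : ∀ x → x ∈ cup a b ⟷ (x ∈ a ∨ x ∈ b)
    cup-spec {a} {b} x =
        (λ h → let y , y∈ , x∈y = proj₁ (⋃-spec x) h in
               cases stable-¬ (proj₁ (upair-spec y) y∈) (λ y≈a → left (∈-respʳ y≈a x∈y)) (λ y≈b → right (∈-respʳ y≈b x∈y)))
      , (λ h → cases stable-∈ h (λ x∈a → proj₂ (⋃-spec x) (a , proj₂ (upair-spec a) (left ≈-refl) , x∈a))
                                (λ x∈b → proj₂ (⋃-spec x) (b , proj₂ (upair-spec b) (right ≈-refl) , x∈b)))

    kp : M → M → M
    kp a b = upair (sing a) (upair a b)

    kp-spec : ∀ x → x ∈ kp a b ⟷ (x ≈ sing a ∨ x ≈ upair a b)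
    kp-spec = upair-spec

  self∈sing : a ∈ sing a
  self∈sing = proj₂ (sing-spec _) ≈-refl

  Den-upair : Den t ρ a → Den u ρ b → Den (upairZ t u) ρ (upair a b)
  Den-upair d e = Den-setOf (λ x → ∨-means (≐-means var-den (Den-↑ d)) (≐-means var-den (Den-↑ e))) upair-spec

  Den-sing : Den t ρ a → Den (singZ t) ρ (sing a)
  Den-sing d = Den-setOf (λ x → ≐-means var-den (Den-↑ d)) sing-spec

  Den-kp : Den t ρ a → Den u ρ b → Den (kpair t u) ρ (kp a b)
  Den-kp d e = Den-setOf (λ x → ∨-means (≐-means var-den (Den-↑ (Den-sing d)))
                                        (≐-means var-den (Den-↑ (Den-upair d e)))) kp-spec

  Den-cup : Den t ρ a → Den u ρ b → Den (cupZ t u) ρ (cup a b)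
  Den-cup d e = Den-setOf (λ x → ∨-means (∈-means var-den (Den-↑ d)) (∈-means var-den (Den-↑ e))) cup-spec

  Den-pow : Den t ρ a → Den (powZ t) ρ (pow a)
  Den-pow d = Den-setOf (λ x → ∀-means λ y → ⇒-means (∈-means var-den var-den)
                                                     (∈-means var-den (Den-↑ (Den-↑ d)))) pow-spec

  ∅-unique : (∀ x → ¬ (x ∈ a)) → a ≈ ∅
  ∅-unique h = ext λ x → (λ x∈ → absurd stable-∈ (h x x∈)) , (λ x∈ → absurd stable-∈ (∅-spec x x∈))

  Den-∅ : Den emptyZ ρ ∅
  Den-∅ {ρ = ρ} = denotes λ y → ⟷-trans (iff (empty y)) (∅-unique , λ p x x∈y → ∅-spec x (∈-respʳ p x∈y))
    where
    empty : ∀ y → Means (∀̇ (¬̇ (v0 ∈z v1))) (y ∷ ρ) (∀ x → ¬ (x ∈ y))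
    empty y = ∀-means λ x → ¬-means (∈-means var-den var-den)

  kpᵗ : Tm n → Tm n → Tm n
  kpᵗ t u = record { term = kpair (term t) (term u) ; val = λ ρ → kp (val t ρ) (val u ρ)
                    ; den = λ ρ → Den-kp (den t ρ) (den u ρ) }

  ∅ᵗ : Tm n
  ∅ᵗ = record { term = zeroZ ; val = λ ρ → ∅
               ; den = λ ρ → Den-∅ }

  one : M
  one = sing ∅

  oneᵗ : Tm n
  oneᵗ = record { term = oneZ ; val = λ ρ → one
                 ; den = λ ρ → Den-sing Den-∅ }

  sing-injective : sing a ≈ sing b → a ≈ b
  sing-injective p = proj₁ (sing-spec _) (∈-respʳ p self∈sing)

  kp-cong : a ≈ c → b ≈ d → kp a b ≈ kp c d
  kp-cong {c = c} {b} {d} p q = ≈-trans (val-cong (kpᵗ x0 x1) {b ∷ []} p) (val-cong (kpᵗ x1 x0) {c ∷ []} q)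

  kp-injectiveˡ : kp a b ≈ kp c d → a ≈ c
  kp-injectiveˡ p = cases stable-≈ (proj₁ (kp-spec _) (∈-respʳ p (proj₂ (kp-spec _) (left ≈-refl))))
    (λ q → sing-injective q)
    (λ q → ≈-sym (proj₁ (sing-spec _) (∈-respʳ (≈-sym q) (proj₂ (upair-spec _) (left ≈-refl)))))

  kp-second : kp a b ≈ kp c d → d ≈ a ∨ d ≈ b
  kp-second p = cases stable-¬ (proj₁ (kp-spec _) (∈-respʳ (≈-sym p) (proj₂ (kp-spec _) (right ≈-refl))))
    (λ q → left (proj₁ (sing-spec _) (∈-respʳ q (proj₂ (upair-spec _) (right ≈-refl)))))
    (λ q → proj₁ (upair-spec _) (∈-respʳ q (proj₂ (upair-spec _) (right ≈-refl))))

  -- Only `d ≈ a` needs an argument. By symmetry `b` is `c` or `d`, and in the first case b = c = a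
  -- = d.
  kp-injectiveʳ : kp a b ≈ kp c d → b ≈ d
  kp-injectiveʳ p = cases stable-≈ (kp-second p)
    (λ d≈a → cases stable-≈ (kp-second (≈-sym p))
      (λ b≈c → ≈-trans b≈c (≈-trans (≈-sym (kp-injectiveˡ p)) (≈-sym d≈a))) id)
    ≈-sym

  ∅≉one : ¬ (∅ ≈ one)
  ∅≉one p = ∅-spec _ (∈-respʳ (≈-sym p) self∈sing)

  prod-exists : ∀ a b → ∃ λ p → ∀ x → x ∈ p ⟷ (∃ λ u → u ∈ a × ∃ λ v → v ∈ b × x ≈ kp u v)
  -- A Kuratowski pair over a ∪ b is a set of subsets of a ∪ b, so the double power set bounds the
  -- product.
  prod-exists a b = exactly (∃∈ᶠ x1 (∃∈ᶠ x3 (x2 ≐ᶠ kpᵗ x1 x0))) (a ∷ b ∷ []) (pow (pow (cup a b)))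
    λ x (u , u∈a , v , v∈b , x≈) → ∈-respˡ (≈-sym x≈) (proj₂ (pow-spec _) λ y y∈ →
      let u∈ = proj₂ (cup-spec u) (left u∈a)
          v∈ = proj₂ (cup-spec v) (right v∈b)
      in proj₂ (pow-spec y) λ z z∈y → cases stable-∈ (proj₁ (kp-spec y) y∈)
           (λ y≈ → ∈-respˡ (≈-sym (proj₁ (sing-spec z) (∈-respʳ y≈ z∈y))) u∈)
           (λ y≈ → cases stable-∈ (proj₁ (upair-spec z) (∈-respʳ y≈ z∈y))
                     (λ z≈u → ∈-respˡ (≈-sym z≈u) u∈) (λ z≈v → ∈-respˡ (≈-sym z≈v) v∈)))

  abstract
    prod : M → M → M
    prod a b = proj₁ (prod-exists a b)

    prod-spec : ∀ x → x ∈ prod a b ⟷ (∃ λ u → u ∈ a × ∃ λ v → v ∈ b × x ≈ kp u v)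
    prod-spec {a} {b} = proj₂ (prod-exists a b)

  Den-prod : Den t ρ a → Den u ρ b → Den (prodZ t u) ρ (prod a b)
  Den-prod d e = Den-setOf (λ x → ∃∈-means (Den-↑ d) λ y → ∃∈-means (Den-↑ (Den-↑ e)) λ z →
                                    ≐-means var-den (Den-kp var-den var-den)) prod-spec

  succ : M → M
  succ a = cup a (sing a)

  succ-spec : ∀ x → x ∈ succ a ⟷ (x ∈ a ∨ x ≈ a)
  succ-spec x = ⟷-trans (cup-spec x)
    ( (λ h → cases stable-¬ h left (λ x∈ → right (proj₁ (sing-spec x) x∈)))
    , (λ h → cases stable-¬ h left (λ x≈ → right (proj₂ (sing-spec x) x≈))))

  Den-succ : Den t ρ a → Den (succZ t) ρ (succ a)
  Den-succ d = Den-setOf (λ x → ∨-means (∈-means var-den (Den-↑ d)) (≐-means var-den (Den-↑ d))) succ-spec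

  succᵗ : Tm n → Tm n
  succᵗ t = record { term = succZ (term t) ; val = λ ρ → succ (val t ρ)
                    ; den = λ ρ → Den-succ (den t ρ) }

  self∈succ : a ∈ succ a
  self∈succ = proj₂ (succ-spec _) (right ≈-refl)

  step : M → M
  step Y = cup (prod (sing ∅) (pow Y)) (prod (sing one) (prod Y Y))

  Den-step : Den t ρ a → Den (stepZ t) ρ (step a)
  Den-step {t = t} {ρ = ρ} {a = a} d = Den-cup {t = setsZ} {u = pairsZ} sets pairs
    where
    setsZ  = prodZ (singZ zeroZ) (powZ t)
    pairsZ = prodZ (singZ oneZ) (prodZ t t)
    sets : Den setsZ ρ (prod (sing ∅) (pow a))
    sets = Den-prod {t = singZ zeroZ} {u = powZ t} (Den-sing {t = zeroZ} Den-∅) (Den-pow d)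
    squares : Den (prodZ t t) ρ (prod a a)
    squares = Den-prod d d
    pairs : Den pairsZ ρ (prod (sing one) (prod a a))
    pairs = Den-prod {t = singZ oneZ} {u = prodZ t t} (Den-sing {t = oneZ} (den oneᵗ ρ)) squares

  step-set : y ⊆ a → kp ∅ y ∈ step a
  step-set y⊆a = proj₂ (cup-spec _) (left (proj₂ (prod-spec _)
    (∅ , self∈sing , _ , proj₂ (pow-spec _) y⊆a , ≈-refl)))

  step-pair : x ∈ a → y ∈ a → kp one (kp x y) ∈ step a
  step-pair x∈a y∈a = proj₂ (cup-spec _) (right (proj₂ (prod-spec _)
    (one , self∈sing , _ , proj₂ (prod-spec _) (_ , x∈a , _ , y∈a , ≈-refl) , ≈-refl)))

  step-inversion : x ∈ step a → (∃ λ y → x ≈ kp ∅ y × y ⊆ a) ∨ (∃ λ u → ∃ λ v → x ≈ kp one (kp u v) × u ∈ a × v ∈ a)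
  step-inversion {x} x∈ = cases stable-¬ (proj₁ (cup-spec _) x∈)
    (λ h → let z , z∈ , y , y∈ , x≈ = proj₁ (prod-spec x) h in
           left (y , ≈-trans x≈ (kp-cong (proj₁ (sing-spec z) z∈) ≈-refl) , proj₁ (pow-spec y) y∈))
    (λ h → let z , z∈ , w , w∈ , x≈ = proj₁ (prod-spec x) h
               u , u∈ , v , v∈ , w≈ = proj₁ (prod-spec w) w∈ in
           right (u , v , ≈-trans x≈ (kp-cong (proj₁ (sing-spec z) z∈) w≈) , u∈ , v∈))

  stepᵗ : Tm n → Tm n
  stepᵗ t = record { term = stepZ (term t) ; val = λ ρ → step (val t ρ)
                    ; den = λ ρ → Den-step (den t ρ) }

  step-mono : a ⊆ b → step a ⊆ step b
  step-mono a⊆b x x∈ = cases stable-∈ (step-inversion x∈)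
    (λ (y , x≈ , y⊆a) → ∈-respˡ (≈-sym x≈) (step-set λ z z∈y → a⊆b z (y⊆a z z∈y)))
    (λ (u , v , x≈ , u∈ , v∈) → ∈-respˡ (≈-sym x≈) (step-pair (a⊆b u u∈) (a⊆b v v∈)))

-- Ordinals: induction, comparability and limits

module Ordinals (𝓜 : Model ZFAxiom) where

  open Model 𝓜
  open SetTheory 𝓜
  open SetConstructions 𝓜

  private variable
    α β γ a : M

  Transitive : M → Set
  Transitive a = ∀ y → y ∈ a → y ⊆ a

  Ord : M → Set
  Ord α = Transitive α × (∀ y → y ∈ α → Transitive y)

  transᶠ : Tm n → Fm n
  transᶠ t = ∀∈ᶠ t (x0 ⊆ᶠ ↑ᵗ t)

  ordᶠ : Tm n → Fm n
  ordᶠ t = transᶠ t ∧ᶠ ∀∈ᶠ t (transᶠ x0)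

  ord-∈ : Ord α → β ∈ α → Ord β
  ord-∈ (trans-α , trans-∈α) β∈α = trans-∈α _ β∈α , λ y y∈β → trans-∈α y (trans-α _ β∈α y y∈β)

  ∉-self : ¬ (a ∈ a)
  ∉-self {a} a∈a with minimal self∈sing
  ... | y , y∈ , min = min a self∈sing (∈-respʳ (≈-sym (proj₁ (sing-spec y) y∈)) a∈a)

  ord-succ : Ord α → Ord (succ α)
  ord-succ {α} (trans-α , trans-∈α) =
      (λ y y∈ x x∈y → cases stable-∈ (proj₁ (succ-spec y) y∈)
        (λ y∈α → proj₂ (succ-spec x) (left (trans-α y y∈α x x∈y)))
        (λ y≈α → proj₂ (succ-spec x) (left (∈-respʳ y≈α x∈y))))
    , (λ y y∈ → cases (stableᶠ (transᶠ x0) {y ∷ []}) (proj₁ (succ-spec y) y∈) (trans-∈α y)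
        (λ y≈α → leibnizᶠ (transᶠ x0) {[]} (≈-sym y≈α) trans-α))

  ord-⋃ : (∀ α → α ∈ a → Ord α) → Ord (⋃ a)
  ord-⋃ ords =
      (λ y y∈ x x∈y → let α , α∈ , y∈α = proj₁ (⋃-spec y) y∈ in
        proj₂ (⋃-spec x) (α , α∈ , proj₁ (ords α α∈) y y∈α x x∈y))
    , (λ y y∈ → let α , α∈ , y∈α = proj₁ (⋃-spec y) y∈ in proj₂ (ords α α∈) y y∈α)

  -- Foundation gives a minimal counterexample below `α`. Counterexamples must form a set for this,
  -- which is why `P` is a formula with a meaning and not an arbitrary predicate.
  ord-induction : (P : Fm (suc n)) (ρ : Env n) →
                  (∀ α → Ord α → (∀ β → β ∈ α → sem P (β ∷ ρ)) → sem P (α ∷ ρ)) →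
                  ∀ α → Ord α → sem P (α ∷ ρ)
  ord-induction P ρ step α ord-α = step α ord-α λ β β∈α → stableᶠ P λ ¬Pβ →
    let z , z-spec = separate (¬ᶠ P) ρ α
        μ , μ∈z , μ-min = minimal (proj₂ (z-spec β) (β∈α , ¬Pβ))
        μ∈α , ¬Pμ = proj₁ (z-spec μ) μ∈z
    in ¬Pμ (step μ (ord-∈ ord-α μ∈α) λ γ γ∈μ → stableᶠ P λ ¬Pγ →
         μ-min γ (proj₂ (z-spec γ) (proj₁ ord-α μ μ∈α γ γ∈μ , ¬Pγ)) γ∈μ)

  -- If there were no least ordinal satisfying `P`, its negation would be inductive.
  least : (P : Fm (suc n)) (ρ : Env n) → Ord α → sem P (α ∷ ρ) →
          ∃ λ β → (Ord β × sem P (β ∷ ρ)) × (∀ γ → γ ∈ β → ¬ sem P (γ ∷ ρ))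
  least {α = α} P ρ ord-α Pα = stableᶠ (∃ᶠ ((ordᶠ x0 ∧ᶠ P) ∧ᶠ ∀∈ᶠ x0 (¬ᶠ skip1ᶠ P))) {ρ} λ none →
    ord-induction (¬ᶠ P) ρ (λ β ord-β below Pβ → none (β , (ord-β , Pβ) , below)) α ord-α Pα

  Comparable : M → M → Set
  Comparable α β = α ∈ β ∨ (α ≈ β ∨ β ∈ α)

  -- Nested induction. If neither ordinal is an element of the other, the induction hypotheses place
  -- every element of each in the other, so extensionality makes them equal.
  trichotomy : ∀ α → Ord α → ∀ β → Ord β → Comparable α β
  trichotomy = ord-induction (∀ᶠ (ordᶠ x0 ⇒ᶠ ((x1 ∈ᶠ x0) ∨ᶠ ((x1 ≐ᶠ x0) ∨ᶠ (x0 ∈ᶠ x1))))) []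
    λ α ord-α IHα → ord-induction ((x1 ∈ᶠ x0) ∨ᶠ ((x1 ≐ᶠ x0) ∨ᶠ (x0 ∈ᶠ x1))) (α ∷ [])
    λ β ord-β IHβ none → none (inj₂ (λ none′ → none′ (inj₁ (ext λ x →
        (λ x∈α → cases stable-∈ (IHα x x∈α β ord-β) id λ h → absurd stable-∈ (h λ
            { (inj₁ x≈β) → none (inj₂ (right (∈-respˡ x≈β x∈α)))
            ; (inj₂ β∈x) → none (inj₂ (right (proj₁ ord-α x x∈α β β∈x))) }))
      , (λ x∈β → stable-∈ λ x∉α → IHβ x x∈β λ
            { (inj₁ α∈x) → none (inj₁ (proj₁ ord-β x x∈β α α∈x))
            ; (inj₂ h)   → h λ { (inj₁ α≈x) → none (inj₁ (∈-respˡ (≈-sym α≈x) x∈β))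
                                ; (inj₂ x∈α) → x∉α x∈α } })))))

  Limit : M → Set
  Limit β = ¬ (β ≈ ∅) × ¬ (∃ λ γ → γ ∈ β × β ≈ succ γ)

  limit-succ : Ord β → Limit β → γ ∈ β → succ γ ∈ β
  limit-succ {β} {γ} ord-β (_ , not-succ) γ∈β =
    cases stable-∈ (trichotomy (succ γ) (ord-succ (ord-∈ ord-β γ∈β)) β ord-β) id λ h →
    cases stable-∈ h (λ succ≈β → absurd stable-∈ (not-succ (γ , γ∈β , ≈-sym succ≈β)))
      λ β∈succ → absurd stable-∈ (cases (λ k → k id) (proj₁ (succ-spec β) β∈succ)
        (λ β∈γ → ∉-self (proj₁ ord-β γ γ∈β β β∈γ))
        (λ β≈γ → ∉-self (∈-respʳ β≈γ γ∈β)))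

-- Existence and uniqueness of the levels of W

module Hierarchy (𝓜 : Model ZFAxiom) where

  open Model 𝓜
  open SetTheory 𝓜
  open SetConstructions 𝓜
  open Ordinals 𝓜

  private variable
    α β γ δ f g v w x y z : M

  App : M → M → M → Set
  App f x y = kp x y ∈ f

  Function : M → Set
  Function f = (∀ p → p ∈ f → ∃ λ x → ∃ λ y → p ≈ kp x y) × (∀ x y z → App f x y × App f x z → y ≈ z)

  Domain : M → M → Set
  Domain f d = ∀ x → x ∈ d ⟷ ∃ (App f x)

  -- x ∈ ⋃_{γ ∈ β} F(f(γ)).  Demanding f(β) = ⋃_{γ ∈ β} F(f(γ)) replaces the three recursion clauses for W.
  Accumulated : M → M → M → Set
  Accumulated f β x = ∃ λ γ → γ ∈ β × ∃ λ w → App f γ w × x ∈ step w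

  Approximation : M → M → Set
  Approximation α f = Function f × Domain f (succ α) ×
                      (∀ β → β ∈ succ α → ∀ y → App f β y → ∀ x → x ∈ y ⟷ Accumulated f β x)

  -- w = W_α
  Level : M → M → Set
  Level α w = ∃ λ f → Approximation α f × App f α w

  functionᶠ : Tm n → Fm n
  functionᶠ f = ∀∈ᶠ f (∃ᶠ (∃ᶠ (x2 ≐ᶠ kpᵗ x1 x0)))
              ∧ᶠ ∀ᶠ (∀ᶠ (∀ᶠ ((kpᵗ x2 x1 ∈ᶠ ↑ᵗ (↑ᵗ (↑ᵗ f))) ∧ᶠ (kpᵗ x2 x0 ∈ᶠ ↑ᵗ (↑ᵗ (↑ᵗ f))) ⇒ᶠ (x1 ≐ᶠ x0))))

  domainᶠ : Tm n → Tm n → Fm n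
  domainᶠ f d = ∀ᶠ ((x0 ∈ᶠ ↑ᵗ d) ⇔ᶠ ∃ᶠ (kpᵗ x1 x0 ∈ᶠ ↑ᵗ (↑ᵗ f)))

  accumulatedᶠ : Tm n → Tm n → Tm n → Fm n
  accumulatedᶠ f β x =
    ∃∈ᶠ β (∃ᶠ ((kpᵗ x1 x0 ∈ᶠ ↑ᵗ (↑ᵗ f)) ∧ᶠ (↑ᵗ (↑ᵗ x) ∈ᶠ stepᵗ x0)))

  approximationᶠ : Tm n → Tm n → Fm n
  approximationᶠ α f = functionᶠ f ∧ᶠ domainᶠ f (succᵗ α) ∧ᶠ ∀∈ᶠ (succᵗ α)
    (∀ᶠ ((kpᵗ x1 x0 ∈ᶠ ↑ᵗ (↑ᵗ f)) ⇒ᶠ ∀ᶠ ((x0 ∈ᶠ x1) ⇔ᶠ accumulatedᶠ (↑ᵗ (↑ᵗ (↑ᵗ f))) x2 x0)))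

  levelᶠ : Tm n → Tm n → Fm n
  levelᶠ α w = ∃ᶠ (approximationᶠ (↑ᵗ α) x0 ∧ᶠ (kpᵗ (↑ᵗ α) (↑ᵗ w) ∈ᶠ x0))

  Level-resp : α ≈ β → v ≈ w → Level α v → Level β w
  Level-resp {β = β} {v = v} p q h =
    leibnizᶠ (levelᶠ x1 x0) {β ∷ []} q (leibnizᶠ (levelᶠ x0 x1) {v ∷ []} p h)

  App-respˡ : x ≈ y → App f x z → App f y z
  App-respˡ p = ∈-respˡ (kp-cong p ≈-refl)

  step-cong : v ≈ w → x ∈ step v → x ∈ step w
  step-cong p = ∈-respʳ (val-cong (stepᵗ x0) {[]} p)

  ∈succ : x ∈ α → x ∈ succ α
  ∈succ x∈α = proj₂ (succ-spec _) (left x∈α)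

  ∈succ-trans : Ord α → β ∈ succ α → γ ∈ β → γ ∈ succ α
  ∈succ-trans ord-α β∈ γ∈β = proj₁ (ord-succ ord-α) _ β∈ _ γ∈β

  -- Induction over the common part of two possibly different domains: equal values below `β` give
  -- equal unions at `β`.
  approximations-agree :
    ∀ α f δ g → Ord α → Ord δ → Approximation α f → Approximation δ g → ∀ β → Ord β →
    β ∈ succ α → β ∈ succ δ → ∀ y → App f β y → ∀ z → App g β z → y ≈ z
  approximations-agree α f δ g ord-α ord-δ (_ , dom-f , union-f) (_ , dom-g , union-g) =
    ord-induction ((x0 ∈ᶠ succᵗ x1) ⇒ᶠ (x0 ∈ᶠ succᵗ x3) ⇒ᶠ
                   -- Behind z, y, β, α, f and δ, index 6 is `g`.
                   ∀ᶠ ((kpᵗ x1 x0 ∈ᶠ x3) ⇒ᶠ ∀ᶠ ((kpᵗ x2 x0 ∈ᶠ varᵗ (suc (suc (suc (suc (suc (suc zero))))))) ⇒ᶠ (x1 ≐ᶠ x0))))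
                  (α ∷ f ∷ δ ∷ g ∷ [])
      λ β ord-β IH β∈α β∈δ y fy z gz → ext λ x →
        (λ x∈y → let γ , γ∈β , w , fw , x∈ = proj₁ (union-f β β∈α y fy x) x∈y
                     γ∈α = ∈succ-trans ord-α β∈α γ∈β
                     γ∈δ = ∈succ-trans ord-δ β∈δ γ∈β
                     w′ , gw′ = proj₁ (dom-g γ) γ∈δ
                 in proj₂ (union-g β β∈δ z gz x)
                      (γ , γ∈β , w′ , gw′ , step-cong (IH γ γ∈β γ∈α γ∈δ w fw w′ gw′) x∈))
      , (λ x∈z → let γ , γ∈β , w , gw , x∈ = proj₁ (union-g β β∈δ z gz x) x∈z
                     γ∈α = ∈succ-trans ord-α β∈α γ∈β
                     γ∈δ = ∈succ-trans ord-δ β∈δ γ∈β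
                     w′ , fw′ = proj₁ (dom-f γ) γ∈α
                 in proj₂ (union-f β β∈α y fy x)
                      (γ , γ∈β , w′ , fw′ , step-cong (≈-sym (IH γ γ∈β γ∈α γ∈δ w′ fw′ w gw)) x∈))

  Level-unique : Ord α → Level α v → Level α w → v ≈ w
  Level-unique {α} ord-α (f , f-approx , fv) (g , g-approx , gw) =
    approximations-agree α f α g ord-α ord-α f-approx g-approx α ord-α self∈succ self∈succ _ fv _ gw

  LevelBelow : M → M → Set
  LevelBelow α x = ∃ λ γ → γ ∈ α × ∃ λ w → Level γ w × x ∈ step w

  approximation⟷Level : Ord α → Approximation α f → γ ∈ α → Level γ v → ∀ w → App f γ w ⟷ Level γ w
  approximation⟷Level {α} {f} {γ} ord-α f-approx@(_ , dom-f , _) γ∈α Lγv@(g , g-approx , gv) w =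
      (λ fw → Level-resp ≈-refl (≈-sym (agree w fw)) Lγv)
    , (λ Lγw → let w′ , fw′ = proj₁ (dom-f γ) (∈succ γ∈α) in
               ∈-respˡ (kp-cong ≈-refl (≈-trans (agree w′ fw′) (Level-unique (ord-∈ ord-α γ∈α) Lγv Lγw))) fw′)
    where
    agree : ∀ w → App f γ w → w ≈ _
    agree w fw = approximations-agree α f γ g ord-α (ord-∈ ord-α γ∈α) f-approx g-approx γ (ord-∈ ord-α γ∈α)
                   (∈succ γ∈α) self∈succ w fw _ gv

  -- Totality below `α` is a hypothesis because this equation is used inside the induction that
  -- establishes totality.
  Level-spec′ : Ord α → (∀ γ → γ ∈ α → ∃ (Level γ)) → Level α w → ∀ x → x ∈ w ⟷ LevelBelow α x
  Level-spec′ {α} {w} ord-α total (f , f-approx , fw) x = forth , back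
    where
    union-f : x ∈ w ⟷ Accumulated f α x
    union-f = proj₂ (proj₂ f-approx) α self∈succ w fw x
    translate : ∀ γ → γ ∈ α → ∀ w → App f γ w ⟷ Level γ w
    translate γ γ∈α = approximation⟷Level ord-α f-approx γ∈α (proj₂ (total γ γ∈α))
    forth : x ∈ w → LevelBelow α x
    forth x∈w = let γ , γ∈α , v , fv , x∈ = proj₁ union-f x∈w in γ , γ∈α , v , proj₁ (translate γ γ∈α v) fv , x∈
    back : LevelBelow α x → x ∈ w
    back (γ , γ∈α , v , Lv , x∈) = proj₂ union-f (γ , γ∈α , v , proj₂ (translate γ γ∈α v) Lv , x∈)

  -- The inductive step of the recursion theorem. By uniqueness, replacement collects the levels
  -- below `α` into a function, which is extended by one pair at `α`.
  module NextApproximation {α : M} (ord-α : Ord α) (total : ∀ γ → γ ∈ α → ∃ (Level γ)) where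

    Level-functional : γ ∈ α → Level γ v → Level γ w → v ≈ w
    Level-functional γ∈α = Level-unique (ord-∈ ord-α γ∈α)

    abstract
      graph : ∃ λ G → ∀ p → p ∈ G ⟷ ∃ λ γ → γ ∈ α × ∃ λ w → p ≈ kp γ w × Level γ w
      graph = replace (∃ᶠ ((x1 ≐ᶠ kpᵗ x2 x0) ∧ᶠ levelᶠ x2 x0)) [] α λ γ γ∈α →
        let w , Lw = total γ γ∈α in
        kp γ w , (w , ≈-refl , Lw) , λ p (v , p≈ , Lv) → ≈-trans p≈ (kp-cong ≈-refl (Level-functional γ∈α Lv Lw))

      steps : ∃ λ S → ∀ s → s ∈ S ⟷ ∃ λ γ → γ ∈ α × ∃ λ w → s ≈ step w × Level γ w
      steps = replace (∃ᶠ ((x1 ≐ᶠ stepᵗ x0) ∧ᶠ levelᶠ x2 x0)) [] α λ γ γ∈α →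
        let w , Lw = total γ γ∈α in
        step w , (w , ≈-refl , Lw) ,
        λ p (v , p≈ , Lv) → ≈-trans p≈ (val-cong (stepᵗ x0) {[]} (Level-functional γ∈α Lv Lw))

    top : M
    top = ⋃ (proj₁ steps)

    top-spec : ∀ x → x ∈ top ⟷ LevelBelow α x
    top-spec x = forth , back
      where
      forth : x ∈ top → LevelBelow α x
      forth x∈ = let s , s∈ , x∈s = proj₁ (⋃-spec x) x∈
                     γ , γ∈α , w , s≈ , Lw = proj₁ (proj₂ steps s) s∈
                 in γ , γ∈α , w , Lw , ∈-respʳ s≈ x∈s
      back : LevelBelow α x → x ∈ top
      back (γ , γ∈α , w , Lw , x∈) =
        proj₂ (⋃-spec x) (step w , proj₂ (proj₂ steps (step w)) (γ , γ∈α , w , ≈-refl , Lw) , x∈)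

    next : M
    next = cup (proj₁ graph) (sing (kp α top))

    app-next : ∀ γ w → App next γ w ⟷ (γ ∈ α × Level γ w) ∨ (γ ≈ α × w ≈ top)
    app-next γ w = forth , back
      where
      forth : App next γ w → (γ ∈ α × Level γ w) ∨ (γ ≈ α × w ≈ top)
      forth p∈ = cases stable-¬ (proj₁ (cup-spec _) p∈)
        (λ p∈G → let δ , δ∈α , v , p≈ , Lv = proj₁ (proj₂ graph _) p∈G in
                 left (∈-respˡ (≈-sym (kp-injectiveˡ p≈)) δ∈α ,
                       Level-resp (≈-sym (kp-injectiveˡ p≈)) (≈-sym (kp-injectiveʳ p≈)) Lv))
        (λ p∈S → let p≈ = proj₁ (sing-spec _) p∈S in right (kp-injectiveˡ p≈ , kp-injectiveʳ p≈))
      back : (γ ∈ α × Level γ w) ∨ (γ ≈ α × w ≈ top) → App next γ w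
      back h = cases stable-∈ h
        (λ (γ∈α , Lw) → proj₂ (cup-spec _) (left (proj₂ (proj₂ graph _) (γ , γ∈α , w , ≈-refl , Lw))))
        (λ (γ≈α , w≈) → proj₂ (cup-spec _) (right (proj₂ (sing-spec _) (kp-cong γ≈α w≈))))

    app-next-below : γ ∈ α → ∀ w → App next γ w ⟷ Level γ w
    app-next-below {γ} γ∈α w =
        (λ p → cases (stableᶠ (levelᶠ x0 x1) {γ ∷ w ∷ []}) (proj₁ (app-next γ w) p) proj₂
                 λ (γ≈α , _) → absurd (stableᶠ (levelᶠ x0 x1) {γ ∷ w ∷ []}) (∉-self (∈-respʳ (≈-sym γ≈α) γ∈α)))
      , (λ Lw → proj₂ (app-next γ w) (left (γ∈α , Lw)))

    app-next-top : γ ≈ α → ∀ w → App next γ w ⟷ w ≈ top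
    app-next-top {γ} γ≈α w =
        (λ p → cases stable-≈ (proj₁ (app-next γ w) p)
                 (λ (γ∈α , _) → absurd stable-≈ (∉-self (∈-respʳ (≈-sym γ≈α) γ∈α))) proj₂)
      , (λ w≈ → proj₂ (app-next γ w) (right (γ≈α , w≈)))

    function-next : Function next
    function-next = pairs , functional
      where
      pairs : ∀ p → p ∈ next → ∃ λ x → ∃ λ y → p ≈ kp x y
      pairs p p∈ = cases (stableᶠ (∃ᶠ (∃ᶠ (x2 ≐ᶠ kpᵗ x1 x0))) {p ∷ []}) (proj₁ (cup-spec p) p∈)
        (λ p∈G → let γ , _ , w , p≈ , _ = proj₁ (proj₂ graph p) p∈G in γ , w , p≈)
        (λ p∈S → α , top , proj₁ (sing-spec p) p∈S)
      functional : ∀ x y z → App next x y × App next x z → y ≈ z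
      functional x y z (p , q) = cases stable-≈ (proj₁ (app-next x y) p)
        (λ (x∈α , Ly) → Level-functional x∈α Ly (proj₁ (app-next-below x∈α z) q))
        (λ (x≈α , y≈) → ≈-trans y≈ (≈-sym (proj₁ (app-next-top x≈α z) q)))

    domain-next : Domain next (succ α)
    domain-next x = forth , back
      where
      forth : x ∈ succ α → ∃ (App next x)
      forth x∈ = cases (stableᶠ (∃ᶠ (kpᵗ x1 x0 ∈ᶠ x2)) {x ∷ next ∷ []}) (proj₁ (succ-spec x) x∈)
        (λ x∈α → let w , Lw = total x x∈α in w , proj₂ (app-next-below x∈α w) Lw)
        (λ x≈α → top , proj₂ (app-next-top x≈α top) ≈-refl)
      back : ∃ (App next x) → x ∈ succ α
      back (y , p) = cases stable-∈ (proj₁ (app-next x y) p)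
        (λ (x∈α , _) → ∈succ x∈α) (λ (x≈α , _) → proj₂ (succ-spec x) (right x≈α))

    -- Accumulation at `β` consults only arguments below `β`, hence below `α`; the added pair never
    -- enters.
    accumulated-next : β ∈ succ α → ∀ x → Accumulated next β x ⟷ LevelBelow β x
    accumulated-next β∈ x =
        (λ (γ , γ∈β , w , p , x∈) → γ , γ∈β , w , proj₁ (app-next-below (γ∈α γ∈β) w) p , x∈)
      , (λ (γ , γ∈β , w , Lw , x∈) → γ , γ∈β , w , proj₂ (app-next-below (γ∈α γ∈β) w) Lw , x∈)
      where
      γ∈α : γ ∈ _ → γ ∈ α
      γ∈α γ∈β = cases stable-∈ (proj₁ (succ-spec _) β∈) (λ β∈α → proj₁ ord-α _ β∈α _ γ∈β) (λ β≈α → ∈-respʳ β≈α γ∈β)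

    union-next : ∀ β → β ∈ succ α → ∀ y → App next β y → ∀ x → x ∈ y ⟷ Accumulated next β x
    union-next β β∈ y p x = forth , back
      where
      stable-goal : Stable (x ∈ y ⟷ LevelBelow β x)
      stable-goal = stableᶠ ((x0 ∈ᶠ x1) ⇔ᶠ ∃∈ᶠ x2 (∃ᶠ (levelᶠ x1 x0 ∧ᶠ (x2 ∈ᶠ stepᵗ x0)))) {x ∷ y ∷ β ∷ []}
      members : x ∈ y ⟷ LevelBelow β x
      members = cases stable-goal (proj₁ (app-next β y) p)
        (λ (β∈α , Ly) → Level-spec′ (ord-∈ ord-α β∈α) (λ γ γ∈β → total γ (proj₁ ord-α β β∈α γ γ∈β)) Ly x)
        (λ (β≈α , y≈) →
            (λ x∈y → let γ , γ∈α , h = proj₁ (top-spec x) (∈-respʳ y≈ x∈y) in γ , ∈-respʳ (≈-sym β≈α) γ∈α , h)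
          , (λ (γ , γ∈β , h) → ∈-respʳ (≈-sym y≈) (proj₂ (top-spec x) (γ , ∈-respʳ β≈α γ∈β , h))))
      forth : x ∈ y → Accumulated next β x
      forth x∈y = proj₂ (accumulated-next β∈ x) (proj₁ members x∈y)
      back : Accumulated next β x → x ∈ y
      back h = proj₂ members (proj₁ (accumulated-next β∈ x) h)

    level : ∃ (Level α)
    level = top , next , (function-next , domain-next , union-next) , proj₂ (app-next-top ≈-refl top) ≈-refl

  Level-total : ∀ α → Ord α → ∃ (Level α)
  Level-total = ord-induction (∃ᶠ (levelᶠ x1 x0)) [] λ α ord-α total → NextApproximation.level ord-α total

  Level-spec : Ord α → Level α w → ∀ x → x ∈ w ⟷ LevelBelow α x
  Level-spec ord-α = Level-spec′ ord-α (λ γ γ∈α → Level-total γ (ord-∈ ord-α γ∈α))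

-- Agreement with the recursion clauses in `HZ`

module Universe (𝓜 : Model ZFAxiom) where

  open Model 𝓜
  open SetTheory 𝓜
  open SetConstructions 𝓜
  open Ordinals 𝓜
  open Hierarchy 𝓜

  private variable
    β γ a b f w x y : M
    ρ   : Env n
    t u : ZTerm n

  H : M → Set
  H x = ∃ λ α → Ord α × ∃ λ w → Level α w × x ∈ w

  RecursionClauses : M → M → M → Set
  RecursionClauses f β y =
      (β ≈ ∅ → y ≈ ∅)
    × (∀ γ → γ ∈ β → β ≈ succ γ → ∀ w → App f γ w → y ≈ step w)
    × (Limit β → ∀ x → x ∈ y ⟷ ∃ λ γ → γ ∈ β × ∃ λ w → App f γ w × x ∈ w)

  module Recursion {α f : M} (ord-α : Ord α) (fun : Function f) (dom : Domain f (succ α)) where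

    UnionAt : M → Set
    UnionAt β = ∀ y → App f β y → ∀ x → x ∈ y ⟷ Accumulated f β x

    module _ {β : M} (β∈ : β ∈ succ α) (below : ∀ γ → γ ∈ β → UnionAt γ) where

      ord-β : Ord β
      ord-β = ord-∈ (ord-succ ord-α) β∈

      -- The values below `β` increase, because those unions run over more indices. As F is
      -- monotone, the term at the predecessor `γ` absorbs all the others.
      accumulated-succ : γ ∈ β → β ≈ succ γ → App f γ w → ∀ x → Accumulated f β x ⟷ x ∈ step w
      accumulated-succ {γ} {w} γ∈β β≈ fw x = forth , λ x∈ → γ , γ∈β , w , fw , x∈
        where
        included : ∀ δ → δ ∈ β → ∀ v → App f δ v → δ ∈ γ → v ⊆ w
        included δ δ∈β v fv δ∈γ z z∈v =
          let ε , ε∈δ , h = proj₁ (below δ δ∈β v fv z) z∈v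
          in proj₂ (below γ γ∈β w fw z) (ε , proj₁ (ord-∈ ord-β γ∈β) δ δ∈γ ε ε∈δ , h)
        forth : Accumulated f β x → x ∈ step w
        forth (δ , δ∈β , v , fv , x∈) = cases stable-∈ (proj₁ (succ-spec δ) (∈-respʳ β≈ δ∈β))
          (λ δ∈γ → step-mono (included δ δ∈β v fv δ∈γ) x x∈)
          (λ δ≈γ → step-cong (proj₂ fun γ v w (App-respˡ δ≈γ fv , fw)) x∈)

      -- An element of F(f(δ)) lies in f(δ+1), and δ+1 is still below a limit. Conversely each f(γ)
      -- is itself a union of such terms.
      accumulated-limit : Limit β → ∀ x → Accumulated f β x ⟷ ∃ λ γ → γ ∈ β × ∃ λ w → App f γ w × x ∈ w
      accumulated-limit limit x = forth , back
        where
        forth : Accumulated f β x → ∃ λ γ → γ ∈ β × ∃ λ w → App f γ w × x ∈ w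
        forth (δ , δ∈β , v , fv , x∈) =
          let sδ∈β = limit-succ ord-β limit δ∈β
              w , fw = proj₁ (dom (succ δ)) (∈succ-trans ord-α β∈ sδ∈β)
          in succ δ , sδ∈β , w , fw , proj₂ (below (succ δ) sδ∈β w fw x) (δ , self∈succ , v , fv , x∈)
        back : (∃ λ γ → γ ∈ β × ∃ λ w → App f γ w × x ∈ w) → Accumulated f β x
        back (γ , γ∈β , w , fw , x∈w) =
          let δ , δ∈γ , h = proj₁ (below γ γ∈β w fw x) x∈w
          in δ , proj₁ ord-β γ γ∈β δ δ∈γ , h

      union⇒clauses : App f β y → (∀ x → x ∈ y ⟷ Accumulated f β x) → RecursionClauses f β y
      union⇒clauses {y} fy members = at-zero , at-succ , at-limit
        where
        at-zero : β ≈ ∅ → y ≈ ∅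
        at-zero β≈∅ = ∅-unique λ x x∈y →
          let γ , γ∈β , _ = proj₁ (members x) x∈y in ∅-spec γ (∈-respʳ β≈∅ γ∈β)
        at-succ : ∀ γ → γ ∈ β → β ≈ succ γ → ∀ w → App f γ w → y ≈ step w
        at-succ γ γ∈β β≈ w fw = ext λ x →
            (λ x∈y → proj₁ (accumulated-succ γ∈β β≈ fw x) (proj₁ (members x) x∈y))
          , (λ x∈s → proj₂ (members x) (proj₂ (accumulated-succ γ∈β β≈ fw x) x∈s))
        at-limit : Limit β → ∀ x → x ∈ y ⟷ ∃ λ γ → γ ∈ β × ∃ λ w → App f γ w × x ∈ w
        at-limit limit x =
            (λ x∈y → proj₁ (accumulated-limit limit x) (proj₁ (members x) x∈y))
          , (λ h → proj₂ (members x) (proj₂ (accumulated-limit limit x) h))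

      clauses⇒union : RecursionClauses f β y → ∀ x → x ∈ y ⟷ Accumulated f β x
      clauses⇒union {y} (at-zero , at-succ , at-limit) x =
        by-cases stable-goal at-∅ λ β≉∅ → by-cases stable-goal at-successor λ not-succ →
          (λ x∈y → proj₂ (accumulated-limit (β≉∅ , not-succ) x) (proj₁ (at-limit (β≉∅ , not-succ) x) x∈y))
        , (λ h → proj₂ (at-limit (β≉∅ , not-succ) x) (proj₁ (accumulated-limit (β≉∅ , not-succ) x) h))
        where
        stable-goal : Stable (x ∈ y ⟷ Accumulated f β x)
        stable-goal = stableᶠ ((x0 ∈ᶠ x1) ⇔ᶠ accumulatedᶠ x2 x3 x0) {x ∷ y ∷ f ∷ β ∷ []}
        stable-acc : Stable (Accumulated f β x)
        stable-acc = stableᶠ (accumulatedᶠ x0 x1 x2) {f ∷ β ∷ x ∷ []}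
        at-∅ : β ≈ ∅ → x ∈ y ⟷ Accumulated f β x
        at-∅ β≈∅ = (λ x∈y → absurd stable-acc (∅-spec x (∈-respʳ (at-zero β≈∅) x∈y)))
                 , (λ (γ , γ∈β , _) → absurd stable-∈ (∅-spec γ (∈-respʳ β≈∅ γ∈β)))
        at-successor : (∃ λ γ → γ ∈ β × β ≈ succ γ) → x ∈ y ⟷ Accumulated f β x
        at-successor (γ , γ∈β , β≈) =
          let w , fw = proj₁ (dom γ) (∈succ-trans ord-α β∈ γ∈β)
              y≈ = at-succ γ γ∈β β≈ w fw
          in (λ x∈y → proj₂ (accumulated-succ γ∈β β≈ fw x) (∈-respʳ y≈ x∈y))
           , (λ h → ∈-respʳ (≈-sym y≈) (proj₁ (accumulated-succ γ∈β β≈ fw x) h))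

    unions⇒clauses : (∀ β → β ∈ succ α → UnionAt β) → ∀ β → β ∈ succ α → ∀ y → App f β y → RecursionClauses f β y
    unions⇒clauses unions β β∈ y fy =
      union⇒clauses β∈ (λ γ γ∈β → unions γ (∈succ-trans ord-α β∈ γ∈β)) fy (unions β β∈ y fy)

    clauses⇒unions : (∀ β → β ∈ succ α → ∀ y → App f β y → RecursionClauses f β y) → ∀ β → β ∈ succ α → UnionAt β
    clauses⇒unions clauses β β∈ = unions β (ord-∈ (ord-succ ord-α) β∈) β∈
      where
      unions : ∀ β → Ord β → β ∈ succ α → UnionAt β
      unions = ord-induction ((x0 ∈ᶠ succᵗ x1) ⇒ᶠ ∀ᶠ ((kpᵗ x1 x0 ∈ᶠ x3) ⇒ᶠ
                                ∀ᶠ ((x0 ∈ᶠ x1) ⇔ᶠ accumulatedᶠ x4 x2 x0))) (α ∷ f ∷ [])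
        λ β ord-β IH β∈ y fy →
          clauses⇒union β∈ (λ γ γ∈β → IH γ γ∈β (∈succ-trans ord-α β∈ γ∈β)) (clauses β β∈ y fy)

  App-means : Den u ρ f → Den t ρ b → ∀ x → ⟦ kpair (↑ t) v0 ∈z ↑ u ⟧ (x ∷ ρ) ⟷ App f b x
  App-means d e x = Den-∈ (Den-kp (Den-↑ e) (var-den {i = zero})) (Den-↑ d)

  Den-app : Function f → App f b y → Den u ρ f → Den t ρ b → Den (appZ u t) ρ y
  Den-app {f} {b} {y} (_ , functional) fy d e = denotes λ x → ⟷-trans (App-means d e x)
    ((λ fx → functional b x y (fx , fy)) , (λ x≈y → ∈-respˡ (kp-cong ≈-refl (≈-sym x≈y)) fy))

  -- A true membership forces the application to denote, so the value appears under the existential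
  -- on the right.
  var∈app-means : {i : Fin n} → Function f → Den u ρ f → Den t ρ b →
                  Means (var i ∈z appZ u t) ρ (∃ λ w → App f b w × lookup ρ i ∈ w)
  var∈app-means fun d e = means
    ( (λ (w , h , x∈w) → w , proj₁ (App-means d e w) (proj₂ (h w) ≈-refl) , x∈w)
    , (λ (w , fw , x∈w) → w , Den.value (Den-app fun fw d e) , x∈w))

  -- The equation itself supplies the set: with a non-denoting right side it is false, and if `a`
  -- has the right elements then `a` is the value. This covers the union in the limit clause, whose
  -- existence has not been shown separately.
  ≐-setOf-means : {φ : ZForm (suc n)} {P : M → Set} → Den t ρ a → (∀ x → Means φ (x ∷ ρ) (P x)) →
                  Means (t ≐ setOf φ) ρ (∀ x → x ∈ a ⟷ P x)
  ≐-setOf-means {t = t} {ρ} {a} {φ} {P} d c = means (forth , back)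
    where
    members : ∀ y → Means (∀̇ ((v0 ∈z v1) ⇔ renF skip1 φ)) (y ∷ ρ) (∀ x → x ∈ y ⟷ P x)
    members y = ∀-means λ x → ⇔-means (∈-means var-den var-den) (ren-means (lookup-skip1 ρ) (c x))
    forth : ⟦ t ≐ setOf φ ⟧ ρ → ∀ x → x ∈ a ⟷ P x
    forth h x = let b , is-b , a≈b = proj₁ (Den-≔ d (λ p (b , is-b , q) → b , is-b , ≈-trans (≈-sym p) q)) h
                    b-spec = proj₁ (iff (members b)) (proj₂ (is-b b) ≈-refl) x
                in (λ x∈a → proj₁ b-spec (∈-respʳ a≈b x∈a)) , (λ p → ∈-respʳ (≈-sym a≈b) (proj₂ b-spec p))
    back : (∀ x → x ∈ a ⟷ P x) → ⟦ t ≐ setOf φ ⟧ ρ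
    back spec = proj₂ (Den-≐ d (Den-setOf c spec)) ≈-refl

  limitᶠ : Tm n → Fm n
  limitᶠ t = ¬ᶠ (t ≐ᶠ ∅ᵗ) ∧ᶠ ¬ᶠ ∃∈ᶠ t (↑ᵗ t ≐ᶠ succᵗ x0)

  module _ {α f : M} (ord-α : Ord α) (fun : Function f) (dom : Domain f (succ α)) {n : ℕ} (ρ : Env n) where

    clauses-means : β ∈ succ α → App f β y → Means (wClauseZ v1 v0) (β ∷ f ∷ ρ) (RecursionClauses f β y)
    clauses-means {β} {y} β∈ fy = ∧-means at-zero (∧-means at-succ at-limit)
      where
      value : Den (appZ v1 v0) (β ∷ f ∷ ρ) y
      value = Den-app fun fy (var-den {i = suc zero}) (var-den {i = zero})
      at-zero : Means ((v0 ≐ zeroZ) ⇒ (appZ v1 v0 ≐ zeroZ)) (β ∷ f ∷ ρ) (β ≈ ∅ → y ≈ ∅)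
      at-zero = ⇒-means (≐-means {t = v0} {u = zeroZ} var-den Den-∅)
                        (≐-means {t = appZ v1 v0} {u = zeroZ} value Den-∅)
      succ-case : ZForm (3 + n)
      succ-case = (v1 ≐ succZ v0) ⇒ (appZ v2 v1 ≐ stepZ (appZ v2 v0))
      succ-case-means : ∀ γ w → App f γ w →
                        Means succ-case (γ ∷ β ∷ f ∷ ρ) (β ≈ succ γ → y ≈ step w)
      succ-case-means γ w fw =
        ⇒-means (≐-means {t = v1} {u = succZ v0} var-den (Den-succ {t = v0} var-den))
                (≐-means {t = appZ v2 v1} {u = stepZ (appZ v2 v0)} value-at-β (Den-step {t = appZ v2 v0} value-at-γ))
        where
        value-at-β : Den (appZ v2 v1) (γ ∷ β ∷ f ∷ ρ) y
        value-at-β = Den-app fun fy (var-den {i = suc (suc zero)}) (var-den {i = suc zero})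
        value-at-γ : Den (appZ v2 v0) (γ ∷ β ∷ f ∷ ρ) w
        value-at-γ = Den-app fun fw (var-den {i = suc (suc zero)}) (var-den {i = zero})
      at-succ : Means (∀∈z v0 succ-case) (β ∷ f ∷ ρ) (∀ γ → γ ∈ β → β ≈ succ γ → ∀ w → App f γ w → y ≈ step w)
      at-succ = ∀∈-means {t = v0} var-den λ γ γ∈β →
        let w , fw = proj₁ (dom γ) (∈succ-trans ord-α β∈ γ∈β) in
        means-⟷ (succ-case-means γ w fw)
          ( (λ h β≈ w′ fw′ → ≈-trans (h β≈) (val-cong (stepᵗ x0) {[]} (proj₂ fun γ w w′ (fw , fw′))))
          , (λ h β≈ → h β≈ w fw))
      in-union : ∀ x → Means (∃∈z v1 (v1 ∈z appZ v3 v0)) (x ∷ β ∷ f ∷ ρ)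
                             (∃ λ γ → γ ∈ β × ∃ λ w → App f γ w × x ∈ w)
      in-union x = ∃∈-means {t = v1} var-den λ γ →
        var∈app-means {i = suc zero} fun (var-den {i = suc (suc (suc zero))}) (var-den {i = zero})
      at-limit : Means (limitZ v0 ⇒ (appZ v1 v0 ≐ bigUZ v1 v0)) (β ∷ f ∷ ρ)
                       (Limit β → ∀ x → x ∈ y ⟷ ∃ λ γ → γ ∈ β × ∃ λ w → App f γ w × x ∈ w)
      at-limit = ⇒-means (corr (limitᶠ x0) (β ∷ f ∷ ρ)) (≐-setOf-means {t = appZ v1 v0} value in-union)

  -- `HZ` read halfway. The clauses and the final membership contain applications of `f` and can be
  -- interpreted only after the first two components make `f` a function with the right domain.
  RawHistory : Fin n → Env n → M → M → Set
  RawHistory i ρ α f = Function f × Domain f (succ α)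
                     × (∀ β → β ∈ succ α → ⟦ wClauseZ v1 v0 ⟧ (β ∷ f ∷ α ∷ ρ))
                     × ⟦ var (suc (suc i)) ∈z appZ v0 v1 ⟧ (f ∷ α ∷ ρ)

  HZ-means : (i : Fin n) (ρ : Env n) → Means (HZ (var i)) ρ (H (lookup ρ i))
  HZ-means i ρ = means
    ( (λ h → let α , ord-α , f , history = proj₁ (iff raw) h in to α ord-α f history)
    , (λ h → proj₂ (iff raw) (from h)))
    where
    raw : Means (HZ (var i)) ρ (∃ λ α → Ord α × ∃ λ f → RawHistory i ρ α f)
    raw = ∃-means λ α → ∧-means (corr (ordᶠ x0) (α ∷ ρ)) (∃-means λ f →
      ∧-means (corr (functionᶠ x0) (f ∷ α ∷ ρ)) (∧-means (corr (domainᶠ x0 (succᵗ x1)) (f ∷ α ∷ ρ))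
        (∧-means (∀∈-means (Den-succ var-den) λ β _ → means ⟷-refl) (means ⟷-refl))))
    to : ∀ α → Ord α → ∀ f → RawHistory i ρ α f → H (lookup ρ i)
    to α ord-α f (fun , dom , clauses , x∈) =
      let w , fw , x∈w = proj₁ (iff (var∈app-means {ρ = f ∷ α ∷ ρ} {i = suc (suc i)} fun (var-den {i = zero}) (var-den {i = suc zero}))) x∈
          unions = Recursion.clauses⇒unions ord-α fun dom λ β β∈ y fy →
                     proj₁ (iff (clauses-means ord-α fun dom (α ∷ ρ) β∈ fy)) (clauses β β∈)
      in α , ord-α , w , (f , (fun , dom , unions) , fw) , x∈w
    from : H (lookup ρ i) → ∃ λ α → Ord α × ∃ λ f → RawHistory i ρ α f
    from (α , ord-α , w , (f , (fun , dom , unions) , fw) , x∈w) =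
      α , ord-α , f , fun , dom
      , (λ β β∈ → let y , fy = proj₁ (dom β) β∈ in
           proj₂ (iff (clauses-means ord-α fun dom (α ∷ ρ) β∈ fy))
                 (Recursion.unions⇒clauses ord-α fun dom unions β β∈ y fy))
      , proj₂ (iff (var∈app-means {ρ = f ∷ α ∷ ρ} {i = suc (suc i)} fun (var-den {i = zero}) (var-den {i = suc zero})))
              (w , fw , x∈w)

-- The universe H and the meaning of translated formulas

module Interpretation (𝓜 : Model ZFAxiom) where

  open Model 𝓜
  open SetTheory 𝓜
  open SetConstructions 𝓜
  open Ordinals 𝓜
  open Hierarchy 𝓜
  open Universe 𝓜

  private variable
    α β γ a b u v w x y z : M

  -- Closure properties of the universe H

  InLevel : M → M → Set
  InLevel α x = ∃ λ w → Level α w × x ∈ w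

  inLevelᶠ : Tm n → Tm n → Fm n
  inLevelᶠ α x = ∃ᶠ (levelᶠ (↑ᵗ α) x0 ∧ᶠ (↑ᵗ x ∈ᶠ x0))

  Hᶠ : Fin n → Fm n
  Hᶠ i = record { form = HZ (var i) ; sem = λ ρ → H (lookup ρ i) ; corr = HZ-means i }

  stable-H : Stable (H x)
  stable-H {x} = stableᶠ (Hᶠ zero) {x ∷ []}

  H-step : Ord γ → Level γ w → x ∈ step w → H x
  H-step {γ} {w} ord-γ Lw x∈ = let v , Lv = Level-total (succ γ) (ord-succ ord-γ) in
    succ γ , ord-succ ord-γ , v , Lv , proj₂ (Level-spec (ord-succ ord-γ) Lv _) (γ , self∈succ , w , Lw , x∈)

  H-inversion : H x → ∃ λ γ → Ord γ × ∃ λ w → Level γ w × x ∈ step w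
  H-inversion {x} (α , ord-α , w , Lw , x∈w) = let γ , γ∈α , v , Lv , x∈ = proj₁ (Level-spec ord-α Lw x) x∈w in
    γ , ord-∈ ord-α γ∈α , v , Lv , x∈

  Level-mono : Ord α → Ord β → α ⊆ β → Level α v → Level β w → v ⊆ w
  Level-mono ord-α ord-β α⊆β Lv Lw x x∈v = let γ , γ∈α , h = proj₁ (Level-spec ord-α Lv x) x∈v in
    proj₂ (Level-spec ord-β Lw x) (γ , α⊆β γ γ∈α , h)

  -- An element lies in many levels; replacement needs a single one to be chosen.
  LeastLevel : M → M → Set
  LeastLevel β x = (Ord β × InLevel β x) × (∀ γ → γ ∈ β → ¬ InLevel γ x)

  leastLevel-unique : LeastLevel α x → LeastLevel β x → α ≈ β
  leastLevel-unique {α} {β = β} ((ord-α , in-α) , below-α) ((ord-β , in-β) , below-β) =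
    cases stable-≈ (trichotomy α ord-α β ord-β) (λ α∈β → absurd stable-≈ (below-β α α∈β in-α)) λ h →
    cases stable-≈ h id (λ β∈α → absurd stable-≈ (below-α β β∈α in-β))

  -- The least levels of the elements of `y` form a set of ordinals by replacement. Its union is an
  -- ordinal including all of them, and levels grow along inclusion.
  H-bounded : ∀ y → (∀ a → a ∈ y → H a) → ∃ λ σ → Ord σ × ∃ λ w → Level σ w × y ⊆ w
  H-bounded y y⊆H = ⋃ S , ord-σ , proj₁ W , proj₂ W , y⊆W
    where
    leastLevel : ∀ a → a ∈ y → ∃ λ β → LeastLevel β a
    leastLevel a a∈y = let α , ord-α , in-α = y⊆H a a∈y in least (inLevelᶠ x0 x1) (a ∷ []) ord-α in-α
    levels : ∃ λ S → ∀ β → β ∈ S ⟷ ∃ λ a → a ∈ y × LeastLevel β a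
    levels = replace ((ordᶠ x0 ∧ᶠ inLevelᶠ x0 x1) ∧ᶠ ∀∈ᶠ x0 (¬ᶠ inLevelᶠ x0 x2)) [] y λ a a∈y →
      let β , l = leastLevel a a∈y in β , l , λ γ l′ → leastLevel-unique l′ l
    S : M
    S = proj₁ levels
    ord-S : ∀ α → α ∈ S → Ord α
    ord-S α α∈S = let a , a∈y , l = proj₁ (proj₂ levels α) α∈S in proj₁ (proj₁ l)
    ord-σ : Ord (⋃ S)
    ord-σ = ord-⋃ ord-S
    W : ∃ (Level (⋃ S))
    W = Level-total (⋃ S) ord-σ
    y⊆W : y ⊆ proj₁ W
    y⊆W a a∈y =
      let β , l@((ord-β , v , Lv , a∈v) , _) = leastLevel a a∈y
          β∈S = proj₂ (proj₂ levels β) (a , a∈y , l)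
      in Level-mono ord-β ord-σ (λ γ γ∈β → proj₂ (⋃-spec γ) (β , β∈S , γ∈β)) Lv (proj₂ W) a a∈v

  H-set : (∀ a → a ∈ y → H a) → H (kp ∅ y)
  H-set {y} y⊆H = let σ , ord-σ , w , Lw , y⊆w = H-bounded y y⊆H in H-step ord-σ Lw (step-set y⊆w)

  H-pair : H u → H v → H (kp one (kp u v))
  H-pair {u} {v} Hu Hv = H-step ord-σ Lw (step-pair (uv⊆w u (proj₂ (upair-spec u) (left ≈-refl)))
                                                    (uv⊆w v (proj₂ (upair-spec v) (right ≈-refl))))
    where
    bounded : ∃ λ σ → Ord σ × ∃ λ w → Level σ w × upair u v ⊆ w
    bounded = H-bounded (upair u v) λ a a∈ → cases stable-H (proj₁ (upair-spec a) a∈)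
      (λ a≈u → leibnizᶠ (Hᶠ zero) {[]} (≈-sym a≈u) Hu) (λ a≈v → leibnizᶠ (Hᶠ zero) {[]} (≈-sym a≈v) Hv)
    ord-σ = proj₁ (proj₂ bounded)
    Lw    = proj₁ (proj₂ (proj₂ (proj₂ bounded)))
    uv⊆w  = proj₂ (proj₂ (proj₂ (proj₂ bounded)))

  -- The interpreted predicates

  infix 4 _∈̂_ _π̂₁_ _π̂₂_

  _∈̂_ _π̂₁_ _π̂₂_ : M → M → Set
  a ∈̂ x  = ∃ λ y → x ≈ kp ∅ y × a ∈ y
  a π̂₁ p = ∃ λ u → ∃ λ v → p ≈ kp one (kp u v) × a ≈ u
  a π̂₂ p = ∃ λ u → ∃ λ v → p ≈ kp one (kp u v) × a ≈ v

  _∈̂ᶠ_ _π̂₁ᶠ_ _π̂₂ᶠ_ : Tm n → Tm n → Fm n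
  a ∈̂ᶠ x  = ∃ᶠ ((↑ᵗ x ≐ᶠ kpᵗ ∅ᵗ x0) ∧ᶠ (↑ᵗ a ∈ᶠ x0))
  a π̂₁ᶠ p = ∃ᶠ (∃ᶠ ((↑ᵗ (↑ᵗ p) ≐ᶠ kpᵗ oneᵗ (kpᵗ x1 x0)) ∧ᶠ (↑ᵗ (↑ᵗ a) ≐ᶠ x1)))
  a π̂₂ᶠ p = ∃ᶠ (∃ᶠ ((↑ᵗ (↑ᵗ p) ≐ᶠ kpᵗ oneᵗ (kpᵗ x1 x0)) ∧ᶠ (↑ᵗ (↑ᵗ a) ≐ᶠ x0)))

  ∈̂-set : ∀ a → a ∈̂ kp ∅ y ⟷ a ∈ y
  ∈̂-set {y} a = (λ (z , p , a∈z) → ∈-respʳ (≈-sym (kp-injectiveʳ p)) a∈z) , (λ a∈y → y , ≈-refl , a∈y)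

  ∈̂-resp : x ≈ y → a ∈̂ x → a ∈̂ y
  ∈̂-resp p (z , q , a∈z) = z , ≈-trans (≈-sym p) q , a∈z

  set≉pair : x ≈ kp ∅ y → ¬ (x ≈ kp one z)
  set≉pair p q = ∅≉one (kp-injectiveˡ (≈-trans (≈-sym p) q))

  -- Constituents descend: what was built from `w` by one application of F has its members in `w`.
  -- Transitivity of H and the foundation axiom both rest on this and on `pair-step`.
  ∈̂-step : a ∈ step w → b ∈̂ a → b ∈ w
  ∈̂-step a∈ (y , a≈ , b∈y) = cases stable-∈ (step-inversion a∈)
    (λ (z , a≈′ , z⊆w) → z⊆w _ (∈-respʳ (kp-injectiveʳ (≈-trans (≈-sym a≈) a≈′)) b∈y))
    (λ (u , v , a≈′ , _) → absurd stable-∈ (set≉pair a≈ a≈′))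

  pair-step : x ∈ step w → x ≈ kp one (kp u v) → u ∈ w × v ∈ w
  pair-step x∈ x≈ = cases (stable-× stable-∈ stable-∈) (step-inversion x∈)
    (λ (z , x≈′ , _) → absurd (stable-× stable-∈ stable-∈) (set≉pair x≈′ x≈))
    (λ (u′ , v′ , x≈′ , u′∈ , v′∈) →
      let p = kp-injectiveʳ (≈-trans (≈-sym x≈′) x≈)
      in ∈-respˡ (kp-injectiveˡ p) u′∈ , ∈-respˡ (kp-injectiveʳ p) v′∈)

  H-∈̂ : H x → a ∈̂ x → H a
  H-∈̂ Hx a∈x = let γ , ord-γ , w , Lw , x∈ = H-inversion Hx in γ , ord-γ , w , Lw , ∈̂-step x∈ a∈x

  H-components : H x → x ≈ kp one (kp u v) → H u × H v
  H-components Hx x≈ = let γ , ord-γ , w , Lw , x∈ = H-inversion Hx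
                           u∈ , v∈ = pair-step x∈ x≈
                       in (γ , ord-γ , w , Lw , u∈) , (γ , ord-γ , w , Lw , v∈)

  IsPair : M → Set
  IsPair x = ∃ λ b → H b × b π̂₁ x

  pair-shape : IsPair x → ∃ λ u → ∃ λ v → x ≈ kp one (kp u v)
  pair-shape (_ , _ , u , v , x≈ , _) = u , v , x≈

  is-pair : H x → x ≈ kp one (kp u v) → IsPair x
  is-pair {u = u} {v} Hx x≈ = u , proj₁ (H-components Hx x≈) , u , v , x≈ , ≈-refl

  set-not-pair : ¬ IsPair (kp ∅ y)
  set-not-pair h = let u , v , x≈ = pair-shape h in set≉pair ≈-refl x≈

  set-shape : H x → ¬ IsPair x → ∃ λ y → x ≈ kp ∅ y × (∀ a → a ∈ y → H a)
  set-shape {x} Hx not-pair =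
    let γ , ord-γ , w , Lw , x∈ = H-inversion Hx
        y , x≈ = cases (stableᶠ (∃ᶠ (x1 ≐ᶠ kpᵗ ∅ᵗ x0)) {x ∷ []}) (step-inversion x∈)
          (λ (y , x≈ , _) → y , x≈)
          (λ (u , v , x≈ , _) → absurd (stableᶠ (∃ᶠ (x1 ≐ᶠ kpᵗ ∅ᵗ x0)) {x ∷ []}) (not-pair (is-pair Hx x≈)))
    in y , x≈ , λ a a∈y → H-∈̂ Hx (y , x≈ , a∈y)

  set-elements : x ≈ kp ∅ y → ∀ a → a ∈̂ x ⟷ a ∈ y
  set-elements x≈ a = (λ a∈x → proj₁ (∈̂-set a) (∈̂-resp x≈ a∈x)) , (λ a∈y → _ , x≈ , a∈y)

  -- For a pair x this is ∅.
  elements : ∀ x → ∃ λ y → ∀ a → a ∈ y ⟷ a ∈̂ x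
  elements x = exactly (x0 ∈̂ᶠ x1) (x ∷ []) (⋃ (⋃ x)) λ a (y , x≈ , a∈y) →
    proj₂ (⋃-spec a) (y , proj₂ (⋃-spec y) (upair ∅ y , ∈-respʳ (≈-sym x≈) (proj₂ (kp-spec _) (right ≈-refl))
                         , proj₂ (upair-spec y) (right ≈-refl)) , a∈y)

  -- Interpretation of translated formulas

  -- Indexed by the ZFP formula itself, so that `correct` concerns literally `trF φ`; the meaning
  -- has its quantifiers restricted to H.
  record Translated (φ : PForm n) : Set₁ where
    field
      meaning : Env n → Set
      correct : ∀ ρ → Means (trF φ) ρ (meaning ρ)
  open Translated public

  statement : {φ : PForm 0} → ZFPAxiom φ → PForm 0
  statement {φ} _ = φ

  private variable
    φ ψ : PForm n

  translatedᶠ : {φ : PForm n} → Translated φ → Fm n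
  translatedᶠ {φ = φ} P = record { form = trF φ ; sem = meaning P ; corr = correct P }

  infix  7 _∈ᴾ_ _π₁ᴾ_ _π₂ᴾ_ _≐ᴾ_
  infixr 6 _∧ᴾ_ _∨ᴾ_
  infixr 5 _⇒ᴾ_ _⇔ᴾ_

  _∈ᴾ_ : (i j : Fin n) → Translated (var i ∈p var j)
  i ∈ᴾ j = record { meaning = λ ρ → lookup ρ i ∈̂ lookup ρ j ; correct = corr (varᵗ i ∈̂ᶠ varᵗ j) }

  _π₁ᴾ_ : (i j : Fin n) → Translated (var i π₁ var j)
  i π₁ᴾ j = record { meaning = λ ρ → lookup ρ i π̂₁ lookup ρ j ; correct = corr (varᵗ i π̂₁ᶠ varᵗ j) }

  _π₂ᴾ_ : (i j : Fin n) → Translated (var i π₂ var j)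
  i π₂ᴾ j = record { meaning = λ ρ → lookup ρ i π̂₂ lookup ρ j ; correct = corr (varᵗ i π̂₂ᶠ varᵗ j) }

  _≐ᴾ_ : (i j : Fin n) → Translated (var i ≐ var j)
  i ≐ᴾ j = record { meaning = λ ρ → lookup ρ i ≈ lookup ρ j ; correct = λ ρ → ≐-means var-den var-den }

  ¬ᴾ_ : Translated φ → Translated (¬̇ φ)
  ¬ᴾ P = record { meaning = λ ρ → ¬ meaning P ρ ; correct = λ ρ → ¬-means (correct P ρ) }

  _⇒ᴾ_ : Translated φ → Translated ψ → Translated (φ ⇒ ψ)
  P ⇒ᴾ Q = record { meaning = λ ρ → meaning P ρ → meaning Q ρ
                  ; correct = λ ρ → ⇒-means (correct P ρ) (correct Q ρ) }

  _∧ᴾ_ : Translated φ → Translated ψ → Translated (φ ∧̇ ψ)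
  P ∧ᴾ Q = record { meaning = λ ρ → meaning P ρ × meaning Q ρ
                  ; correct = λ ρ → ∧-means (correct P ρ) (correct Q ρ) }

  _∨ᴾ_ : Translated φ → Translated ψ → Translated (φ ∨̇ ψ)
  P ∨ᴾ Q = record { meaning = λ ρ → meaning P ρ ∨ meaning Q ρ
                  ; correct = λ ρ → ∨-means (correct P ρ) (correct Q ρ) }

  _⇔ᴾ_ : Translated φ → Translated ψ → Translated (φ ⇔ ψ)
  P ⇔ᴾ Q = (P ⇒ᴾ Q) ∧ᴾ (Q ⇒ᴾ P)

  ∀ᴾ : Translated φ → Translated (∀̇ φ)
  ∀ᴾ P = record { meaning = λ ρ → ∀ x → H x → meaning P (x ∷ ρ)
                ; correct = λ ρ → ∀-means λ x → ⇒-means (HZ-means zero (x ∷ ρ)) (correct P (x ∷ ρ)) }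

  ∃ᴾ : Translated φ → Translated (∃̇ φ)
  ∃ᴾ P = record
    { meaning = λ ρ → ∃ λ x → H x × meaning P (x ∷ ρ)
    ; correct = λ ρ → means-⟷ (correct (¬ᴾ ∀ᴾ (¬ᴾ P)) ρ)
        -- The translated existential is a negated universal restricted to H; stability recovers a
        -- witness in H.
        ( (λ h → stableᶠ (∃ᶠ (Hᶠ zero ∧ᶠ translatedᶠ P)) λ none → h λ x Hx Px → none (x , Hx , Px))
        , (λ (x , Hx , Px) k → k x Hx Px))
    }

  pattern i0 = zero
  pattern i1 = suc zero
  pattern i2 = suc (suc zero)
  pattern i3 = suc (suc (suc zero))

  pairᴾ : (i : Fin n) → Translated (PairP (var i))
  pairᴾ i = ∃ᴾ (i0 π₁ᴾ suc i)

  setᴾ : (i : Fin n) → Translated (SetP (var i))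
  setᴾ i = ¬ᴾ pairᴾ i

  ∀Setᴾ : Translated φ → Translated (∀Set φ)
  ∀Setᴾ P = ∀ᴾ (setᴾ i0 ⇒ᴾ P)

  ∃Setᴾ : Translated φ → Translated (∃Set φ)
  ∃Setᴾ P = ∃ᴾ (setᴾ i0 ∧ᴾ P)

  ∀Pairᴾ : Translated φ → Translated (∀Pair φ)
  ∀Pairᴾ P = ∀ᴾ (pairᴾ i0 ⇒ᴾ P)

  ∀∈ᴾ : (i : Fin n) → Translated φ → Translated (∀∈p (var i) φ)
  ∀∈ᴾ i P = ∀ᴾ (i0 ∈ᴾ suc i ⇒ᴾ P)

  ∃∈ᴾ : (i : Fin n) → Translated φ → Translated (∃∈p (var i) φ)
  ∃∈ᴾ i P = ∃ᴾ (i0 ∈ᴾ suc i ∧ᴾ P)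

-- The axioms of ZFP other than replacement

module Axioms (𝓜 : Model ZFAxiom) where

  open Model 𝓜
  open SetTheory 𝓜
  open SetConstructions 𝓜
  open Ordinals 𝓜
  open Hierarchy 𝓜
  open Universe 𝓜
  open Interpretation 𝓜

  private variable
    a b p u v w x y : M

  S1ᴾ : Translated (statement S1)
  S1ᴾ = ∀Setᴾ (∀Setᴾ (∀ᴾ ((i0 ∈ᴾ i2) ⇔ᴾ (i0 ∈ᴾ i1)) ⇒ᴾ (i1 ≐ᴾ i0)))

  S1-holds : meaning S1ᴾ []
  S1-holds x Hx set-x y Hy set-y same =
    let x₁ , x≈ , x₁⊆H = set-shape Hx set-x
        y₁ , y≈ , y₁⊆H = set-shape Hy set-y
        x₁≈y₁ = ext λ a →
            (λ a∈x₁ → proj₁ (set-elements y≈ a) (proj₁ (same a (x₁⊆H a a∈x₁)) (proj₂ (set-elements x≈ a) a∈x₁)))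
          , (λ a∈y₁ → proj₁ (set-elements x≈ a) (proj₂ (same a (y₁⊆H a a∈y₁)) (proj₂ (set-elements y≈ a) a∈y₁)))
    in ≈-trans x≈ (≈-trans (kp-cong ≈-refl x₁≈y₁) (≈-sym y≈))

  S2ᴾ : Translated (statement S2)
  S2ᴾ = ∀Setᴾ (∃ᴾ (∀ᴾ ((i0 ∈ᴾ i1) ⇔ᴾ ∃∈ᴾ i2 (i1 ∈ᴾ i0))))

  S2-holds : meaning S2ᴾ []
  S2-holds x Hx set-x = kp ∅ U , H-set U⊆H , λ a Ha →
      (λ a∈U → let z , z∈X , a∈z = proj₁ (U-spec a) (proj₁ (∈̂-set a) a∈U)
                   z∈x = proj₁ (X-spec z) z∈X
               in z , H-∈̂ Hx z∈x , z∈x , proj₁ (proj₂ (elements z) a) a∈z)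
    , (λ (z , Hz , z∈x , a∈z) → proj₂ (∈̂-set a)
         (proj₂ (U-spec a) (z , proj₂ (X-spec z) z∈x , proj₂ (proj₂ (elements z) a) a∈z)))
    where
    X : M
    X = proj₁ (elements x)
    X-spec : ∀ a → a ∈ X ⟷ a ∈̂ x
    X-spec = proj₂ (elements x)
    -- The members of `x` are codes, so a union cannot be taken directly. Replacement exchanges each
    -- code for the set of its interpreted members, which is empty for a pair.
    families : ∃ λ F → ∀ f → f ∈ F ⟷ ∃ λ z → z ∈ X × (∀ a → a ∈ f ⟷ a ∈̂ z)
    families = replace (∀ᶠ ((x0 ∈ᶠ x1) ⇔ᶠ (x0 ∈̂ᶠ x2))) [] X λ z _ →
      proj₁ (elements z) , proj₂ (elements z) , λ f f-spec → ext λ a →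
        ⟷-trans (f-spec a) (⟷-sym (proj₂ (elements z) a))
    U : M
    U = ⋃ (proj₁ families)
    U-spec : ∀ a → a ∈ U ⟷ ∃ λ z → z ∈ X × a ∈ proj₁ (elements z)
    U-spec a = forth , back
      where
      forth : a ∈ U → ∃ λ z → z ∈ X × a ∈ proj₁ (elements z)
      forth a∈U = let f , f∈ , a∈f = proj₁ (⋃-spec a) a∈U
                      z , z∈X , f-spec = proj₁ (proj₂ families f) f∈
                  in z , z∈X , proj₂ (proj₂ (elements z) a) (proj₁ (f-spec a) a∈f)
      back : (∃ λ z → z ∈ X × a ∈ proj₁ (elements z)) → a ∈ U
      back (z , z∈X , a∈z) = proj₂ (⋃-spec a)
        (proj₁ (elements z) , proj₂ (proj₂ families _) (z , z∈X , proj₂ (elements z)) , a∈z)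
    U⊆H : ∀ a → a ∈ U → H a
    U⊆H a a∈U = let z , z∈X , a∈z = proj₁ (U-spec a) a∈U in
      H-∈̂ (H-∈̂ Hx (proj₁ (X-spec z) z∈X)) (proj₁ (proj₂ (elements z) a) a∈z)

  S3ᴾ : Translated (statement S3)
  S3ᴾ = ∀Setᴾ (∃ᴾ (∀ᴾ ((i0 ∈ᴾ i1) ⇔ᴾ (setᴾ i0 ∧ᴾ setᴾ i2 ∧ᴾ ∀∈ᴾ i0 (i0 ∈ᴾ i3)))))

  S3-holds : meaning S3ᴾ []
  S3-holds x Hx set-x = kp ∅ P , H-set P⊆H , λ z Hz → forth z , back z Hz
    where
    shape : ∃ λ y → x ≈ kp ∅ y × (∀ a → a ∈ y → H a)
    shape = set-shape Hx set-x
    Y : M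
    Y = proj₁ shape
    x≈ = proj₁ (proj₂ shape)
    P : M
    -- The codes ⟨0,u⟩ of the subsets u of `Y`.
    P = prod (sing ∅) (pow Y)
    P-spec : ∀ z → z ∈ P → ∃ λ u → z ≈ kp ∅ u × u ⊆ Y
    P-spec z z∈ = let e , e∈ , u , u∈ , z≈ = proj₁ (prod-spec z) z∈ in
      u , ≈-trans z≈ (kp-cong (proj₁ (sing-spec e) e∈) ≈-refl) , proj₁ (pow-spec u) u∈
    P⊆H : ∀ z → z ∈ P → H z
    P⊆H z z∈ = let u , z≈ , u⊆y = P-spec z z∈ in
      leibnizᶠ (Hᶠ zero) {[]} (≈-sym z≈) (H-set λ a a∈u → proj₂ (proj₂ shape) a (u⊆y a a∈u))
    forth : ∀ z → z ∈̂ kp ∅ P → ¬ IsPair z × ¬ IsPair x × (∀ a → H a → a ∈̂ z → a ∈̂ x)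
    forth z z∈ = let u , z≈ , u⊆y = P-spec z (proj₁ (∈̂-set z) z∈) in
        (λ pair → let _ , _ , p = pair-shape pair in set≉pair z≈ p)
      , set-x
      , (λ a _ a∈z → proj₂ (set-elements x≈ a) (u⊆y a (proj₁ (set-elements z≈ a) a∈z)))
    back : ∀ z → H z → ¬ IsPair z × ¬ IsPair x × (∀ a → H a → a ∈̂ z → a ∈̂ x) → z ∈̂ kp ∅ P
    back z Hz (set-z , _ , z⊆x) = let u , z≈ , u⊆H = set-shape Hz set-z in
      proj₂ (∈̂-set z) (proj₂ (prod-spec z) (∅ , self∈sing , u , proj₂ (pow-spec u) (λ a a∈u →
        proj₁ (set-elements x≈ a) (z⊆x a (u⊆H a a∈u) (proj₂ (set-elements z≈ a) a∈u))) , z≈))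

  S4ᴾ : Translated (statement S4)
  S4ᴾ = ∃ᴾ (∃Setᴾ ((i0 ∈ᴾ i1) ∧ᴾ ∀ᴾ (¬ᴾ (i0 ∈ᴾ i1)))
            ∧ᴾ ∀∈ᴾ i0 (∃∈ᴾ i1 (∀ᴾ ((i0 ∈ᴾ i1) ⇔ᴾ ((i0 ∈ᴾ i2) ∨ᴾ (i0 ≐ᴾ i2))))))

  -- For such an ordinal λ, W_λ is closed under x ↦ x ∪ {x}.
  LimitOrdinal : Set
  LimitOrdinal = ∃ λ ℓ → Ord ℓ × ∃ (_∈ ℓ) × (∀ x → x ∈ ℓ → ∃ λ α → α ∈ ℓ × x ∈ α)

  limit-ordinal : LimitOrdinal
  limit-ordinal = ⋃ J , ord-⋃ (λ α α∈J → proj₂ (proj₁ (J-spec α) α∈J)) , (e , e∈ℓ) , λ x x∈ℓ →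
      let α , α∈J , x∈α = proj₁ (⋃-spec x) x∈ℓ
          s , s∈J , α∈s = next α α∈J
      in α , proj₂ (⋃-spec α) (s , s∈J , α∈s) , x∈α
    where
    I = proj₁ infinity-set
    e = proj₁ (proj₁ (proj₂ infinity-set))
    -- The ordinals in the inductive set are closed under successor but need not form a transitive
    -- set, so the limit ordinal is their union.
    J : M
    J = proj₁ (separate (ordᶠ x0) [] I)
    J-spec : ∀ x → x ∈ J ⟷ (x ∈ I × Ord x)
    J-spec = proj₂ (separate (ordᶠ x0) [] I)
    next : ∀ α → α ∈ J → ∃ λ s → s ∈ J × α ∈ s
    next α α∈J =
      let α∈I , ord-α = proj₁ (J-spec α) α∈J
          s , s∈I , s-spec = proj₂ (proj₂ infinity-set) α α∈I
          s≈ : succ α ≈ s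
          s≈ = ext λ z → ⟷-trans (succ-spec z) (⟷-sym (s-spec z))
      in s , proj₂ (J-spec s) (s∈I , leibnizᶠ (ordᶠ x0) {[]} s≈ (ord-succ ord-α)) , ∈-respʳ s≈ self∈succ
    e-empty : ∀ x → ¬ (x ∈ e)
    e-empty = proj₂ (proj₂ (proj₁ (proj₂ infinity-set)))
    e∈J : e ∈ J
    e∈J = proj₂ (J-spec e) (proj₁ (proj₂ (proj₁ (proj₂ infinity-set)))
      , (λ y y∈e → absurd (stableᶠ (x0 ⊆ᶠ x1) {y ∷ e ∷ []}) (e-empty y y∈e))
      , (λ y y∈e → absurd (stableᶠ (transᶠ x0) {y ∷ []}) (e-empty y y∈e)))
    e∈ℓ : e ∈ ⋃ J
    e∈ℓ = let s , s∈J , e∈s = next e e∈J in proj₂ (⋃-spec e) (s , s∈J , e∈s)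

  infinite-set : LimitOrdinal → meaning S4ᴾ []
  infinite-set (ℓ , ord-ℓ , (e , e∈ℓ) , cofinal) = kp ∅ W , H-set W⊆H , zero-set , successor-set
    where
    W : M
    W = proj₁ (Level-total ℓ ord-ℓ)
    LW : Level ℓ W
    LW = proj₂ (Level-total ℓ ord-ℓ)
    W⊆H : ∀ a → a ∈ W → H a
    W⊆H a a∈W = ℓ , ord-ℓ , W , LW , a∈W
    H-∅ : H (kp ∅ ∅)
    H-∅ = H-set λ a a∈ → absurd stable-H (∅-spec a a∈)
    step⊆W : ∀ α → α ∈ ℓ → ∀ v → Level α v → step v ⊆ W
    step⊆W α α∈ℓ v Lv x x∈ = proj₂ (Level-spec ord-ℓ LW x) (α , α∈ℓ , v , Lv , x∈)
    ∅∈̂W : kp ∅ ∅ ∈̂ kp ∅ W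
    ∅∈̂W = let v , Lv = Level-total e (ord-∈ ord-ℓ e∈ℓ) in
      proj₂ (∈̂-set _) (step⊆W e e∈ℓ v Lv _ (step-set λ a a∈ → absurd stable-∈ (∅-spec a a∈)))
    zero-set : ∃ λ z → H z × ¬ IsPair z × z ∈̂ kp ∅ W × (∀ b → H b → ¬ (b ∈̂ z))
    zero-set = kp ∅ ∅ , H-∅ , set-not-pair , ∅∈̂W , λ a _ a∈ → ∅-spec a (proj₁ (∈̂-set a) a∈)
    -- If `x` is in F(W_γ), choose `α` in `ℓ` above `γ`. Both `x` and its members lie in W_α, so the
    -- code of x ∪ {x} lies in F(W_α), which is part of W_ℓ.
    successor : ∀ x → x ∈ W → ∃ λ s → H s × s ∈̂ kp ∅ W × (∀ c → H c → c ∈̂ s ⟷ (c ∈̂ x ∨ c ≈ x))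
    successor x x∈W =
      let γ , γ∈ℓ , v , Lv , x∈v = proj₁ (Level-spec ord-ℓ LW x) x∈W
          α , α∈ℓ , γ∈α = cofinal γ γ∈ℓ
          ord-α = ord-∈ ord-ℓ α∈ℓ
          v′ , Lv′ = Level-total α ord-α
          v⊆v′ = Level-mono (ord-∈ ord-ℓ γ∈ℓ) ord-α (proj₁ ord-α γ γ∈α) Lv Lv′
          x∈v′ = proj₂ (Level-spec ord-α Lv′ x) (γ , γ∈α , v , Lv , x∈v)
          t , t-spec = exactly ((x0 ∈̂ᶠ x1) ∨ᶠ (x0 ≐ᶠ x1)) (x ∷ []) v′ λ c h →
            cases stable-∈ h (λ c∈x → v⊆v′ c (∈̂-step x∈v c∈x)) (λ c≈x → ∈-respˡ (≈-sym c≈x) x∈v′)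
          s∈W = step⊆W α α∈ℓ v′ Lv′ (kp ∅ t) (step-set λ c c∈t →
            cases stable-∈ (proj₁ (t-spec c) c∈t) (λ c∈x → v⊆v′ c (∈̂-step x∈v c∈x))
                           (λ c≈x → ∈-respˡ (≈-sym c≈x) x∈v′))
      in kp ∅ t , W⊆H _ s∈W , proj₂ (∈̂-set _) s∈W , λ c _ →
           (λ c∈s → proj₁ (t-spec c) (proj₁ (∈̂-set c) c∈s)) , (λ h → proj₂ (∈̂-set c) (proj₂ (t-spec c) h))

    successor-set : ∀ x → H x → x ∈̂ kp ∅ W → ∃ λ s → H s × s ∈̂ kp ∅ W × (∀ c → H c → c ∈̂ s ⟷ (c ∈̂ x ∨ c ≈ x))
    successor-set x _ x∈ = successor x (proj₁ (∈̂-set x) x∈)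

  S4-holds : meaning S4ᴾ []
  S4-holds = infinite-set limit-ordinal

  P1ᴾ : Translated (statement P1)
  P1ᴾ = ∀Pairᴾ (∀ᴾ (¬ᴾ (i0 ∈ᴾ i1)))

  P1-holds : meaning P1ᴾ []
  P1-holds p Hp pair a Ha (y , p≈ , _) = let _ , _ , p≈′ = pair-shape pair in set≉pair p≈ p≈′

  P2ᴾ : Translated (statement P2)
  P2ᴾ = ∀ᴾ (∀ᴾ (∃ᴾ ((i2 π₁ᴾ i0) ∧ᴾ (i1 π₂ᴾ i0))))

  P2-holds : meaning P2ᴾ []
  P2-holds a Ha b Hb = kp one (kp a b) , H-pair Ha Hb , (a , b , ≈-refl , ≈-refl) , (a , b , ≈-refl , ≈-refl)

  P3ᴾ : Translated (statement P3)
  P3ᴾ = ∀ᴾ (∃ᴾ (i0 π₁ᴾ i1) ⇔ᴾ ∃ᴾ (i0 π₂ᴾ i1))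

  P3-holds : meaning P3ᴾ []
  P3-holds p Hp = (λ (_ , _ , u , v , p≈ , _) → v , proj₂ (H-components Hp p≈) , u , v , p≈ , ≈-refl)
                , (λ (_ , _ , u , v , p≈ , _) → u , proj₁ (H-components Hp p≈) , u , v , p≈ , ≈-refl)

  P4ᴾ : Translated (statement P4)
  P4ᴾ = ∀Pairᴾ (∃ᴾ ((i0 π₁ᴾ i1) ∧ᴾ ∀ᴾ ((i0 π₁ᴾ i2) ⇒ᴾ (i0 ≐ᴾ i1)))
              ∧ᴾ ∃ᴾ ((i0 π₂ᴾ i1) ∧ᴾ ∀ᴾ ((i0 π₂ᴾ i2) ⇒ᴾ (i0 ≐ᴾ i1))))

  kp-one-injective : p ≈ kp one (kp u v) → p ≈ kp one (kp x y) → kp u v ≈ kp x y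
  kp-one-injective e e′ = kp-injectiveʳ (≈-trans (≈-sym e) e′)

  P4-holds : meaning P4ᴾ []
  P4-holds p Hp pair =
    let u , v , p≈ = pair-shape pair
        Hu , Hv = H-components Hp p≈
    in (u , Hu , (u , v , p≈ , ≈-refl) , λ b _ (u′ , v′ , p≈′ , b≈) →
          ≈-trans b≈ (kp-injectiveˡ (kp-one-injective p≈′ p≈)))
     , (v , Hv , (u , v , p≈ , ≈-refl) , λ b _ (u′ , v′ , p≈′ , b≈) →
          ≈-trans b≈ (kp-injectiveʳ (kp-one-injective p≈′ p≈)))

  P5ᴾ : Translated (statement P5)
  P5ᴾ = ∀Pairᴾ (∀Pairᴾ (∀ᴾ (((i0 π₁ᴾ i2) ⇔ᴾ (i0 π₁ᴾ i1)) ∧ᴾ ((i0 π₂ᴾ i2) ⇔ᴾ (i0 π₂ᴾ i1))) ⇒ᴾ (i1 ≐ᴾ i0)))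

  P5-holds : meaning P5ᴾ []
  P5-holds p Hp pair-p q Hq pair-q same =
    let u , v , p≈ = pair-shape pair-p
        Hu , Hv = H-components Hp p≈
        u₁ , v₁ , q≈₁ , u≈ = proj₁ (proj₁ (same u Hu)) (u , v , p≈ , ≈-refl)
        u₂ , v₂ , q≈₂ , v≈ = proj₁ (proj₂ (same v Hv)) (u , v , p≈ , ≈-refl)
        u≈u₂ = ≈-trans u≈ (kp-injectiveˡ (kp-one-injective q≈₁ q≈₂))
    in ≈-trans p≈ (≈-trans (kp-cong ≈-refl (kp-cong u≈u₂ v≈)) (≈-sym q≈₂))

  EmptySet : M → Set
  EmptySet x = H x × ¬ IsPair x × (∀ a → H a → ¬ (a ∈̂ x))

  -- (S6) contains a description, so its translation can be read only once the value of that
  -- description is known: the code of the empty set.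
  Den-empty : (ρ : Env n) → Den (trT emptyP) ρ (kp ∅ ∅)
  Den-empty {n} ρ = denotes λ x → ⟷-trans (iff (emptySet-means x)) (forth x , back x)
    where
    emptySet-means : ∀ x → Means (HZ v0 ∧̇ trF (SetP v0 ∧̇ ∀̇ (¬̇ (v0 ∈p v1)))) (x ∷ ρ) (EmptySet x)
    emptySet-means x = ∧-means (HZ-means zero (x ∷ ρ)) (correct (setᴾ i0 ∧ᴾ ∀ᴾ (¬ᴾ (i0 ∈ᴾ i1))) (x ∷ ρ))
    forth : ∀ x → EmptySet x → x ≈ kp ∅ ∅
    forth x (Hx , set-x , empty) = let y , x≈ , y⊆H = set-shape Hx set-x in
      ≈-trans x≈ (kp-cong ≈-refl (∅-unique λ a a∈y → empty a (y⊆H a a∈y) (y , x≈ , a∈y)))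
    back : ∀ x → x ≈ kp ∅ ∅ → EmptySet x
    back x x≈ = leibnizᶠ (Hᶠ zero) {[]} (≈-sym x≈) (H-set λ a a∈ → absurd stable-H (∅-spec a a∈))
              , (λ pair → let _ , _ , p = pair-shape pair in set≉pair x≈ p)
              , (λ a _ a∈x → ∅-spec a (proj₁ (set-elements x≈ a) a∈x))

  _≐∅ᴾ : (i : Fin n) → Translated (var i ≐ emptyP)
  i ≐∅ᴾ = record { meaning = λ ρ → lookup ρ i ≈ kp ∅ ∅ ; correct = λ ρ → ≐-means var-den (Den-empty ρ) }

  S6ᴾ : Translated (statement S6)
  S6ᴾ = ∀Setᴾ ((i0 ≐∅ᴾ)
               ∨ᴾ ∃∈ᴾ i0 (¬ᴾ ∃∈ᴾ i1 ((i0 π₁ᴾ i1) ∨ᴾ (i0 π₂ᴾ i1) ∨ᴾ (i0 ∈ᴾ i1))))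

  constituent-step : a ∈ step w → (b π̂₁ a ∨ (b π̂₂ a ∨ b ∈̂ a)) → b ∈ w
  constituent-step a∈ h = cases stable-∈ h
    (λ (u , v , a≈ , b≈) → ∈-respˡ (≈-sym b≈) (proj₁ (pair-step a∈ a≈))) λ h′ → cases stable-∈ h′
    (λ (u , v , a≈ , b≈) → ∈-respˡ (≈-sym b≈) (proj₂ (pair-step a∈ a≈))) (∈̂-step a∈)

  S6-holds : meaning S6ᴾ []
  S6-holds x Hx set-x = by-cases stable-¬ (λ h → right (minimal-element h)) (λ none → left (empty none))
    where
    shape : ∃ λ y → x ≈ kp ∅ y × (∀ a → a ∈ y → H a)
    shape = set-shape Hx set-x
    Y : M
    Y = proj₁ shape
    x≈ = proj₁ (proj₂ shape)
    empty : ¬ ∃ (_∈ Y) → x ≈ kp ∅ ∅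
    empty none = ≈-trans x≈ (kp-cong ≈-refl (∅-unique λ a a∈y → none (a , a∈y)))
    Reaches : M → Set
    Reaches α = ∃ λ a → a ∈ Y × InLevel α a
    least-level : ∃ (_∈ Y) → ∃ λ α → (Ord α × Reaches α) × (∀ γ → γ ∈ α → ¬ Reaches γ)
    least-level (a₀ , a₀∈Y) = let α₀ , ord-α₀ , in-α₀ = proj₂ (proj₂ shape) a₀ a₀∈Y in
      least (∃∈ᶠ x1 (inLevelᶠ x1 x0)) (Y ∷ []) ord-α₀ (a₀ , a₀∈Y , in-α₀)
    Constituent : M → M → Set
    Constituent b a = b π̂₁ a ∨ (b π̂₂ a ∨ b ∈̂ a)
    -- An element `a` of `Y` in the least level reached is in F(W_γ) for some γ below `α`, so its
    -- constituents are in W_γ. One of them in `Y` would reach a smaller level.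
    constituent-free : ∀ α → Ord α × Reaches α → (∀ γ → γ ∈ α → ¬ Reaches γ) →
                       ∃ λ a → a ∈ Y × (∀ b → b ∈ Y → ¬ Constituent b a)
    constituent-free α (ord-α , a , a∈Y , w , Lw , a∈w) below =
      let γ , γ∈α , v , Lv , a∈ = proj₁ (Level-spec ord-α Lw a) a∈w
      in a , a∈Y , λ b b∈Y h → below γ γ∈α (b , b∈Y , v , Lv , constituent-step a∈ h)
    minimal-element : ∃ (_∈ Y) → ∃ λ a → H a × a ∈̂ x × ¬ (∃ λ b → H b × b ∈̂ x × Constituent b a)
    minimal-element inhabited =
      let α , reaches , below = least-level inhabited
          a , a∈Y , free = constituent-free α reaches below
      in a , proj₂ (proj₂ shape) a a∈Y , proj₂ (set-elements x≈ a) a∈Y ,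
         λ (b , _ , b∈x , h) → free b (proj₁ (set-elements x≈ b) b∈x) h

-- The translation

relHat-ren : (f : Fin n → Fin m) (r : ZFPRel) (t u : ZTerm n) →
             relHat r (renT f t) (renT f u) ≡ renF f (relHat r t u)
relHat-ren f pmem t u rewrite renT-↑ f t | renT-↑ f u = refl
relHat-ren f pi1  t u rewrite sym (renT-↑ f t) | sym (renT-↑ f u)
                            | sym (renT-↑ (liftR f) (↑ t)) | sym (renT-↑ (liftR f) (↑ u)) = refl
relHat-ren f pi2  t u rewrite sym (renT-↑ f t) | sym (renT-↑ f u)
                            | sym (renT-↑ (liftR f) (↑ t)) | sym (renT-↑ (liftR f) (↑ u)) = refl

HZ-ren : (f : Fin n → Fin m) (i : Fin n) → HZ (var (f i)) ≡ renF f (HZ (var i))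
HZ-ren f i = refl

mutual
  trT-ren : (f : Fin n → Fin m) (t : PTerm n) → trT (renT f t) ≡ renT f (trT t)
  trT-ren f (var i)  = refl
  trT-ren f (desc φ) = cong desc (cong₂ _∧̇_ (HZ-ren (liftR f) zero) (trF-ren (liftR f) φ))

  -- Needed for (S5), where the arbitrary formula occurs renamed inside the axiom and is translated
  -- only afterwards.
  trF-ren : (f : Fin n → Fin m) (φ : PForm n) → trF (renF f φ) ≡ renF f (trF φ)
  trF-ren f (rel r t u) = trans (cong₂ (relHat r) (trT-ren f t) (trT-ren f u)) (relHat-ren f r (trT t) (trT u))
  trF-ren f (t ≐ u)     = cong₂ _≐_ (trT-ren f t) (trT-ren f u)
  trF-ren f (¬̇ φ)       = cong ¬̇_ (trF-ren f φ)
  trF-ren f (φ ⇒ ψ)     = cong₂ _⇒_ (trF-ren f φ) (trF-ren f ψ)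
  trF-ren f (∀̇ φ)       = cong ∀̇ (cong₂ _⇒_ (HZ-ren (liftR f) zero) (trF-ren (liftR f) φ))

-- The replacement schema of ZFP

module Replacement (𝓜 : Model ZFAxiom) (φ : PForm 4) where

  open Model 𝓜
  open SetTheory 𝓜
  open SetConstructions 𝓜
  open Universe 𝓜
  open Interpretation 𝓜

  -- An arbitrary formula, possibly with descriptions, has no more readable meaning than the truth
  -- of its translation; the schema needs nothing finer.
  translated : (ψ : PForm n) → Translated ψ
  translated ψ = record { meaning = ⟦ trF ψ ⟧ ; correct = λ ρ → means ⟷-refl }

  renamed : {ψ : PForm n} (f : Fin n → Fin m) (g : Env m → Env n) →
            (∀ ρ i → lookup ρ (f i) ≡ lookup (g ρ) i) → Translated ψ → Translated (renF f ψ)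
  renamed {ψ = ψ} f g eq t = record
    { meaning = λ ρ → meaning t (g ρ)
    ; correct = λ ρ → subst (λ χ → Means χ ρ (meaning t (g ρ))) (sym (trF-ren f ψ))
                            (ren-means (eq ρ) (correct t (g ρ)))
    }

  env₁ : Env 5 → Env 4
  env₁ (b ∷ a ∷ _ ∷ c₂ ∷ c₁ ∷ []) = a ∷ b ∷ c₁ ∷ c₂ ∷ []

  env₂ : Env 6 → Env 4
  env₂ (a ∷ b ∷ _ ∷ _ ∷ c₂ ∷ c₁ ∷ []) = a ∷ b ∷ c₁ ∷ c₂ ∷ []

  lookup-env₁ : ∀ ρ i → lookup ρ (s5σ₁ i) ≡ lookup (env₁ ρ) i
  lookup-env₁ (b ∷ a ∷ _ ∷ c₂ ∷ c₁ ∷ []) zero                   = refl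
  lookup-env₁ (b ∷ a ∷ _ ∷ c₂ ∷ c₁ ∷ []) (suc zero)             = refl
  lookup-env₁ (b ∷ a ∷ _ ∷ c₂ ∷ c₁ ∷ []) (suc (suc zero))       = refl
  lookup-env₁ (b ∷ a ∷ _ ∷ c₂ ∷ c₁ ∷ []) (suc (suc (suc zero))) = refl

  lookup-env₂ : ∀ ρ i → lookup ρ (s5σ₂ i) ≡ lookup (env₂ ρ) i
  lookup-env₂ (a ∷ b ∷ _ ∷ _ ∷ c₂ ∷ c₁ ∷ []) zero                   = refl
  lookup-env₂ (a ∷ b ∷ _ ∷ _ ∷ c₂ ∷ c₁ ∷ []) (suc zero)             = refl
  lookup-env₂ (a ∷ b ∷ _ ∷ _ ∷ c₂ ∷ c₁ ∷ []) (suc (suc zero))       = refl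
  lookup-env₂ (a ∷ b ∷ _ ∷ _ ∷ c₂ ∷ c₁ ∷ []) (suc (suc (suc zero))) = refl

  premise : Translated (renF s5σ₁ φ)
  premise = renamed s5σ₁ env₁ lookup-env₁ (translated φ)

  S5ᴾ : Translated (statement (S5 φ))
  S5ᴾ = ∀ᴾ (∀ᴾ (∀ᴾ (∀∈ᴾ i0 (∃ᴾ (premise ∧ᴾ ∀ᴾ (renamed skip1 drop₁ lookup-drop₁ premise ⇒ᴾ i0 ≐ᴾ i1)))
        ⇒ᴾ ∃Setᴾ (∀ᴾ (i0 ∈ᴾ i1 ⇔ᴾ ∃∈ᴾ i2 (renamed s5σ₂ env₂ lookup-env₂ (translated φ)))))))

  Holds : M → M → M → M → Set
  Holds c₁ c₂ a b = ⟦ trF φ ⟧ (a ∷ b ∷ c₁ ∷ c₂ ∷ [])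

  S5-holds : meaning S5ᴾ []
  S5-holds c₁ _ c₂ _ x Hx functional = kp ∅ Y , H-set Y⊆H , set-not-pair , λ b Hb → forth b , back b Hb
    where
    X : M
    X = proj₁ (elements x)
    X-spec : ∀ a → a ∈ X ⟷ a ∈̂ x
    X-spec = proj₂ (elements x)
    swap : Fin 4 → Fin 4
    swap zero          = suc zero
    swap (suc zero)    = zero
    swap (suc (suc i)) = suc (suc i)
    swapEnv : Env 4 → Env 4
    swapEnv (b ∷ a ∷ ρ) = a ∷ b ∷ ρ
    lookup-swap : ∀ ρ i → lookup ρ (swap i) ≡ lookup (swapEnv ρ) i
    lookup-swap (b ∷ a ∷ ρ) zero          = refl
    lookup-swap (b ∷ a ∷ ρ) (suc zero)    = refl
    lookup-swap (b ∷ a ∷ ρ) (suc (suc i)) = refl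
    image-set : ∃ λ Y → ∀ b → b ∈ Y ⟷ ∃ λ a → a ∈ X × H b × Holds c₁ c₂ a b
    -- Uniqueness of `b` is known only within H, so membership in H is made part of the relation
    -- being replaced.
    image-set = replace (Hᶠ zero ∧ᶠ renᶠ swap swapEnv lookup-swap (translatedᶠ (translated φ))) (c₁ ∷ c₂ ∷ []) X
      λ a a∈X → let a∈x = proj₁ (X-spec a) a∈X
                    b , Hb , holds , unique = functional a (H-∈̂ Hx a∈x) a∈x
                in b , (Hb , holds) , λ b′ (Hb′ , holds′) → unique b′ Hb′ holds′
    Y : M
    Y = proj₁ image-set
    Y⊆H : ∀ b → b ∈ Y → H b
    Y⊆H b b∈Y = let a , _ , Hb , _ = proj₁ (proj₂ image-set b) b∈Y in Hb
    forth : ∀ b → b ∈̂ kp ∅ Y → ∃ λ a → H a × a ∈̂ x × Holds c₁ c₂ a b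
    forth b b∈ = let a , a∈X , _ , holds = proj₁ (proj₂ image-set b) (proj₁ (∈̂-set b) b∈)
                     a∈x = proj₁ (X-spec a) a∈X
                 in a , H-∈̂ Hx a∈x , a∈x , holds
    back : ∀ b → H b → (∃ λ a → H a × a ∈̂ x × Holds c₁ c₂ a b) → b ∈̂ kp ∅ Y
    back b Hb (a , _ , a∈x , holds) =
      proj₂ (∈̂-set b) (proj₂ (proj₂ image-set b) (a , proj₂ (X-spec a) a∈x , Hb , holds))

all-relations : (r : ZFRel) → r ∈ˡ (mem ∷ [])
all-relations mem = here refl

-- Infinity is an existential sentence, and so provides the theorem asserting a nonempty domain.
open Completeness (mem ∷ []) all-relations ZFAxiom (ax infinity)

derive : {φ : PForm zero}
         (P : (𝓜 : Model ZFAxiom) → Interpretation.Translated 𝓜 φ) →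
         ((𝓜 : Model ZFAxiom) → Interpretation.meaning (P 𝓜) []) → ZFAxiom ⊢ trF φ
derive P holds = completeness λ 𝓜 →
  proj₂ (SetTheory.iff (Interpretation.correct (P 𝓜) [])) (holds 𝓜)

theorem1 : {φ : PForm zero} → ZFPAxiom φ → ZFAxiom ⊢ trF φ
theorem1 S1     = derive Axioms.S1ᴾ Axioms.S1-holds
theorem1 S2     = derive Axioms.S2ᴾ Axioms.S2-holds
theorem1 S3     = derive Axioms.S3ᴾ Axioms.S3-holds
theorem1 S4     = derive Axioms.S4ᴾ Axioms.S4-holds
theorem1 (S5 φ) = derive (λ 𝓜 → Replacement.S5ᴾ 𝓜 φ) (λ 𝓜 → Replacement.S5-holds 𝓜 φ)
theorem1 S6     = derive Axioms.S6ᴾ Axioms.S6-holds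
theorem1 P1     = derive Axioms.P1ᴾ Axioms.P1-holds
theorem1 P2     = derive Axioms.P2ᴾ Axioms.P2-holds
theorem1 P3     = derive Axioms.P3ᴾ Axioms.P3-holds
theorem1 P4     = derive Axioms.P4ᴾ Axioms.P4-holds
theorem1 P5     = derive Axioms.P5ᴾ Axioms.P5-holds
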